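{- For each of the groups $\mathbb{Z}/11\mathbb{Z}\oplus\mathbb{Z}^2$, $\mathbb{Z}/13\mathbb{Z}\oplus\mathbb{Z}$, $\mathbb{Z}/15\mathbb{Z}\oplus\mathbb{Z}$, $\mathbb{Z}/16\mathbb{Z}\oplus\mathbb{Z}$, $\mathbb{Z}/20\mathbb{Z}\oplus\mathbb{Z}$, $\mathbb{Z}/2\mathbb{Z}\oplus\mathbb{Z}/10\mathbb{Z}\oplus\mathbb{Z}$, $\mathbb{Z}/2\mathbb{Z}\oplus\mathbb{Z}/12\mathbb{Z}\oplus\mathbb{Z}$, and $\mathbb{Z}/2\mathbb{Z}\oplus\mathbb{Z}/14\mathbb{Z}\oplus\mathbb{Z}$, there exist a cubic number field $K$ and an elliptic curve $E$ over $K$ whose Mordell--Weil group $E(K)$ contains a subgroup isomorphic to that group. -}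

module Defs where

open import Data.Nat as ℕ using (ℕ; zero; suc)
open import Data.Nat.DivMod using (_mod_)
open import Data.Fin using (Fin; toℕ)
open import Data.Integer as ℤ using (ℤ; +_)
open import Data.Rational as ℚ using (ℚ)
open import Data.Product using (_×_; _,_; Σ; ∃; ∃-syntax)
open import Data.Unit using (⊤; tt)
open import Data.List using (List; []; _∷_)
open import Relation.Binary.PropositionalEquality using (_≡_; _≢_)
open import Relation.Nullary using (¬_)

-- Cubic number fields, presented as ℚ[x]/(f) with
-- f = x³ + a x² + b x + c monic and irreducible over ℚ.
-- (By the primitive element theorem every cubic number field is of this form.)

record MonicCubic : Set where
  constructor cubic
  field
    a b c : ℚ
open MonicCubic public

-- f is reducible over ℚ iff it factors as (x + r)(x² + s x + t) with
-- r s t ∈ ℚ (a factorisation into non-units, normalised to be monic).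
Reducible : MonicCubic → Set
Reducible f = ∃[ r ] ∃[ s ] ∃[ t ]
  ( (r ℚ.+ s ≡ a f)
  × (ℚ._+_ (r ℚ.* s) t ≡ b f)
  × (r ℚ.* t ≡ c f) )
  -- (x + r)(x² + s x + t) = x³ + (r+s) x² + (rs+t) x + rt

Irreducible : MonicCubic → Set
Irreducible f = ¬ Reducible f

-- Elements of K = ℚ[x]/(f): p₀ + p₁ α + p₂ α², α the class of x.
record K (f : MonicCubic) : Set where
  constructor ⟨_,_,_⟩
  field
    k0 k1 k2 : ℚ
open K public

module Field (f : MonicCubic) where
  private
    A = a f
    B = b f
    C = c f

  emb : ℚ → K f
  emb q = ⟨ q , ℚ.0ℚ , ℚ.0ℚ ⟩

  nat : ℕ → K f
  nat n = emb (+ n ℚ./ 1)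

  0K 1K : K f
  0K = nat 0
  1K = nat 1

  _+K_ : K f → K f → K f
  p +K q = ⟨ k0 p ℚ.+ k0 q , k1 p ℚ.+ k1 q , k2 p ℚ.+ k2 q ⟩

  -K_ : K f → K f
  -K p = ⟨ ℚ.- k0 p , ℚ.- k1 p , ℚ.- k2 p ⟩

  _-K_ : K f → K f → K f
  p -K q = p +K (-K q)

  -- multiplication, reducing with α³ = -Aα² - Bα - C and
  -- α⁴ = (A² - B)α² + (AB - C)α + AC
  _*K_ : K f → K f → K f
  p *K q = ⟨ c0 ℚ.- (C ℚ.* c3) ℚ.+ (A ℚ.* C) ℚ.* c4
           , c1 ℚ.- (B ℚ.* c3) ℚ.+ ((A ℚ.* B) ℚ.- C) ℚ.* c4
           , c2 ℚ.- (A ℚ.* c3) ℚ.+ ((A ℚ.* A) ℚ.- B) ℚ.* c4 ⟩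
    where
      c0 = k0 p ℚ.* k0 q
      c1 = k0 p ℚ.* k1 q ℚ.+ k1 p ℚ.* k0 q
      c2 = k0 p ℚ.* k2 q ℚ.+ k1 p ℚ.* k1 q ℚ.+ k2 p ℚ.* k0 q
      c3 = k1 p ℚ.* k2 q ℚ.+ k2 p ℚ.* k1 q
      c4 = k2 p ℚ.* k2 q

  infixl 6 _+K_ _-K_
  infixl 7 _*K_

record Weierstrass (f : MonicCubic) : Set where
  constructor weierstrass
  field
    a1 a2 a3 a4 a6 : K f
open Weierstrass public

module Curve {f : MonicCubic} (E : Weierstrass f) where
  open Field f

  b2 b4 b6 b8 Δ : K f
  b2 = a1 E *K a1 E +K nat 4 *K a2 E
  b4 = nat 2 *K a4 E +K a1 E *K a3 E
  b6 = a3 E *K a3 E +K nat 4 *K a6 E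
  b8 = a1 E *K a1 E *K a6 E +K nat 4 *K a2 E *K a6 E -K a1 E *K a3 E *K a4 E
       +K a2 E *K a3 E *K a3 E -K a4 E *K a4 E
  Δ = -K (b2 *K b2 *K b8) -K nat 8 *K b4 *K b4 *K b4
      -K nat 27 *K b6 *K b6 +K nat 9 *K b2 *K b4 *K b6

  data Point : Set where
    O   : Point
    aff : K f → K f → Point

  OnCurve : Point → Set
  OnCurve O = ⊤
  OnCurve (aff x y) =
    y *K y +K a1 E *K x *K y +K a3 E *K y
      ≡ x *K x *K x +K a2 E *K x *K x +K a4 E *K x +K a6 E

  negY : K f → K f → K f
  negY x y = -K y -K a1 E *K x -K a3 E

  -- third point from slope λ (with ν = y₁ - λ x₁)
  x₃ : K f → K f → K f → K f
  x₃ λ' x1 x2 = λ' *K λ' +K a1 E *K λ' -K a2 E -K x1 -K x2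

  y₃ : K f → K f → K f → K f → K f
  y₃ λ' x1 y1 x3 = -K ((λ' +K a1 E) *K x3) -K (y1 -K λ' *K x1) -K a3 E

  data Add : Point → Point → Point → Set where
    O-left  : ∀ P → Add O P P
    O-right : ∀ P → Add P O P
    inverse : ∀ {x1 y1 x2 y2} → x1 ≡ x2 → y2 ≡ negY x1 y1 →
              Add (aff x1 y1) (aff x2 y2) O
    chord   : ∀ {x1 y1 x2 y2} (λ' : K f) → x1 ≢ x2 →
              λ' *K (x2 -K x1) ≡ y2 -K y1 →
              Add (aff x1 y1) (aff x2 y2)
                  (aff (x₃ λ' x1 x2) (y₃ λ' x1 y1 (x₃ λ' x1 x2)))
    tangent : ∀ {x1 y1} (λ' : K f) → y1 ≢ negY x1 y1 →
              λ' *K (nat 2 *K y1 +K a1 E *K x1 +K a3 E)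
                ≡ nat 3 *K x1 *K x1 +K nat 2 *K a2 E *K x1 +K a4 E -K a1 E *K y1 →
              Add (aff x1 y1) (aff x1 y1)
                  (aff (x₃ λ' x1 x1) (y₃ λ' x1 y1 (x₃ λ' x1 x1)))

EllipticCurve : MonicCubic → Set
EllipticCurve f = Σ (Weierstrass f) λ E → Curve.Δ E ≢ Field.0K f

data Factor : Set where
  zmod : ℕ → Factor     -- ℤ/nℤ (used with n ≥ 1)
  zz   : Factor

FElem : Factor → Set
FElem (zmod n) = Fin n
FElem zz = ℤ

faddF : (φ : Factor) → FElem φ → FElem φ → FElem φ
faddF (zmod zero) () _
faddF (zmod (suc n)) i j = (toℕ i ℕ.+ toℕ j) mod (suc n)
faddF zz x y = x ℤ.+ y

Carrier : List Factor → Set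
Carrier [] = ⊤
Carrier (φ ∷ φs) = FElem φ × Carrier φs

gadd : (G : List Factor) → Carrier G → Carrier G → Carrier G
gadd [] _ _ = tt
gadd (φ ∷ φs) (x , xs) (y , ys) = faddF φ x y , gadd φs xs ys

ContainsSubgroupIso : {f : MonicCubic} → Weierstrass f → List Factor → Set
ContainsSubgroupIso E G =
  Σ (Carrier G → Point) λ h →
      (∀ g → OnCurve (h g))
    × (∀ g g' → Add (h g) (h g') (h (gadd G g g')))
    × (∀ g g' → h g ≡ h g' → g ≡ g')
  where open Curve E

CubicRealizable : List Factor → Set
CubicRealizable G =
  Σ MonicCubic λ f → Irreducible f ×
    Σ (EllipticCurve f) λ E → ContainsSubgroupIso (Data.Product.proj₁ E) G

theGroups : List (List Factor)
theGroups =
    (zmod 11 ∷ zz ∷ zz ∷ [])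
  ∷ (zmod 13 ∷ zz ∷ [])
  ∷ (zmod 15 ∷ zz ∷ [])
  ∷ (zmod 16 ∷ zz ∷ [])
  ∷ (zmod 20 ∷ zz ∷ [])
  ∷ (zmod 2 ∷ zmod 10 ∷ zz ∷ [])
  ∷ (zmod 2 ∷ zmod 12 ∷ zz ∷ [])
  ∷ (zmod 2 ∷ zmod 14 ∷ zz ∷ [])
  ∷ []

{-# OPTIONS --safe #-}

-- The group law. Products of ideals of the coordinate ring of y² = x³ + g₂x² + g₁x + g₀ are associative
-- up to principal factors; sending a point to its maximal ideal turns chords and tangents into products,
-- and it is injective because an element of the ring has no pole of order exactly 1 at infinity.
-- Hence addition of points is associative.
--
-- The subgroups. A torsion point T of order n is certified by the list of its multiples. Points
-- P₁, …, Pᵣ are independent modulo torsion as soon as no nonempty subsum of the Pᵢ and of generators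
-- of the 2-primary torsion is divisible by 2: a relation between them can be halved until one of its
-- coefficients is odd. A point Q = 2R makes x(R) a root of a monic quartic with coefficients in ℤ[α],
-- and that quartic has no root modulo a small prime.
module Submission where


-- The embedding must respect addition on an infinite group, so the group law is needed on all of
-- E(K) and not just on the listed points. A proof of associativity in coordinates would have to
-- cross chord, tangent and vertical cases for four sums; with ideal classes each constructor of
-- `Sum` is treated once. Independence is tested through divisibility by 2 because that is a finite
-- check, unlike a height estimate. It requires the 2-torsion exactly, since halving a relation is
-- ambiguous up to it; hence three shapes of curve. The obstacle in the check is the denominator of
-- a putative half R. Its x-coordinate is an algebraic integer, being a root of a monic quartic, but
-- it need not lie in ℤ[α] localised at p, so it might have no residue at all. Testing also that the
-- ring modulo p has no nonzero nilpotents removes this difficulty. Every model is scaled until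
-- coefficients, points and slopes all lie in ℤ[α].

-- Ring identities by normalisation of dense integer polynomials

module RingSolving where
  open import Algebra.Bundles using (CommutativeRing)
  open import Data.Bool using (Bool; true; false; _∧_)
  open import Data.Fin using (Fin; zero; suc)
  open import Data.Integer as ℤ using (ℤ; +_; -[1+_])
  import Data.Integer.Properties as ℤₚ
  open import Data.List using (List; []; _∷_)
  open import Data.Nat as ℕ using (ℕ; zero; suc)
  open import Data.Product using (_×_; _,_; proj₁; proj₂)
  open import Data.Vec as Vec using (Vec; []; _∷_)
  open import Data.Vec.N-ary
  open import Relation.Binary.PropositionalEquality as ≡ using (_≡_; refl)

  -- Polynomials with integer coefficients, dense in each variable.

  Poly : ℕ → Set
  Poly zero    = ℤ
  Poly (suc n) = List (Poly n)

  zeroP : ∀ {n} → Poly n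
  zeroP {zero}  = + 0
  zeroP {suc n} = []

  conP : ∀ {n} → ℤ → Poly n
  conP {zero}  z = z
  conP {suc n} z = conP z ∷ []

  varP : ∀ {n} → Fin n → Poly n
  varP zero    = zeroP ∷ conP (+ 1) ∷ []
  varP (suc i) = varP i ∷ []

  -- Normal forms are not unique, since trailing zero coefficients are never trimmed. Vanishing is
  -- therefore tested entry by entry, and the two sides of an identity are compared through their
  -- difference.
  isZero : ∀ {n} → Poly n → Bool
  isZero {zero}  (+ 0)    = true
  isZero {zero}  _        = false
  isZero {suc n} []       = true
  isZero {suc n} (p ∷ ps) = isZero p ∧ isZero {suc n} ps

  infixl 6 _+P_
  infixl 7 _*P_

  _+P_ : ∀ {n} → Poly n → Poly n → Poly n
  _+P_ {zero}  p q = p ℤ.+ q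
  _+P_ {suc n} [] qs = qs
  _+P_ {suc n} (p ∷ ps) [] = p ∷ ps
  _+P_ {suc n} (p ∷ ps) (q ∷ qs) = (p +P q) ∷ _+P_ {suc n} ps qs

  -P_ : ∀ {n} → Poly n → Poly n
  -P_ {zero}  p = ℤ.- p
  -P_ {suc n} [] = []
  -P_ {suc n} (p ∷ ps) = (-P p) ∷ (-P_ {suc n} ps)

  mutual
    _*P_ : ∀ {n} → Poly n → Poly n → Poly n
    _*P_ {zero}  p q = p ℤ.* q
    _*P_ {suc n} [] qs = []
    _*P_ {suc n} (p ∷ ps) qs = scaleP (isZero p) p qs +P (zeroP ∷ (_*P_ {suc n} ps qs))

    -- The flag lets a zero coefficient be dropped instead of being multiplied through, which keeps
    -- dense products in a dozen variables manageable.
    scaleP : ∀ {n} → Bool → Poly n → Poly (suc n) → Poly (suc n)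
    scaleP true  p qs = []
    scaleP false p [] = []
    scaleP false p (q ∷ qs) = (p *P q) ∷ scaleP false p qs

  infixl 6 _:+_ _:-_
  infixl 7 _:*_
  infix 8 :-_
  infix 4 _:=_

  -- `:1` differs from `con (+ 1)`, whose value unfolds to `1# + 0#`: it denotes the unit of an
  -- abstract ring literally.
  data Expr (n : ℕ) : Set where
    con  : ℤ → Expr n
    :1   : Expr n
    var  : Fin n → Expr n
    _:+_ _:*_ : Expr n → Expr n → Expr n
    :-_  : Expr n → Expr n

  _:-_ : ∀ {n} → Expr n → Expr n → Expr n
  e :- e′ = e :+ (:- e′)

  num : ∀ {n} → ℕ → Expr n
  num k = con (+ k)

  norm : ∀ {n} → Expr n → Poly n
  norm (con z)   = conP z
  norm :1        = conP (+ 1)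
  norm (var i)   = varP i
  norm (e :+ e′) = norm e +P norm e′
  norm (e :* e′) = norm e *P norm e′
  norm (:- e)    = -P (norm e)

  _:=_ : ∀ {n} → Expr n → Expr n → Expr n × Expr n
  _:=_ = _,_

  module RingSolver {c ℓ} (R : CommutativeRing c ℓ) where
    open CommutativeRing R renaming (Carrier to A; refl to ≈-refl; sym to ≈-sym; trans to ≈-trans)
    open import Algebra.Properties.Semiring.Mult semiring using (×-homo-+; ×1-homo-*) renaming (_×_ to _·_)
    open import Algebra.Properties.Ring ring using (-‿distribˡ-*; -‿distribʳ-*; -0#≈0#; -‿involutive; -‿+-comm)
    open import Algebra.Properties.CommutativeSemigroup +-commutativeSemigroup using (interchange)
    import Algebra.Properties.CommutativeSemigroup *-commutativeSemigroup as ×ₚ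
    open import Relation.Binary.Reasoning.Setoid setoid

    ⟦_⟧ℤ : ℤ → A
    ⟦ + n ⟧ℤ      = n · 1#
    ⟦ -[1+ n ] ⟧ℤ = - (suc n · 1#)

    ⊖-homo : ∀ m n → ⟦ m ℤ.⊖ n ⟧ℤ ≈ (m · 1#) - (n · 1#)
    ⊖-homo zero    zero    = ≈-sym (-‿inverseʳ 0#)
    ⊖-homo zero    (suc n) = ≈-sym (+-identityˡ _)
    ⊖-homo (suc m) zero    = ≈-sym (≈-trans (+-congˡ -0#≈0#) (+-identityʳ _))
    ⊖-homo (suc m) (suc n) = begin
      ⟦ suc m ℤ.⊖ suc n ⟧ℤ                      ≡⟨ ≡.cong ⟦_⟧ℤ (ℤₚ.[1+m]⊖[1+n]≡m⊖n m n) ⟩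
      ⟦ m ℤ.⊖ n ⟧ℤ                              ≈⟨ ⊖-homo m n ⟩
      (m · 1#) - (n · 1#)                       ≈⟨ +-identityˡ _ ⟨
      0# + ((m · 1#) - (n · 1#))                ≈⟨ +-congʳ (-‿inverseʳ 1#) ⟨
      (1# - 1#) + ((m · 1#) - (n · 1#))         ≈⟨ interchange _ _ _ _ ⟩
      (1# + m · 1#) + (- 1# + - (n · 1#))       ≈⟨ +-congˡ (-‿+-comm _ _) ⟩
      (suc m · 1#) - (suc n · 1#)               ∎

    +-homo : ∀ x y → ⟦ x ℤ.+ y ⟧ℤ ≈ ⟦ x ⟧ℤ + ⟦ y ⟧ℤ
    +-homo (+ m)    (+ n)    = ×-homo-+ 1# m n
    +-homo (+ m)    -[1+ n ] = ⊖-homo m (suc n)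
    +-homo -[1+ m ] (+ n)    = ≈-trans (⊖-homo n (suc m)) (+-comm _ _)
    +-homo -[1+ m ] -[1+ n ] = begin
      - (suc (suc (m ℕ.+ n)) · 1#)         ≈⟨ -‿cong (reflexive (≡.cong (_· 1#) (ℕsuc m n))) ⟩
      - ((suc m ℕ.+ suc n) · 1#)           ≈⟨ -‿cong (×-homo-+ 1# (suc m) (suc n)) ⟩
      - (suc m · 1# + suc n · 1#)          ≈⟨ -‿+-comm _ _ ⟨
      - (suc m · 1#) - (suc n · 1#)        ∎
      where
      open import Data.Nat.Properties using (+-suc)
      ℕsuc : ∀ m n → suc (suc (m ℕ.+ n)) ≡ suc m ℕ.+ suc n
      ℕsuc m n = ≡.sym (≡.cong suc (+-suc m n))

    neg-homo : ∀ x → ⟦ ℤ.- x ⟧ℤ ≈ - ⟦ x ⟧ℤ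
    neg-homo (+ zero)  = ≈-sym -0#≈0#
    neg-homo (+ suc n) = ≈-refl
    neg-homo -[1+ n ]  = ≈-sym (-‿involutive _)

    *-homo⁺ : ∀ m y → ⟦ + m ℤ.* y ⟧ℤ ≈ (m · 1#) * ⟦ y ⟧ℤ
    *-homo⁺ m (+ n) = ≈-trans (reflexive (≡.cong ⟦_⟧ℤ (≡.sym (ℤₚ.pos-* m n)))) (×1-homo-* m n)
    *-homo⁺ m -[1+ n ] = begin
      ⟦ + m ℤ.* -[1+ n ] ⟧ℤ             ≡⟨ ≡.cong ⟦_⟧ℤ (ℤₚ.neg-distribʳ-* (+ m) (+ suc n)) ⟨
      ⟦ ℤ.- (+ m ℤ.* + suc n) ⟧ℤ        ≈⟨ neg-homo (+ m ℤ.* + suc n) ⟩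
      - ⟦ + m ℤ.* + suc n ⟧ℤ            ≈⟨ -‿cong (*-homo⁺ m (+ suc n)) ⟩
      - ((m · 1#) * (suc n · 1#))       ≈⟨ -‿distribʳ-* _ _ ⟩
      (m · 1#) * - (suc n · 1#)         ∎

    *-homo : ∀ x y → ⟦ x ℤ.* y ⟧ℤ ≈ ⟦ x ⟧ℤ * ⟦ y ⟧ℤ
    *-homo (+ m)    y = *-homo⁺ m y
    *-homo -[1+ m ] y = begin
      ⟦ -[1+ m ] ℤ.* y ⟧ℤ               ≡⟨ ≡.cong ⟦_⟧ℤ (ℤₚ.neg-distribˡ-* (+ suc m) y) ⟨
      ⟦ ℤ.- (+ suc m ℤ.* y) ⟧ℤ          ≈⟨ neg-homo (+ suc m ℤ.* y) ⟩
      - ⟦ + suc m ℤ.* y ⟧ℤ              ≈⟨ -‿cong (*-homo⁺ (suc m) y) ⟩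
      - ((suc m · 1#) * ⟦ y ⟧ℤ)         ≈⟨ -‿distribˡ-* _ _ ⟩
      - (suc m · 1#) * ⟦ y ⟧ℤ           ∎

    ⟦_⟧P : ∀ {n} → Poly n → Vec A n → A
    ⟦_⟧P {zero}  p        ρ       = ⟦ p ⟧ℤ
    ⟦_⟧P {suc n} []       ρ       = 0#
    ⟦_⟧P {suc n} (p ∷ ps) (x ∷ ρ) = ⟦ p ⟧P ρ + x * ⟦_⟧P {suc n} ps (x ∷ ρ)

    zeroP-sound : ∀ {n} (ρ : Vec A n) → ⟦ zeroP {n} ⟧P ρ ≈ 0#
    zeroP-sound []      = ≈-refl
    zeroP-sound (x ∷ ρ) = ≈-refl

    +x*0 : ∀ a x → a + x * 0# ≈ a
    +x*0 a x = ≈-trans (+-congˡ (zeroʳ x)) (+-identityʳ a)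

    conP-sound : ∀ {n} z (ρ : Vec A n) → ⟦ conP {n} z ⟧P ρ ≈ ⟦ z ⟧ℤ
    conP-sound z []      = ≈-refl
    conP-sound z (x ∷ ρ) = ≈-trans (+x*0 _ x) (conP-sound z ρ)

    varP-sound : ∀ {n} (i : Fin n) (ρ : Vec A n) → ⟦ varP i ⟧P ρ ≈ Vec.lookup ρ i
    varP-sound zero (x ∷ ρ) = begin
      ⟦ zeroP ⟧P ρ + x * (⟦ conP (+ 1) ⟧P ρ + x * 0#)
        ≈⟨ +-cong (zeroP-sound ρ) (*-congˡ (≈-trans (+x*0 _ x) (conP-sound (+ 1) ρ))) ⟩
      0# + x * (1# + 0#)   ≈⟨ +-identityˡ _ ⟩
      x * (1# + 0#)        ≈⟨ *-congˡ (+-identityʳ 1#) ⟩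
      x * 1#               ≈⟨ *-identityʳ x ⟩
      x ∎
    varP-sound (suc i) (x ∷ ρ) = ≈-trans (+x*0 _ x) (varP-sound i ρ)

    isZero-sound : ∀ {n} (p : Poly n) → isZero p ≡ true → ∀ ρ → ⟦ p ⟧P ρ ≈ 0#
    isZero-sound {zero}  (+ 0) _ ρ = ≈-refl
    isZero-sound {suc n} [] _ ρ = ≈-refl
    isZero-sound {suc n} (p ∷ ps) e (x ∷ ρ) with isZero p in ep
    ... | true = ≈-trans (+-cong (isZero-sound p ep ρ)
                                 (≈-trans (*-congˡ (isZero-sound {suc n} ps e (x ∷ ρ))) (zeroʳ x)))
                         (+-identityˡ 0#)

    +P-sound : ∀ {n} (p q : Poly n) ρ → ⟦ p +P q ⟧P ρ ≈ ⟦ p ⟧P ρ + ⟦ q ⟧P ρ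
    +P-sound {zero}  p q ρ = +-homo p q
    +P-sound {suc n} [] q ρ = ≈-sym (+-identityˡ _)
    +P-sound {suc n} (p ∷ ps) [] ρ = ≈-sym (+-identityʳ _)
    +P-sound {suc n} (p ∷ ps) (q ∷ qs) (x ∷ ρ) = begin
      ⟦ p +P q ⟧P ρ + x * ⟦ _+P_ {suc n} ps qs ⟧P (x ∷ ρ)
        ≈⟨ +-cong (+P-sound p q ρ) (≈-trans (*-congˡ (+P-sound {suc n} ps qs (x ∷ ρ))) (distribˡ x _ _)) ⟩
      (⟦ p ⟧P ρ + ⟦ q ⟧P ρ) + (x * ⟦_⟧P {suc n} ps (x ∷ ρ) + x * ⟦_⟧P {suc n} qs (x ∷ ρ))
        ≈⟨ interchange _ _ _ _ ⟩
      _ ∎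

    -P-sound : ∀ {n} (p : Poly n) ρ → ⟦ -P p ⟧P ρ ≈ - ⟦ p ⟧P ρ
    -P-sound {zero}  p ρ = neg-homo p
    -P-sound {suc n} [] ρ = ≈-sym -0#≈0#
    -P-sound {suc n} (p ∷ ps) (x ∷ ρ) = begin
      ⟦ -P p ⟧P ρ + x * ⟦ -P_ {suc n} ps ⟧P (x ∷ ρ)
        ≈⟨ +-cong (-P-sound p ρ) (≈-trans (*-congˡ (-P-sound {suc n} ps (x ∷ ρ))) (≈-sym (-‿distribʳ-* x _))) ⟩
      - ⟦ p ⟧P ρ + - (x * ⟦_⟧P {suc n} ps (x ∷ ρ))
        ≈⟨ -‿+-comm _ _ ⟩
      _ ∎

    mutual
      *P-sound : ∀ {n} (p q : Poly n) ρ → ⟦ p *P q ⟧P ρ ≈ ⟦ p ⟧P ρ * ⟦ q ⟧P ρ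
      *P-sound {zero}  p q ρ = *-homo p q
      *P-sound {suc n} [] q ρ = ≈-sym (zeroˡ _)
      *P-sound {suc n} (p ∷ ps) q (x ∷ ρ) = begin
        ⟦ scaleP (isZero p) p q +P (zeroP ∷ (_*P_ {suc n} ps q)) ⟧P (x ∷ ρ)
          ≈⟨ +P-sound (scaleP (isZero p) p q) (zeroP ∷ (_*P_ {suc n} ps q)) (x ∷ ρ) ⟩
        ⟦ scaleP (isZero p) p q ⟧P (x ∷ ρ) + (⟦ zeroP ⟧P ρ + x * ⟦ _*P_ {suc n} ps q ⟧P (x ∷ ρ))
          ≈⟨ +-cong (scaleP-sound (isZero p) p q refl x ρ)
                    (≈-trans (+-congʳ (zeroP-sound ρ)) (≈-trans (+-identityˡ _)
                      (≈-trans (*-congˡ (*P-sound {suc n} ps q (x ∷ ρ))) (≈-sym (*-assoc x _ _))))) ⟩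
        ⟦ p ⟧P ρ * ⟦ q ⟧P (x ∷ ρ) + x * ⟦_⟧P {suc n} ps (x ∷ ρ) * ⟦ q ⟧P (x ∷ ρ)
          ≈⟨ distribʳ _ _ _ ⟨
        _ ∎

      scaleP-sound : ∀ {n} b (p : Poly n) (qs : Poly (suc n)) → isZero p ≡ b → ∀ x ρ →
                     ⟦ scaleP b p qs ⟧P (x ∷ ρ) ≈ ⟦ p ⟧P ρ * ⟦ qs ⟧P (x ∷ ρ)
      scaleP-sound true p qs e x ρ = ≈-sym (≈-trans (*-congʳ (isZero-sound p e ρ)) (zeroˡ _))
      scaleP-sound false p [] e x ρ = ≈-sym (zeroʳ _)
      scaleP-sound false p (q ∷ qs) e x ρ = begin
        ⟦ p *P q ⟧P ρ + x * ⟦ scaleP false p qs ⟧P (x ∷ ρ)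
          ≈⟨ +-cong (*P-sound p q ρ) (≈-trans (*-congˡ (scaleP-sound false p qs e x ρ)) (×ₚ.x∙yz≈y∙xz x _ _)) ⟩
        ⟦ p ⟧P ρ * ⟦ q ⟧P ρ + ⟦ p ⟧P ρ * (x * ⟦ qs ⟧P (x ∷ ρ))
          ≈⟨ distribˡ _ _ _ ⟨
        _ ∎

    ⟦_⟧E : ∀ {n} → Expr n → Vec A n → A
    ⟦ con z ⟧E   ρ = ⟦ z ⟧ℤ
    ⟦ :1 ⟧E      ρ = 1#
    ⟦ var i ⟧E   ρ = Vec.lookup ρ i
    ⟦ e :+ e′ ⟧E ρ = ⟦ e ⟧E ρ + ⟦ e′ ⟧E ρ
    ⟦ e :* e′ ⟧E ρ = ⟦ e ⟧E ρ * ⟦ e′ ⟧E ρ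
    ⟦ :- e ⟧E    ρ = - ⟦ e ⟧E ρ

    norm-sound : ∀ {n} (e : Expr n) ρ → ⟦ norm e ⟧P ρ ≈ ⟦ e ⟧E ρ
    norm-sound (con z)   ρ = conP-sound z ρ
    norm-sound :1        ρ = ≈-trans (conP-sound (+ 1) ρ) (+-identityʳ 1#)
    norm-sound (var i)   ρ = varP-sound i ρ
    norm-sound (e :+ e′) ρ = ≈-trans (+P-sound (norm e) (norm e′) ρ) (+-cong (norm-sound e ρ) (norm-sound e′ ρ))
    norm-sound (e :* e′) ρ = ≈-trans (*P-sound (norm e) (norm e′) ρ) (*-cong (norm-sound e ρ) (norm-sound e′ ρ))
    norm-sound (:- e)    ρ = ≈-trans (-P-sound (norm e) ρ) (-‿cong (norm-sound e ρ))

    prove : ∀ {n} (e e′ : Expr n) → isZero (norm (e :- e′)) ≡ true → ∀ ρ → ⟦ e ⟧E ρ ≈ ⟦ e′ ⟧E ρ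
    prove e e′ z ρ = begin
      ⟦ e ⟧E ρ                              ≈⟨ +-identityʳ _ ⟨
      ⟦ e ⟧E ρ + 0#                         ≈⟨ +-congˡ (-‿inverseˡ _) ⟨
      ⟦ e ⟧E ρ + (- ⟦ e′ ⟧E ρ + ⟦ e′ ⟧E ρ)  ≈⟨ +-assoc _ _ _ ⟨
      ⟦ e :- e′ ⟧E ρ + ⟦ e′ ⟧E ρ            ≈⟨ +-congʳ (≈-trans (≈-sym (norm-sound (e :- e′) ρ)) (isZero-sound (norm (e :- e′)) z ρ)) ⟩
      0# + ⟦ e′ ⟧E ρ                        ≈⟨ +-identityˡ _ ⟩
      ⟦ e′ ⟧E ρ                             ∎

    close : ∀ {a} {B : Set a} n → N-ary n (Expr n) B → B
    close n f = f $ⁿ Vec.map var (Vec.allFin n)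

    solve : ∀ n (f : N-ary n (Expr n) (Expr n × Expr n)) →
            isZero (norm (proj₁ (close n f) :- proj₂ (close n f))) ≡ true →
            Eq n _≈_ (curryⁿ ⟦ proj₁ (close n f) ⟧E) (curryⁿ ⟦ proj₂ (close n f) ⟧E)
    solve n f z = curryⁿ-cong _≈_ ⟦ proj₁ (close n f) ⟧E ⟦ proj₂ (close n f) ⟧E
                    (prove (proj₁ (close n f)) (proj₂ (close n f)) z)

-- The ring ℚ[x]/(f), and inverses when f is irreducible

module CubicFields where
  open RingSolving
  open import Defs
  open import Algebra.Bundles using (CommutativeRing)
  open import Data.Integer using (+_)
  open import Data.Nat using (ℕ)
  open import Data.Rational as ℚ using (ℚ; 0ℚ; 1ℚ)
  import Data.Rational.Properties as ℚₚ
  open import Data.Product using (_,_; ∃-syntax)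
  open import Relation.Nullary using (yes; no; Dec)
  open import Relation.Binary.PropositionalEquality as ≡ using (_≡_; _≢_; refl; sym; trans; cong; cong₂; subst; module ≡-Reasoning)

  open RingSolver ℚₚ.+-*-commutativeRing using () renaming (solve to solveℚ)

  K-≡ : ∀ {f} {p q : K f} → k0 p ≡ k0 q → k1 p ≡ k1 q → k2 p ≡ k2 q → p ≡ q
  K-≡ refl refl refl = refl

  -- Multiplication of Defs.K on symbolic coordinates.
  record Expr³ (n : ℕ) : Set where
    constructor E
    field e0 e1 e2 : Expr n
  open Expr³

  infixl 6 _⊞_

  _⊞_ : ∀ {n} → Expr³ n → Expr³ n → Expr³ n
  E x y z ⊞ E x′ y′ z′ = E (x :+ x′) (y :+ y′) (z :+ z′)

  mulE : ∀ {n} → (A B C : Expr n) → Expr³ n → Expr³ n → Expr³ n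
  mulE A B C (E x y z) (E x′ y′ z′) = E
    (x :* x′ :- C :* (y :* z′ :+ z :* y′) :+ (A :* C) :* (z :* z′))
    ((x :* y′ :+ y :* x′) :- B :* (y :* z′ :+ z :* y′) :+ (A :* B :- C) :* (z :* z′))
    ((x :* z′ :+ y :* y′ :+ z :* x′) :- A :* (y :* z′ :+ z :* y′) :+ (A :* A :- B) :* (z :* z′))

  ℚ-inverse : ∀ q → q ≢ 0ℚ → ∃[ q′ ] q ℚ.* q′ ≡ 1ℚ
  ℚ-inverse q q≢0 = ℚ.1/ q , ℚₚ.*-inverseʳ q
    where instance _ = ℚ.≢-nonZero q≢0

  module KRing (f : MonicCubic) where
    open Field f
    private
      A B C : ℚ
      A = a f
      B = b f
      C = c f

    _≟K_ : (p q : K f) → Dec (p ≡ q)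
    p ≟K q with k0 p ℚₚ.≟ k0 q | k1 p ℚₚ.≟ k1 q | k2 p ℚₚ.≟ k2 q
    ... | yes e | yes e′ | yes e″ = yes (K-≡ e e′ e″)
    ... | no ¬e | _ | _ = no λ { refl → ¬e refl }
    ... | _ | no ¬e | _ = no λ { refl → ¬e refl }
    ... | _ | _ | no ¬e = no λ { refl → ¬e refl }

    +K-assoc : ∀ p q r → (p +K q) +K r ≡ p +K (q +K r)
    +K-assoc ⟨ x , y , z ⟩ ⟨ x′ , y′ , z′ ⟩ ⟨ x″ , y″ , z″ ⟩ =
      K-≡ (ℚₚ.+-assoc x x′ x″) (ℚₚ.+-assoc y y′ y″) (ℚₚ.+-assoc z z′ z″)

    +K-comm : ∀ p q → p +K q ≡ q +K p
    +K-comm ⟨ x , y , z ⟩ ⟨ x′ , y′ , z′ ⟩ = K-≡ (ℚₚ.+-comm x x′) (ℚₚ.+-comm y y′) (ℚₚ.+-comm z z′)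

    +K-identityˡ : ∀ p → 0K +K p ≡ p
    +K-identityˡ ⟨ x , y , z ⟩ = K-≡ (ℚₚ.+-identityˡ x) (ℚₚ.+-identityˡ y) (ℚₚ.+-identityˡ z)

    -K-inverseˡ : ∀ p → (-K p) +K p ≡ 0K
    -K-inverseˡ ⟨ x , y , z ⟩ = K-≡ (ℚₚ.+-inverseˡ x) (ℚₚ.+-inverseˡ y) (ℚₚ.+-inverseˡ z)

    *K-comm : ∀ p q → p *K q ≡ q *K p
    *K-comm ⟨ x , y , z ⟩ ⟨ x′ , y′ , z′ ⟩ = K-≡
      (solveℚ 9 (λ A B C x y z x′ y′ z′ → let P = E x y z; Q = E x′ y′ z′; _⊠_ = mulE A B C in
          e0 (P ⊠ Q) := e0 (Q ⊠ P)) refl A B C x y z x′ y′ z′)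
      (solveℚ 9 (λ A B C x y z x′ y′ z′ → let P = E x y z; Q = E x′ y′ z′; _⊠_ = mulE A B C in
          e1 (P ⊠ Q) := e1 (Q ⊠ P)) refl A B C x y z x′ y′ z′)
      (solveℚ 9 (λ A B C x y z x′ y′ z′ → let P = E x y z; Q = E x′ y′ z′; _⊠_ = mulE A B C in
          e2 (P ⊠ Q) := e2 (Q ⊠ P)) refl A B C x y z x′ y′ z′)

    *K-assoc : ∀ p q r → (p *K q) *K r ≡ p *K (q *K r)
    *K-assoc ⟨ x , y , z ⟩ ⟨ x′ , y′ , z′ ⟩ ⟨ x″ , y″ , z″ ⟩ = K-≡
      (solveℚ 12 (λ A B C x y z x′ y′ z′ x″ y″ z″ →
          let P = E x y z; Q = E x′ y′ z′; R = E x″ y″ z″; _⊠_ = mulE A B C in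
          e0 ((P ⊠ Q) ⊠ R) := e0 (P ⊠ (Q ⊠ R))) refl A B C x y z x′ y′ z′ x″ y″ z″)
      (solveℚ 12 (λ A B C x y z x′ y′ z′ x″ y″ z″ →
          let P = E x y z; Q = E x′ y′ z′; R = E x″ y″ z″; _⊠_ = mulE A B C in
          e1 ((P ⊠ Q) ⊠ R) := e1 (P ⊠ (Q ⊠ R))) refl A B C x y z x′ y′ z′ x″ y″ z″)
      (solveℚ 12 (λ A B C x y z x′ y′ z′ x″ y″ z″ →
          let P = E x y z; Q = E x′ y′ z′; R = E x″ y″ z″; _⊠_ = mulE A B C in
          e2 ((P ⊠ Q) ⊠ R) := e2 (P ⊠ (Q ⊠ R))) refl A B C x y z x′ y′ z′ x″ y″ z″)

    *K-distribʳ : ∀ r p q → (p +K q) *K r ≡ p *K r +K q *K r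
    *K-distribʳ ⟨ x″ , y″ , z″ ⟩ ⟨ x , y , z ⟩ ⟨ x′ , y′ , z′ ⟩ = K-≡
      (solveℚ 12 (λ A B C x y z x′ y′ z′ x″ y″ z″ →
          let P = E x y z; Q = E x′ y′ z′; R = E x″ y″ z″; _⊠_ = mulE A B C in
          e0 ((P ⊞ Q) ⊠ R) := e0 ((P ⊠ R) ⊞ (Q ⊠ R))) refl A B C x y z x′ y′ z′ x″ y″ z″)
      (solveℚ 12 (λ A B C x y z x′ y′ z′ x″ y″ z″ →
          let P = E x y z; Q = E x′ y′ z′; R = E x″ y″ z″; _⊠_ = mulE A B C in
          e1 ((P ⊞ Q) ⊠ R) := e1 ((P ⊠ R) ⊞ (Q ⊠ R))) refl A B C x y z x′ y′ z′ x″ y″ z″)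
      (solveℚ 12 (λ A B C x y z x′ y′ z′ x″ y″ z″ →
          let P = E x y z; Q = E x′ y′ z′; R = E x″ y″ z″; _⊠_ = mulE A B C in
          e2 ((P ⊞ Q) ⊠ R) := e2 ((P ⊠ R) ⊞ (Q ⊠ R))) refl A B C x y z x′ y′ z′ x″ y″ z″)

    *K-emb : ∀ q x y z → emb q *K ⟨ x , y , z ⟩ ≡ ⟨ q ℚ.* x , q ℚ.* y , q ℚ.* z ⟩
    *K-emb q x y z = K-≡
      (solveℚ 7 (λ A B C q x y z → e0 (mulE A B C (E q (con (+ 0)) (con (+ 0))) (E x y z)) := q :* x) refl A B C q x y z)
      (solveℚ 7 (λ A B C q x y z → e1 (mulE A B C (E q (con (+ 0)) (con (+ 0))) (E x y z)) := q :* y) refl A B C q x y z)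
      (solveℚ 7 (λ A B C q x y z → e2 (mulE A B C (E q (con (+ 0)) (con (+ 0))) (E x y z)) := q :* z) refl A B C q x y z)

    *K-identityˡ : ∀ p → 1K *K p ≡ p
    *K-identityˡ ⟨ x , y , z ⟩ = trans (*K-emb 1ℚ x y z) (K-≡ (ℚₚ.*-identityˡ x) (ℚₚ.*-identityˡ y) (ℚₚ.*-identityˡ z))

    K-commutativeRing : CommutativeRing _ _
    K-commutativeRing = record
      { Carrier = K f ; _≈_ = _≡_ ; _+_ = _+K_ ; _*_ = _*K_ ; -_ = -K_ ; 0# = 0K ; 1# = 1K
      ; isCommutativeRing = record
        { isRing = record
          { +-isAbelianGroup = record
            { isGroup = record
              { isMonoid = record
                { isSemigroup = record
                  { isMagma = record { isEquivalence = ≡.isEquivalence ; ∙-cong = cong₂ _+K_ }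
                  ; assoc = +K-assoc }
                ; identity = +K-identityˡ , (λ p → trans (+K-comm p 0K) (+K-identityˡ p)) }
              ; inverse = -K-inverseˡ , (λ p → trans (+K-comm p (-K p)) (-K-inverseˡ p))
              ; ⁻¹-cong = cong (λ p → -K p) }
            ; comm = +K-comm }
          ; *-cong = cong₂ _*K_
          ; *-assoc = *K-assoc
          ; *-identity = *K-identityˡ , (λ p → trans (*K-comm p 1K) (*K-identityˡ p))
          ; distrib = (λ r p q → trans (*K-comm r (p +K q)) (trans (*K-distribʳ r p q) (cong₂ _+K_ (*K-comm p r) (*K-comm q r))))
                    , *K-distribʳ }
        ; *-comm = *K-comm } }

    module _ (irr : Irreducible f) where
      private
        Invertible : K f → Set
        Invertible p = ∃[ q ] p *K q ≡ 1K

        -- The step that lowers degrees: to invert p it is enough to invert one of its multiples. A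
        -- quadratic element is multiplied into an affine one, and an affine one into a rational
        -- constant.
        of-multiple : ∀ p {q r} → p *K q ≡ r → Invertible r → Invertible p
        of-multiple p {q} e (s , rs) = q *K s , trans (sym (*K-assoc p q s)) (trans (cong (_*K s) e) rs)

        constant : ∀ q → q ≢ 0ℚ → Invertible (emb q)
        constant q q≢0 with ℚ-inverse q q≢0
        ... | q′ , e = emb q′ , trans (*K-emb q q′ 0ℚ 0ℚ) (K-≡ e (ℚₚ.*-zeroʳ q) (ℚₚ.*-zeroʳ q))

        -- Division of f by x + r leaves the remainder c − rt, which is nonzero since f is irreducible.
        linear : ∀ y r → y ≢ 0ℚ → Invertible ⟨ y ℚ.* r , y , 0ℚ ⟩
        linear y r y≢0 = of-multiple ⟨ y ℚ.* r , y , 0ℚ ⟩ {⟨ t , s , 1ℚ ⟩} product (constant (y ℚ.* (r ℚ.* t ℚ.- C)) nonzero)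
          where
          s t : ℚ
          s = A ℚ.- r
          t = B ℚ.- r ℚ.* s
          product : ⟨ y ℚ.* r , y , 0ℚ ⟩ *K ⟨ t , s , 1ℚ ⟩ ≡ emb (y ℚ.* (r ℚ.* t ℚ.- C))
          product = K-≡
            (solveℚ 5 (λ A B C y r → let s = A :- r; t = B :- r :* s in
              e0 (mulE A B C (E (y :* r) y (con (+ 0))) (E t s (con (+ 1)))) := y :* (r :* t :- C)) refl A B C y r)
            (solveℚ 5 (λ A B C y r → let s = A :- r; t = B :- r :* s in
              e1 (mulE A B C (E (y :* r) y (con (+ 0))) (E t s (con (+ 1)))) := con (+ 0)) refl A B C y r)
            (solveℚ 5 (λ A B C y r → let s = A :- r; t = B :- r :* s in
              e2 (mulE A B C (E (y :* r) y (con (+ 0))) (E t s (con (+ 1)))) := con (+ 0)) refl A B C y r)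
          nonzero : y ℚ.* (r ℚ.* t ℚ.- C) ≢ 0ℚ
          nonzero e with ℚ-inverse y y≢0
          ... | y′ , yy′ = irr (r , s , t
              , solveℚ 2 (λ A r → r :+ (A :- r) := A) refl A r
              , solveℚ 3 (λ A B r → r :* (A :- r) :+ (B :- r :* (A :- r)) := B) refl A B r
              , (begin
                  r ℚ.* t                                  ≡⟨ solveℚ 2 (λ x C → x := con (+ 1) :* (x :- C) :+ C) refl (r ℚ.* t) C ⟩
                  1ℚ ℚ.* (r ℚ.* t ℚ.- C) ℚ.+ C             ≡⟨ cong (λ u → u ℚ.* (r ℚ.* t ℚ.- C) ℚ.+ C) yy′ ⟨
                  y ℚ.* y′ ℚ.* (r ℚ.* t ℚ.- C) ℚ.+ C       ≡⟨ solveℚ 4 (λ y y′ u C → y :* y′ :* u :+ C := y′ :* (y :* u) :+ C) refl y y′ (r ℚ.* t ℚ.- C) C ⟩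
                  y′ ℚ.* (y ℚ.* (r ℚ.* t ℚ.- C)) ℚ.+ C     ≡⟨ cong (λ u → y′ ℚ.* u ℚ.+ C) e ⟩
                  y′ ℚ.* 0ℚ ℚ.+ C                          ≡⟨ solveℚ 2 (λ y′ C → y′ :* con (+ 0) :+ C := C) refl y′ C ⟩
                  C                                        ∎))
            where open ≡-Reasoning

        affine : ∀ x y → ⟨ x , y , 0ℚ ⟩ ≢ 0K → Invertible ⟨ x , y , 0ℚ ⟩
        affine x y p≢0 with y ℚₚ.≟ 0ℚ
        ... | yes refl = constant x (λ { refl → p≢0 refl })
        ... | no y≢0 with ℚ-inverse y y≢0
        ...   | y′ , yy′ = subst Invertible
                  (cong (λ u → ⟨ u , y , 0ℚ ⟩)
                    (trans (sym (ℚₚ.*-assoc y y′ x)) (trans (cong (ℚ._* x) yy′) (ℚₚ.*-identityˡ x))))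
                  (linear y (y′ ℚ.* x) y≢0)

        -- z(α² + uα + v)(α + A − u) is affine in α, and it vanishes only if f = (x + A − u)(x² + ux + v).
        quadratic : ∀ z u v → z ≢ 0ℚ → Invertible ⟨ z ℚ.* v , z ℚ.* u , z ⟩
        quadratic z u v z≢0 = of-multiple ⟨ z ℚ.* v , z ℚ.* u , z ⟩ {⟨ A ℚ.- u , 1ℚ , 0ℚ ⟩} product (affine _ _ nonzero)
          where
          product : ⟨ z ℚ.* v , z ℚ.* u , z ⟩ *K ⟨ A ℚ.- u , 1ℚ , 0ℚ ⟩
                  ≡ ⟨ z ℚ.* ((A ℚ.- u) ℚ.* v ℚ.- C) , z ℚ.* ((A ℚ.- u) ℚ.* u ℚ.+ v ℚ.- B) , 0ℚ ⟩
          product = K-≡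
            (solveℚ 6 (λ A B C z u v → e0 (mulE A B C (E (z :* v) (z :* u) z) (E (A :- u) (con (+ 1)) (con (+ 0))))
              := z :* ((A :- u) :* v :- C)) refl A B C z u v)
            (solveℚ 6 (λ A B C z u v → e1 (mulE A B C (E (z :* v) (z :* u) z) (E (A :- u) (con (+ 1)) (con (+ 0))))
              := z :* ((A :- u) :* u :+ v :- B)) refl A B C z u v)
            (solveℚ 6 (λ A B C z u v → e2 (mulE A B C (E (z :* v) (z :* u) z) (E (A :- u) (con (+ 1)) (con (+ 0))))
              := con (+ 0)) refl A B C z u v)
          cancel : ∀ w D → z ℚ.* (w ℚ.- D) ≡ 0ℚ → w ≡ D
          cancel w D e with ℚ-inverse z z≢0
          ... | z′ , zz′ = begin
            w                                  ≡⟨ solveℚ 2 (λ w D → w := con (+ 1) :* (w :- D) :+ D) refl w D ⟩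
            1ℚ ℚ.* (w ℚ.- D) ℚ.+ D             ≡⟨ cong (λ u → u ℚ.* (w ℚ.- D) ℚ.+ D) zz′ ⟨
            z ℚ.* z′ ℚ.* (w ℚ.- D) ℚ.+ D       ≡⟨ solveℚ 4 (λ y y′ u C → y :* y′ :* u :+ C := y′ :* (y :* u) :+ C) refl z z′ (w ℚ.- D) D ⟩
            z′ ℚ.* (z ℚ.* (w ℚ.- D)) ℚ.+ D     ≡⟨ cong (λ u → z′ ℚ.* u ℚ.+ D) e ⟩
            z′ ℚ.* 0ℚ ℚ.+ D                    ≡⟨ solveℚ 2 (λ y′ C → y′ :* con (+ 0) :+ C := C) refl z′ D ⟩
            D                                  ∎
            where open ≡-Reasoning
          nonzero : ⟨ z ℚ.* ((A ℚ.- u) ℚ.* v ℚ.- C) , z ℚ.* ((A ℚ.- u) ℚ.* u ℚ.+ v ℚ.- B) , 0ℚ ⟩ ≢ 0K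
          nonzero e = irr (A ℚ.- u , u , v
            , solveℚ 2 (λ A u → A :- u :+ u := A) refl A u
            , cancel _ B (cong k1 e)
            , cancel _ C (cong k0 e))

      K-inverse : ∀ p → p ≢ 0K → ∃[ q ] p *K q ≡ 1K
      K-inverse ⟨ x , y , z ⟩ p≢0 with z ℚₚ.≟ 0ℚ
      ... | yes refl = affine x y p≢0
      ... | no z≢0 with ℚ-inverse z z≢0
      ...   | z′ , zz′ = subst Invertible (cong₂ (λ u v → ⟨ u , v , z ⟩) (unscale x) (unscale y)) (quadratic z (z′ ℚ.* y) (z′ ℚ.* x) z≢0)
        where
        unscale : ∀ x → z ℚ.* (z′ ℚ.* x) ≡ x
        unscale x = trans (sym (ℚₚ.*-assoc z z′ x)) (trans (cong (ℚ._* x) zz′) (ℚₚ.*-identityˡ x))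

-- Decidable fields and power series over them

module PowerSeries where
  open RingSolving
  open import Algebra.Bundles using (CommutativeRing)
  open import Algebra.Structures using (IsCommutativeRing)

  open import Data.Nat as ℕ using (ℕ; zero; suc; _<_; z≤n; s≤s)
  import Data.Nat.Properties as ℕₚ
  open import Data.Product using (_×_; _,_; ∃-syntax)
  open import Data.Sum using (_⊎_; inj₁; inj₂)
  open import Function using (_∘_)
  open import Relation.Nullary using (yes; no; Dec)
  open import Relation.Binary.PropositionalEquality using (_≡_; _≢_; refl; sym; trans; cong; cong₂; module ≡-Reasoning)

  -- Equality is propositional and decidable, so that points are compared by `≡` and certificates
  -- are checked by evaluation. `2≢0` is what turns y = -y into y = 0.
  record DecField : Set₁ where
    infixl 6 _+_ _-_
    infixl 7 _*_
    infix 8 -_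
    infix 4 _≟_
    field
      F : Set
      _+_ _*_ : F → F → F
      -_ : F → F
      0F 1F : F
      isCommutativeRing : IsCommutativeRing _≡_ _+_ _*_ -_ 0F 1F
      _≟_ : (x y : F) → Dec (x ≡ y)
      inverse : ∀ x → x ≢ 0F → ∃[ y ] x * y ≡ 1F
      2≢0 : 1F + 1F ≢ 0F
    _-_ : F → F → F
    x - y = x + - y
    ring : CommutativeRing _ _
    ring = record { isCommutativeRing = isCommutativeRing }
    open RingSolver ring public using (solve)
    open IsCommutativeRing isCommutativeRing public
      using (+-identityˡ; +-identityʳ; *-identityˡ; *-identityʳ; zeroˡ; zeroʳ; *-comm; +-comm; *-assoc; +-assoc; distribʳ; distribˡ; -‿inverseʳ; -‿inverseˡ; +-congˡ; +-congʳ; *-congˡ; *-congʳ)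

    1≢0 : 1F ≢ 0F
    1≢0 e = 2≢0 (trans (cong₂ _+_ e e) (+-identityˡ 0F))

    cancelˡ : ∀ c {x} → c ≢ 0F → c * x ≡ 0F → x ≡ 0F
    cancelˡ c {x} c≢0 e with inverse c c≢0
    ... | d , cd = begin
      x             ≡⟨ *-identityˡ x ⟨
      1F * x        ≡⟨ cong (_* x) cd ⟨
      c * d * x     ≡⟨ solve 3 (λ c d x → c :* d :* x := d :* (c :* x)) refl c d x ⟩
      d * (c * x)   ≡⟨ cong (d *_) e ⟩
      d * 0F        ≡⟨ zeroʳ d ⟩
      0F            ∎
      where open ≡-Reasoning

    *-≢0 : ∀ {x y} → x ≢ 0F → y ≢ 0F → x * y ≢ 0F
    *-≢0 x≢0 y≢0 e = y≢0 (cancelˡ _ x≢0 e)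

    -≡0⇒≡ : ∀ {x y} → x - y ≡ 0F → x ≡ y
    -≡0⇒≡ {x} {y} e = begin
      x            ≡⟨ solve 2 (λ x y → x := (x :- y) :+ y) refl x y ⟩
      x - y + y    ≡⟨ cong (_+ y) e ⟩
      0F + y       ≡⟨ +-identityˡ y ⟩
      y            ∎
      where open ≡-Reasoning

    ≡⇒-≡0 : ∀ {x y} → x ≡ y → x - y ≡ 0F
    ≡⇒-≡0 {x} refl = -‿inverseʳ x

  module Series (𝔽 : DecField) where
    open DecField 𝔽

    Seq : Set
    Seq = ℕ → F

    tail : Seq → Seq
    tail α n = α (suc n)

    infixl 7 _⋆_
    infixl 6 _∔_
    -- The Cauchy product, unfolded as αβ = α₀β + X·(tail α)β without its overlap: the recursion
    -- favours the left factor, and commutativity comes from the mirror image `⋆-sucʳ`.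
    _⋆_ : Seq → Seq → Seq
    (α ⋆ β) zero    = α 0 * β 0
    (α ⋆ β) (suc n) = α 0 * β (suc n) + (tail α ⋆ β) n

    _∔_ : Seq → Seq → Seq
    (α ∔ β) n = α n + β n

    cst : F → Seq
    cst c zero    = c
    cst c (suc n) = 0F

    infix 4 _≗_
    _≗_ : Seq → Seq → Set
    α ≗ β = ∀ n → α n ≡ β n

    ⋆-cong : ∀ {α α′ β β′} → α ≗ α′ → β ≗ β′ → α ⋆ β ≗ α′ ⋆ β′
    ⋆-cong e e′ zero    = cong₂ _*_ (e 0) (e′ 0)
    ⋆-cong e e′ (suc n) = cong₂ _+_ (cong₂ _*_ (e 0) (e′ (suc n))) (⋆-cong (e ∘ suc) e′ n)

    ⋆-sucʳ : ∀ α β n → (α ⋆ β) (suc n) ≡ α (suc n) * β 0 + (α ⋆ tail β) n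
    ⋆-sucʳ α β zero    = +-comm _ _
    ⋆-sucʳ α β (suc n) = trans (+-congˡ (⋆-sucʳ (tail α) β n))
      (solve 3 (λ x y z → x :+ (y :+ z) := y :+ (x :+ z)) refl (α 0 * β (suc (suc n))) (α (suc (suc n)) * β 0) ((tail α ⋆ tail β) n))

    ⋆-comm : ∀ α β → α ⋆ β ≗ β ⋆ α
    ⋆-comm α β zero    = *-comm _ _
    ⋆-comm α β (suc n) = trans (cong₂ _+_ (*-comm _ _) (⋆-comm (tail α) β n)) (sym (⋆-sucʳ β α n))

    ⋆-distribʳ : ∀ γ α β → (α ∔ β) ⋆ γ ≗ α ⋆ γ ∔ β ⋆ γ
    ⋆-distribʳ γ α β zero    = distribʳ _ _ _
    ⋆-distribʳ γ α β (suc n) = trans (+-congˡ (⋆-distribʳ γ (tail α) (tail β) n))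
      (solve 5 (λ a b c x y → (a :+ b) :* c :+ (x :+ y) := (a :* c :+ x) :+ (b :* c :+ y)) refl
        (α 0) (β 0) (γ (suc n)) ((tail α ⋆ γ) n) ((tail β ⋆ γ) n))

    ⋆-scale : ∀ c α β n → ((λ k → c * α k) ⋆ β) n ≡ c * (α ⋆ β) n
    ⋆-scale c α β zero    = *-assoc _ _ _
    ⋆-scale c α β (suc n) = trans (+-congˡ (⋆-scale c (tail α) β n))
      (solve 4 (λ c a b x → c :* a :* b :+ c :* x := c :* (a :* b :+ x)) refl c (α 0) (β (suc n)) ((tail α ⋆ β) n))

    ⋆-assoc : ∀ α β γ → (α ⋆ β) ⋆ γ ≗ α ⋆ (β ⋆ γ)
    ⋆-assoc α β γ zero    = *-assoc _ _ _
    ⋆-assoc α β γ (suc n) = begin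
      α 0 * β 0 * γ (suc n) + (tail (α ⋆ β) ⋆ γ) n
        ≡⟨ +-congˡ (⋆-distribʳ γ (λ k → α 0 * β (suc k)) (tail α ⋆ β) n) ⟩
      α 0 * β 0 * γ (suc n) + (((λ k → α 0 * β (suc k)) ⋆ γ) n + ((tail α ⋆ β) ⋆ γ) n)
        ≡⟨ +-congˡ (cong₂ _+_ (⋆-scale (α 0) (tail β) γ n) (⋆-assoc (tail α) β γ n)) ⟩
      α 0 * β 0 * γ (suc n) + (α 0 * (tail β ⋆ γ) n + (tail α ⋆ (β ⋆ γ)) n)
        ≡⟨ solve 5 (λ a b c x y → a :* b :* c :+ (a :* x :+ y) := a :* (b :* c :+ x) :+ y) refl
             (α 0) (β 0) (γ (suc n)) ((tail β ⋆ γ) n) ((tail α ⋆ (β ⋆ γ)) n) ⟩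
      α 0 * (β 0 * γ (suc n) + (tail β ⋆ γ) n) + (tail α ⋆ (β ⋆ γ)) n ∎
      where open ≡-Reasoning

    ⋆-zero : ∀ {α} → (∀ n → α n ≡ 0F) → ∀ β n → (α ⋆ β) n ≡ 0F
    ⋆-zero e β zero    = trans (*-congʳ (e 0)) (zeroˡ _)
    ⋆-zero e β (suc n) = trans (cong₂ _+_ (trans (*-congʳ (e 0)) (zeroˡ _)) (⋆-zero (e ∘ suc) β n)) (+-identityˡ 0F)

    cst-⋆ : ∀ c β n → (cst c ⋆ β) n ≡ c * β n
    cst-⋆ c β zero    = refl
    cst-⋆ c β (suc n) = trans (+-congˡ (⋆-zero (λ _ → refl) β n)) (+-identityʳ _)

    ring𝕊 : CommutativeRing _ _
    ring𝕊 = record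
      { Carrier = Seq ; _≈_ = _≗_ ; _+_ = _∔_ ; _*_ = _⋆_ ; -_ = λ α n → - α n ; 0# = λ _ → 0F ; 1# = cst 1F
      ; isCommutativeRing = record
        { isRing = record
          { +-isAbelianGroup = record
            { isGroup = record
              { isMonoid = record
                { isSemigroup = record
                  { isMagma = record
                    { isEquivalence = record { refl = λ _ → refl ; sym = λ e n → sym (e n) ; trans = λ e e′ n → trans (e n) (e′ n) }
                    ; ∙-cong = λ e e′ n → cong₂ _+_ (e n) (e′ n) }
                  ; assoc = λ α β γ n → +-assoc _ _ _ }
                ; identity = (λ α n → +-identityˡ _) , (λ α n → +-identityʳ _) }
              ; inverse = (λ α n → -‿inverseˡ _) , (λ α n → -‿inverseʳ _)
              ; ⁻¹-cong = λ e n → cong -_ (e n) }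
            ; comm = λ α β n → +-comm _ _ }
          ; *-cong = ⋆-cong
          ; *-assoc = ⋆-assoc
          ; *-identity = (λ β n → trans (cst-⋆ 1F β n) (*-identityˡ _))
                       , (λ β n → trans (⋆-comm β (cst 1F) n) (trans (cst-⋆ 1F β n) (*-identityˡ _)))
          ; distrib = (λ γ α β n → trans (⋆-comm γ (α ∔ β) n) (trans (⋆-distribʳ γ α β n) (cong₂ _+_ (⋆-comm α γ n) (⋆-comm β γ n))))
                    , ⋆-distribʳ }
        ; *-comm = ⋆-comm } }

    ⋆-vanish : ∀ α β n → (∀ i j → i ℕ.+ j ≡ n → α i * β j ≡ 0F) → (α ⋆ β) n ≡ 0F
    ⋆-vanish α β zero    h = h 0 0 refl
    ⋆-vanish α β (suc n) h = trans (cong₂ _+_ (h 0 (suc n) refl) (⋆-vanish (tail α) β n (λ i j e → h (suc i) j (cong suc e))))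
                                   (+-identityˡ 0F)

    -- Isolates one term of the convolution; `⋆-top` applies it to the product of two leading
    -- coefficients.
    ⋆-single : ∀ α β i₀ j₀ → (∀ i j → i ℕ.+ j ≡ i₀ ℕ.+ j₀ → i ≢ i₀ → α i * β j ≡ 0F) →
               (α ⋆ β) (i₀ ℕ.+ j₀) ≡ α i₀ * β j₀
    ⋆-single α β zero zero h = refl
    ⋆-single α β zero (suc j₀) h =
      trans (+-congˡ (⋆-vanish (tail α) β j₀ (λ i j e → h (suc i) j (cong suc e) λ ()))) (+-identityʳ _)
    ⋆-single α β (suc i₀) j₀ h =
      trans (cong₂ _+_ (h 0 _ refl λ ())
                       (⋆-single (tail α) β i₀ j₀ (λ i j e i≢ → h (suc i) j (cong suc e) (i≢ ∘ ℕₚ.suc-injective))))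
            (+-identityˡ _)

    Above : ℕ → Seq → Set
    Above n α = ∀ k → n < k → α k ≡ 0F

    ⋆-Above : ∀ {m n α β} → Above m α → Above n β → Above (m ℕ.+ n) (α ⋆ β)
    ⋆-Above {m} {n} {α} {β} hα hβ k m+n<k = ⋆-vanish α β k vanish
      where
      vanish : ∀ i j → i ℕ.+ j ≡ k → α i * β j ≡ 0F
      vanish i j refl with i ℕₚ.≤? m
      ... | no i≰m  = trans (*-congʳ (hα i (ℕₚ.≰⇒> i≰m))) (zeroˡ _)
      ... | yes i≤m = trans (*-congˡ (hβ j (ℕₚ.≰⇒> λ j≤n → ℕₚ.<⇒≱ m+n<k (ℕₚ.+-mono-≤ i≤m j≤n)))) (zeroʳ _)

    ⋆-top : ∀ {m n α β} → Above m α → Above n β → (α ⋆ β) (m ℕ.+ n) ≡ α m * β n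
    ⋆-top {m} {n} {α} {β} hα hβ = ⋆-single α β m n vanish
      where
      vanish : ∀ i j → i ℕ.+ j ≡ m ℕ.+ n → i ≢ m → α i * β j ≡ 0F
      vanish i j e i≢m with i ℕₚ.≤? m
      ... | no i≰m  = trans (*-congʳ (hα i (ℕₚ.≰⇒> i≰m))) (zeroˡ _)
      ... | yes i≤m = trans (*-congˡ (hβ j (ℕₚ.≰⇒> λ j≤n → ℕₚ.<⇒≢ (ℕₚ.+-mono-<-≤ (ℕₚ.≤∧≢⇒< i≤m i≢m) j≤n) e))) (zeroʳ _)

    -- A bare sequence has no decidable degree; the bound N makes the search for its top coefficient
    -- finite.
    degree? : ∀ N α → Above N α → (∀ n → α n ≡ 0F) ⊎ ∃[ n ] (α n ≢ 0F × Above n α)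
    degree? N α h with α N ≟ 0F
    ... | no αN≢0 = inj₂ (N , αN≢0 , h)
    degree? zero α h | yes e = inj₁ λ { zero → e ; (suc n) → h (suc n) (s≤s z≤n) }
    degree? (suc N) α h | yes e = degree? N α h′
      where
      h′ : Above N α
      h′ k N<k with ℕₚ.≤⇒≤′ N<k
      ... | ℕ.≤′-refl = e
      ... | ℕ.≤′-step p = h k (s≤s (ℕₚ.≤′⇒≤ p))

-- The coordinate ring and orders of poles at infinity

module CoordinateRings where
  open RingSolving
  open PowerSeries
  open import Algebra.Bundles using (CommutativeRing)
  open import Data.Nat as ℕ using (ℕ; zero; suc; _≤_; _<_; z≤n; s≤s)
  import Data.Nat.Properties as ℕₚ
  open import Data.Product using (_×_; _,_; proj₁; proj₂; ∃-syntax)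
  open import Data.Sum using (_⊎_; inj₁; inj₂)
  open import Data.Empty using (⊥; ⊥-elim)
  open import Function using (_∘_)
  open import Level using (0ℓ)
  open import Relation.Binary using (tri<; tri≈; tri>)
  import Data.Nat.Solver
  open Data.Nat.Solver.+-*-Solver using () renaming (solve to solveℕ; _:+_ to _⊹_; _:=_ to _≑_; con to #)
  open import Relation.Nullary using (¬_; yes; no)
  open import Relation.Binary.PropositionalEquality using (_≡_; _≢_; refl; sym; trans; cong; cong₂; subst)

  -- The coordinate ring of y² = x³ + g₂x² + g₁x + g₀. `Lead f d` says that f ≠ 0 has a pole of order d at infinity.
  record CoordinateRing (𝔽 : DecField) (g₂ g₁ g₀ : DecField.F 𝔽) : Set₁ where
    private module 𝔽 = DecField 𝔽
    open 𝔽 using (F; 0F; 1F)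
    field
      coordinates : CommutativeRing 0ℓ 0ℓ
    open CommutativeRing coordinates public
    field
      κ   : F → Carrier
      κ-+ : ∀ c d → κ (c 𝔽.+ d) ≈ κ c + κ d
      κ-* : ∀ c d → κ (c 𝔽.* d) ≈ κ c * κ d
      κ-‿ : ∀ c → κ (𝔽.- c) ≈ - κ c
      κ-0 : κ 0F ≈ 0#
      κ-1 : κ 1F ≈ 1#
      X Y : Carrier
      Y²  : Y * Y ≈ X * X * X + κ g₂ * (X * X) + κ g₁ * X + κ g₀
      Lead : Carrier → ℕ → Set
      lead-resp   : ∀ {f g d} → f ≈ g → Lead f d → Lead g d
      lead-*      : ∀ {f g d e} → Lead f d → Lead g e → Lead (f * g) (d ℕ.+ e)
      lead-unique : ∀ {f d e} → Lead f d → Lead f e → d ≡ e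
      lead-0      : ∀ {d} → ¬ Lead 0# d
      lead?       : ∀ f → f ≈ 0# ⊎ ∃[ d ] Lead f d
      lead-const  : ∀ {c} → c ≢ 0F → Lead (κ c) 0
      lead-X      : ∀ e → Lead (X + κ e) 2
      lead-Y      : ∀ d e → Lead (Y + (κ d * X + κ e)) 3
      order-0     : ∀ {f} → Lead f 0 → ∃[ c ] (c ≢ 0F × f ≈ κ c)
      order-1     : ∀ {f} → ¬ Lead f 1
      order-2     : ∀ {f} → Lead f 2 → ∃[ c ] ∃[ e ] (c ≢ 0F × f ≈ κ c * X + κ e)
      order-3     : ∀ {f} → Lead f 3 → ∃[ c ] ∃[ d ] ∃[ e ] (c ≢ 0F × f ≈ κ c * Y + (κ d * X + κ e))
      independent : ∀ {c₀ c₁ c₂ d₀ d₁} → κ c₀ + κ c₁ * X + κ c₂ * (X * X) + (κ d₀ + κ d₁ * X) * Y ≈ 0# →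
                    (c₀ ≡ 0F × c₁ ≡ 0F × c₂ ≡ 0F) × (d₀ ≡ 0F × d₁ ≡ 0F)

  module Construction (𝔽 : DecField) (g₂ g₁ g₀ : DecField.F 𝔽) where
    open DecField 𝔽
    open Series 𝔽
    open RingSolver ring𝕊 using () renaming (solve to solve𝕊)

    g : Seq
    g 0 = g₀
    g 1 = g₁
    g 2 = g₂
    g 3 = 1F
    g (suc (suc (suc (suc n)))) = 0F

    g-above : Above 3 g
    g-above (suc (suc (suc (suc k)))) _ = refl
    g-above 1 (s≤s ())
    g-above 2 (s≤s (s≤s ()))
    g-above 3 (s≤s (s≤s (s≤s ())))

    above-mono : ∀ {m n α} → m ≤ n → Above m α → Above n α
    above-mono m≤n h k n<k = h k (ℕₚ.≤-<-trans m≤n n<k)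

    ∔-above : ∀ {n α β} → Above n α → Above n β → Above n (α ∔ β)
    ∔-above h h′ k n<k = trans (cong₂ _+_ (h k n<k) (h′ k n<k)) (+-identityˡ 0F)

    -- the element p(x) + q(x) y
    record Element : Set where
      constructor element
      field
        p q : Seq
        bound : ℕ
        p-bound : Above bound p
        q-bound : Above bound q
    open Element

    infix 4 _≈R_
    -- Bounds are not part of the value of an element, hence those of sums and products may be
    -- generous.
    _≈R_ : Element → Element → Set
    f ≈R h = p f ≗ p h × q f ≗ q h

    infixl 6 _+R_
    infixl 7 _*R_
    infix 8 -R_
    _+R_ _*R_ : Element → Element → Element
    f +R h = element (p f ∔ p h) (q f ∔ q h) (bound f ℕ.+ bound h)
      (∔-above (above-mono (ℕₚ.m≤m+n _ _) (p-bound f)) (above-mono (ℕₚ.m≤n+m _ _) (p-bound h)))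
      (∔-above (above-mono (ℕₚ.m≤m+n _ _) (q-bound f)) (above-mono (ℕₚ.m≤n+m _ _) (q-bound h)))
    f *R h = element (p f ⋆ p h ∔ q f ⋆ q h ⋆ g) (p f ⋆ q h ∔ q f ⋆ p h) (bound f ℕ.+ bound h ℕ.+ 3)
      (∔-above (above-mono (ℕₚ.m≤m+n _ 3) (⋆-Above (p-bound f) (p-bound h)))
               (⋆-Above (⋆-Above (q-bound f) (q-bound h)) g-above))
      (above-mono (ℕₚ.m≤m+n _ 3)
        (∔-above (⋆-Above (p-bound f) (q-bound h)) (⋆-Above (q-bound f) (p-bound h))))

    -R_ : Element → Element
    -R f = element (λ n → - p f n) (λ n → - q f n) (bound f)
      (λ k h → trans (cong -_ (p-bound f k h)) neg0) (λ k h → trans (cong -_ (q-bound f k h)) neg0)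
      where
      neg0 : - 0F ≡ 0F
      neg0 = trans (sym (+-identityˡ _)) (-‿inverseʳ 0F)

    κR : F → Element
    κR c = element (cst c) (λ _ → 0F) 0 (λ { (suc k) _ → refl }) (λ _ _ → refl)

    0R : Element
    0R = element (λ _ → 0F) (λ _ → 0F) 0 (λ _ _ → refl) (λ _ _ → refl)

    R-ring : CommutativeRing 0ℓ 0ℓ
    R-ring = record
      { Carrier = Element ; _≈_ = _≈R_ ; _+_ = _+R_ ; _*_ = _*R_ ; -_ = -R_ ; 0# = 0R ; 1# = κR 1F
      ; isCommutativeRing = record
        { isRing = record
          { +-isAbelianGroup = record
            { isGroup = record
              { isMonoid = record
                { isSemigroup = record
                  { isMagma = record
                    { isEquivalence = record
                      { refl = (λ _ → refl) , (λ _ → refl)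
                      ; sym = λ (e , e′) → (λ n → sym (e n)) , (λ n → sym (e′ n))
                      ; trans = λ (e , e′) (d , d′) → (λ n → trans (e n) (d n)) , (λ n → trans (e′ n) (d′ n)) }
                    ; ∙-cong = λ (e , e′) (d , d′) → (λ n → cong₂ _+_ (e n) (d n)) , (λ n → cong₂ _+_ (e′ n) (d′ n)) }
                  ; assoc = λ f h k → (λ n → +-assoc _ _ _) , (λ n → +-assoc _ _ _) }
                ; identity = (λ f → (λ n → +-identityˡ _) , (λ n → +-identityˡ _))
                           , (λ f → (λ n → +-identityʳ _) , (λ n → +-identityʳ _)) }
              ; inverse = (λ f → (λ n → -‿inverseˡ _) , (λ n → -‿inverseˡ _))
                        , (λ f → (λ n → -‿inverseʳ _) , (λ n → -‿inverseʳ _))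
              ; ⁻¹-cong = λ (e , e′) → (λ n → cong -_ (e n)) , (λ n → cong -_ (e′ n)) }
            ; comm = λ f h → (λ n → +-comm _ _) , (λ n → +-comm _ _) }
          ; *-cong = λ (e , e′) (d , d′) →
              (λ n → cong₂ _+_ (⋆-cong e d n) (⋆-cong (⋆-cong e′ d′) (λ _ → refl) n))
              , (λ n → cong₂ _+_ (⋆-cong e d′ n) (⋆-cong e′ d n))
          ; *-assoc = *-assocR
          ; *-identity = *-identityR , λ f → ≈R-trans {f *R κR 1F} {κR 1F *R f} {f} (*-commR f (κR 1F)) (*-identityR f)
          ; distrib = (λ k f h → ≈R-trans {k *R (f +R h)} {(f +R h) *R k} {k *R f +R k *R h} (*-commR k (f +R h)) (≈R-trans {(f +R h) *R k} {f *R k +R h *R k} {k *R f +R k *R h} (*-distribR k f h)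
                          ((λ n → cong₂ _+_ (proj₁ (*-commR f k) n) (proj₁ (*-commR h k) n))
                          , (λ n → cong₂ _+_ (proj₂ (*-commR f k) n) (proj₂ (*-commR h k) n)))))
                    , *-distribR }
        ; *-comm = *-commR } }
      where
      ≈R-trans : ∀ {f h k} → f ≈R h → h ≈R k → f ≈R k
      ≈R-trans (e , e′) (d , d′) = (λ n → trans (e n) (d n)) , (λ n → trans (e′ n) (d′ n))
      *-commR : ∀ f h → (f *R h) ≈R (h *R f)
      *-commR f h =
        solve𝕊 5 (λ p q p′ q′ g → p :* p′ :+ q :* q′ :* g := p′ :* p :+ q′ :* q :* g) refl (p f) (q f) (p h) (q h) g ,
        solve𝕊 5 (λ p q p′ q′ g → p :* q′ :+ q :* p′ := p′ :* q :+ q′ :* p) refl (p f) (q f) (p h) (q h) g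
      *-assocR : ∀ f h k → ((f *R h) *R k) ≈R (f *R (h *R k))
      *-assocR f h k =
        solve𝕊 7 (λ p q p′ q′ p″ q″ g → (p :* p′ :+ q :* q′ :* g) :* p″ :+ (p :* q′ :+ q :* p′) :* q″ :* g
                     := p :* (p′ :* p″ :+ q′ :* q″ :* g) :+ q :* (p′ :* q″ :+ q′ :* p″) :* g) refl
               (p f) (q f) (p h) (q h) (p k) (q k) g ,
        solve𝕊 7 (λ p q p′ q′ p″ q″ g → (p :* p′ :+ q :* q′ :* g) :* q″ :+ (p :* q′ :+ q :* p′) :* p″
                     := p :* (p′ :* q″ :+ q′ :* p″) :+ q :* (p′ :* p″ :+ q′ :* q″ :* g)) refl
               (p f) (q f) (p h) (q h) (p k) (q k) g
      *-distribR : ∀ k f h → ((f +R h) *R k) ≈R ((f *R k) +R (h *R k))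
      *-distribR k f h =
        solve𝕊 7 (λ p q p′ q′ p″ q″ g → (p :+ p′) :* p″ :+ (q :+ q′) :* q″ :* g
                     := (p :* p″ :+ q :* q″ :* g) :+ (p′ :* p″ :+ q′ :* q″ :* g)) refl
               (p f) (q f) (p h) (q h) (p k) (q k) g ,
        solve𝕊 7 (λ p q p′ q′ p″ q″ g → (p :+ p′) :* q″ :+ (q :+ q′) :* p″
                     := (p :* q″ :+ q :* p″) :+ (p′ :* q″ :+ q′ :* p″)) refl
               (p f) (q f) (p h) (q h) (p k) (q k) g
      *-identityR : ∀ f → (κR 1F *R f) ≈R f
      *-identityR f = (λ n → trans (cong₂ _+_ (trans (cst-⋆ 1F (p f) n) (*-identityˡ _)) (⋆-zero (⋆-zero (λ _ → refl) (q f)) g n)) (+-identityʳ _))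
                    , (λ n → trans (cong₂ _+_ (trans (cst-⋆ 1F (q f) n) (*-identityˡ _)) (⋆-zero (λ _ → refl) (p f) n)) (+-identityʳ _))

    xs : Seq
    xs 0 = 0F
    xs 1 = 1F
    xs (suc (suc n)) = 0F

    shift : Seq → Seq
    shift α zero    = 0F
    shift α (suc n) = α n

    xs-⋆ : ∀ β → xs ⋆ β ≗ shift β
    xs-⋆ β zero    = zeroˡ _
    xs-⋆ β (suc n) = trans (cong₂ _+_ (zeroˡ _) (trans (⋆-cong {tail xs} {cst 1F} {β} (λ { zero → refl ; (suc _) → refl }) (λ _ → refl) n)
                                                      (trans (cst-⋆ 1F β n) (*-identityˡ _)))) (+-identityˡ _)

    XR YR : Element
    XR = element xs (λ _ → 0F) 1 (λ { (suc (suc k)) _ → refl ; (suc zero) (s≤s ()) }) (λ _ _ → refl)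
    YR = element (λ _ → 0F) (cst 1F) 0 (λ _ _ → refl) (λ { (suc k) _ → refl })

    κ*-p : ∀ c f n → p (κR c *R f) n ≡ c * p f n
    κ*-p c f n = trans (cong₂ _+_ (cst-⋆ c (p f) n) (⋆-zero (⋆-zero (λ _ → refl) (q f)) g n)) (+-identityʳ _)
    κ*-q : ∀ c f n → q (κR c *R f) n ≡ c * q f n
    κ*-q c f n = trans (cong₂ _+_ (cst-⋆ c (q f) n) (⋆-zero (λ _ → refl) (p f) n)) (+-identityʳ _)
    X*-p : ∀ f n → p (XR *R f) n ≡ shift (p f) n
    X*-p f n = trans (cong₂ _+_ (xs-⋆ (p f) n) (⋆-zero (⋆-zero (λ _ → refl) (q f)) g n)) (+-identityʳ _)
    X*-q : ∀ f n → q (XR *R f) n ≡ shift (q f) n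
    X*-q f n = trans (cong₂ _+_ (xs-⋆ (q f) n) (⋆-zero (λ _ → refl) (p f) n)) (+-identityʳ _)
    Y*-p : ∀ f n → p (YR *R f) n ≡ (q f ⋆ g) n
    Y*-p f n = trans (cong₂ _+_ (⋆-zero (λ _ → refl) (p f) n)
      (⋆-cong {cst 1F ⋆ q f} {q f} {g} (λ k → trans (cst-⋆ 1F (q f) k) (*-identityˡ _)) (λ _ → refl) n)) (+-identityˡ _)
    Y*-q : ∀ f n → q (YR *R f) n ≡ p f n
    Y*-q f n = trans (cong₂ _+_ (⋆-zero (λ _ → refl) (q f) n) (trans (cst-⋆ 1F (p f) n) (*-identityˡ _))) (+-identityˡ _)

    -- x has a pole of order 2 and y one of order 3, so p contributes the even order 2·deg p and q·y
    -- the odd order 3 + 2·deg q; they cannot cancel, and the larger one counts. In `even` the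
    -- condition on q says deg q ≤ n - 2, that is 3 + 2·deg q < 2n; in `odd` the condition on p says
    -- 2·deg p < 2n + 3. The order 1 never occurs.
    data LeadR (f : Element) : ℕ → Set where
      even : ∀ n → p f n ≢ 0F → Above n (p f) → (∀ k → n ≤ suc k → q f k ≡ 0F) → LeadR f (n ℕ.+ n)
      odd  : ∀ n → q f n ≢ 0F → Above n (q f) → Above (suc n) (p f) → LeadR f (3 ℕ.+ (n ℕ.+ n))

    leadR-resp : ∀ {f h d} → f ≈R h → LeadR f d → LeadR h d
    leadR-resp (e , e′) (even n c≢0 hp hq) =
      even n (c≢0 ∘ trans (e n)) (λ k l → trans (sym (e k)) (hp k l)) (λ k l → trans (sym (e′ k)) (hq k l))
    leadR-resp (e , e′) (odd n c≢0 hq hp) =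
      odd n (c≢0 ∘ trans (e′ n)) (λ k l → trans (sym (e′ k)) (hq k l)) (λ k l → trans (sym (e k)) (hp k l))

    leadR-0 : ∀ {d} → ¬ LeadR 0R d
    leadR-0 (even n c≢0 _ _) = c≢0 refl
    leadR-0 (odd n c≢0 _ _) = c≢0 refl

    degree-unique : ∀ {α : Seq} {m n} → α m ≢ 0F → Above m α → α n ≢ 0F → Above n α → m ≡ n
    degree-unique {α} {m} {n} cm am cn an with ℕₚ.<-cmp m n
    ... | tri< m<n _ _ = ⊥-elim (cn (am n m<n))
    ... | tri≈ _ e _ = e
    ... | tri> _ _ n<m = ⊥-elim (cm (an m n<m))

    even-odd : ∀ {f m n} → p f m ≢ 0F → (∀ k → m ≤ suc k → q f k ≡ 0F) → q f n ≢ 0F → Above (suc n) (p f) → ⊥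
    even-odd {f} {m} {n} cm hq cn hp with m ℕₚ.≤? suc n
    ... | yes m≤1+n = cn (hq n m≤1+n)
    ... | no m≰1+n  = cm (hp m (ℕₚ.≰⇒> m≰1+n))

    leadR-unique : ∀ {f d e} → LeadR f d → LeadR f e → d ≡ e
    leadR-unique (even m cm am _) (even n cn an _) with refl ← degree-unique cm am cn an = refl
    leadR-unique {f} (even m cm _ hq) (odd n cn _ hp) = ⊥-elim (even-odd {f} cm hq cn hp)
    leadR-unique {f} (odd n cn _ hp) (even m cm _ hq) = ⊥-elim (even-odd {f} cm hq cn hp)
    leadR-unique (odd m cm am _) (odd n cn an _) with refl ← degree-unique cm am cn an = refl

    leadR? : ∀ f → f ≈R 0R ⊎ ∃[ d ] LeadR f d
    leadR? f with degree? (bound f) (p f) (p-bound f) | degree? (bound f) (q f) (q-bound f)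
    ... | inj₁ zp | inj₁ zq = inj₁ (zp , zq)
    ... | inj₁ zp | inj₂ (n , c , h) = inj₂ (_ , odd n c h (λ k _ → zp k))
    ... | inj₂ (n , c , h) | inj₁ zq = inj₂ (_ , even n c h (λ k _ → zq k))
    ... | inj₂ (m , c , h) | inj₂ (n , c′ , h′) with m ℕₚ.≤? suc n
    ...   | yes m≤1+n = inj₂ (_ , odd n c′ h′ (above-mono m≤1+n h))
    ...   | no m≰1+n  = inj₂ (_ , even m c h (λ k m≤1+k → h′ k (ℕ.s≤s⁻¹ (ℕₚ.≤-trans (ℕₚ.≰⇒> m≰1+n) m≤1+k))))


    -- degree α < m − s
    Vanish : ℕ → ℕ → Seq → Set
    Vanish s m α = ∀ k → m ≤ s ℕ.+ k → α k ≡ 0F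

    -- The degrees are at most m - s - 1 and n - t - 1. Two units are lost in the sum while a strict
    -- inequality costs only one, hence the `suc`.
    ⋆-Vanish : ∀ {s t m n α β} → Vanish s m α → Vanish t n β → Vanish (suc (s ℕ.+ t)) (m ℕ.+ n) (α ⋆ β)
    ⋆-Vanish {s} {t} {m} {n} {α} {β} hα hβ k h = ⋆-vanish α β k vanish
      where
      vanish : ∀ i j → i ℕ.+ j ≡ k → α i * β j ≡ 0F
      vanish i j refl with m ℕₚ.≤? s ℕ.+ i | n ℕₚ.≤? t ℕ.+ j
      ... | yes m≤ | _ = trans (*-congʳ (hα i m≤)) (zeroˡ _)
      ... | _ | yes n≤ = trans (*-congˡ (hβ j n≤)) (zeroʳ _)
      ... | no m≰ | no n≰ = ⊥-elim (ℕₚ.<⇒≱ lt h)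
        where
        lt : suc (s ℕ.+ t ℕ.+ (i ℕ.+ j)) < m ℕ.+ n
        lt = ℕₚ.≤-trans (ℕₚ.≤-reflexive (solveℕ 4 (λ s t i j → # 2 ⊹ (s ⊹ t ⊹ (i ⊹ j)) ≑ (# 1 ⊹ (s ⊹ i)) ⊹ (# 1 ⊹ (t ⊹ j))) refl s t i j))
                        (ℕₚ.+-mono-≤ (ℕₚ.≰⇒> m≰) (ℕₚ.≰⇒> n≰))

    -- Vanish s m implies Vanish s′ m′ if m − s ≤ m′ − s′
    weaken : ∀ {s m α} r s′ m′ → s′ ℕ.+ r ≡ s → m ≡ m′ ℕ.+ r → Vanish s m α → Vanish s′ m′ α
    weaken r s′ m′ refl refl h k le = h k (ℕₚ.≤-trans (ℕₚ.+-monoˡ-≤ r le)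
      (ℕₚ.≤-reflexive (solveℕ 3 (λ s k r → s ⊹ k ⊹ r ≑ s ⊹ r ⊹ k) refl s′ k r)))

    ∔-Vanish : ∀ {s m α β} → Vanish s m α → Vanish s m β → Vanish s m (α ∔ β)
    ∔-Vanish h h′ k l = trans (cong₂ _+_ (h k l) (h′ k l)) (+-identityˡ 0F)

    g-Vanish : Vanish 0 4 g
    g-Vanish = g-above

    -- In each case one product carries the leading coefficient: p·p′ for two even orders, p·q′ for
    -- an even and an odd one, and q·q′·g for two odd ones, where the monic cubic g stands for y²
    -- and accounts for 3 + 3 = 6. All other products lie strictly lower, which is what the uses of
    -- `weaken` record.
    leadR-* : ∀ {f h d e} → LeadR f d → LeadR h e → LeadR (f *R h) (d ℕ.+ e)
    leadR-* {f} {h} (even m c hp hq) (even n c′ hp′ hq′) =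
      subst (LeadR (f *R h)) (solveℕ 2 (λ m n → (m ⊹ n) ⊹ (m ⊹ n) ≑ (m ⊹ m) ⊹ (n ⊹ n)) refl m n)
        (even (m ℕ.+ n) (λ e → *-≢0 c c′ (trans (sym (trans (cong₂ _+_ (⋆-top hp hp′) (low (m ℕ.+ n) ℕₚ.≤-refl)) (+-identityʳ _))) e))
          (∔-above (⋆-Above hp hp′) (λ k l → low k (ℕₚ.<⇒≤ l)))
          (∔-Vanish {1} {m ℕ.+ n}
            (weaken 1 1 (m ℕ.+ n) refl (solveℕ 2 (λ m n → # 1 ⊹ m ⊹ n ≑ m ⊹ n ⊹ # 1) refl m n) (⋆-Vanish {0} {1} {suc m} {n} hp hq′))
            (weaken 1 1 (m ℕ.+ n) refl (solveℕ 2 (λ m n → m ⊹ (# 1 ⊹ n) ≑ m ⊹ n ⊹ # 1) refl m n) (⋆-Vanish {1} {0} {m} {suc n} hq hp′))))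
      where
      low : Vanish 0 (m ℕ.+ n) (q f ⋆ q h ⋆ g)
      low = weaken 4 0 (m ℕ.+ n) refl refl (⋆-Vanish {3} {0} {m ℕ.+ n} {4} (⋆-Vanish {1} {1} {m} {n} hq hq′) g-Vanish)
    leadR-* {f} {h} (even m c hp hq) (odd n c′ hq′ hp′) =
      subst (LeadR (f *R h)) (solveℕ 2 (λ m n → # 3 ⊹ ((m ⊹ n) ⊹ (m ⊹ n)) ≑ (m ⊹ m) ⊹ (# 3 ⊹ (n ⊹ n))) refl m n)
        (odd (m ℕ.+ n) (λ e → *-≢0 c c′ (trans (sym (trans (cong₂ _+_ (⋆-top hp hq′) (low (m ℕ.+ n) ℕₚ.≤-refl)) (+-identityʳ _))) e))
          (∔-above (⋆-Above hp hq′) (λ k l → low k (ℕₚ.<⇒≤ l)))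
          (∔-Vanish {0} {suc (suc (m ℕ.+ n))}
            (weaken 1 0 _ refl (solveℕ 2 (λ m n → # 1 ⊹ m ⊹ (# 2 ⊹ n) ≑ # 2 ⊹ (m ⊹ n) ⊹ # 1) refl m n) (⋆-Vanish {0} {0} {suc m} {suc (suc n)} hp hp′))
            (weaken 3 0 _ refl (solveℕ 2 (λ m n → m ⊹ (# 1 ⊹ n) ⊹ # 4 ≑ # 2 ⊹ (m ⊹ n) ⊹ # 3) refl m n)
              (⋆-Vanish {2} {0} {m ℕ.+ suc n} {4} (⋆-Vanish {1} {0} {m} {suc n} hq hq′) g-Vanish))))
      where
      low : Vanish 0 (m ℕ.+ n) (q f ⋆ p h)
      low = weaken 2 0 (m ℕ.+ n) refl (solveℕ 2 (λ m n → m ⊹ (# 2 ⊹ n) ≑ m ⊹ n ⊹ # 2) refl m n) (⋆-Vanish {1} {0} {m} {suc (suc n)} hq hp′)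
    leadR-* {f} {h} {d} {e} l@(odd _ _ _ _) l′@(even _ _ _ _) =
      leadR-resp (CommutativeRing.*-comm R-ring h f) (subst (LeadR (h *R f)) (ℕₚ.+-comm e d) (leadR-* l′ l))
    leadR-* {f} {h} (odd m c hq hp) (odd n c′ hq′ hp′) =
      subst (LeadR (f *R h)) (solveℕ 2 (λ m n → (m ⊹ n ⊹ # 3) ⊹ (m ⊹ n ⊹ # 3) ≑ (# 3 ⊹ (m ⊹ m)) ⊹ (# 3 ⊹ (n ⊹ n))) refl m n)
        (even (m ℕ.+ n ℕ.+ 3)
          (λ e → *-≢0 c c′ (trans (sym (trans (cong₂ _+_ (low (m ℕ.+ n ℕ.+ 3) ℕₚ.≤-refl)
              (trans (⋆-top (⋆-Above hq hq′) g-above) (trans (*-identityʳ _) (⋆-top hq hq′)))) (+-identityˡ _))) e))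
          (∔-above (λ k l → low k (ℕₚ.<⇒≤ l)) (⋆-Above (⋆-Above hq hq′) g-above))
          (∔-Vanish {1} {m ℕ.+ n ℕ.+ 3}
            (weaken 0 1 _ refl (solveℕ 2 (λ m n → # 2 ⊹ m ⊹ (# 1 ⊹ n) ≑ m ⊹ n ⊹ # 3 ⊹ # 0) refl m n) (⋆-Vanish {0} {0} {suc (suc m)} {suc n} hp hq′))
            (weaken 0 1 _ refl (solveℕ 2 (λ m n → # 1 ⊹ m ⊹ (# 2 ⊹ n) ≑ m ⊹ n ⊹ # 3 ⊹ # 0) refl m n) (⋆-Vanish {0} {0} {suc m} {suc (suc n)} hq hp′))))
      where
      low : Vanish 0 (m ℕ.+ n ℕ.+ 3) (p f ⋆ p h)
      low = weaken 1 0 _ refl (solveℕ 2 (λ m n → # 2 ⊹ m ⊹ (# 2 ⊹ n) ≑ m ⊹ n ⊹ # 3 ⊹ # 1) refl m n) (⋆-Vanish {0} {0} {suc (suc m)} {suc (suc n)} hp hp′)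

    coordinateRing : CoordinateRing 𝔽 g₂ g₁ g₀
    coordinateRing = record
      { coordinates = R-ring
      ; κ = κR
      ; κ-+ = λ c d → (λ { zero → refl ; (suc n) → sym (+-identityˡ 0F) }) , λ n → sym (+-identityˡ 0F)
      ; κ-* = λ c d → (λ { zero → sym (κ*-p c (κR d) 0) ; (suc n) → sym (trans (κ*-p c (κR d) (suc n)) (zeroʳ c)) })
                    , (λ n → sym (trans (κ*-q c (κR d) n) (zeroʳ c)))
      ; κ-‿ = λ c → (λ { zero → refl ; (suc n) → sym neg0 }) , (λ n → sym neg0)
      ; κ-0 = (λ { zero → refl ; (suc n) → refl }) , (λ n → refl)
      ; κ-1 = (λ n → refl) , (λ n → refl)
      ; X = XR ; Y = YR
      ; Y² = Y²R
      ; Lead = LeadR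
      ; lead-resp = leadR-resp
      ; lead-* = leadR-*
      ; lead-unique = leadR-unique
      ; lead-0 = leadR-0
      ; lead? = leadR?
      ; lead-const = λ c≢0 → even 0 c≢0 (λ { (suc k) _ → refl }) (λ _ _ → refl)
      ; lead-X = λ e → even 1 (λ z → 1≢0 (trans (sym (+-identityʳ 1F)) z)) (λ { (suc (suc k)) _ → +-identityˡ 0F ; (suc zero) (s≤s ()) }) (λ k _ → +-identityˡ 0F)
      ; lead-Y = lead-YR
      ; order-0 = order-0R
      ; order-1 = order-1R
      ; order-2 = order-2R
      ; order-3 = order-3R
      ; independent = independentR
      }
      where
      neg0 : - 0F ≡ 0F
      neg0 = trans (sym (+-identityˡ _)) (-‿inverseʳ 0F)
      +0ˡ : ∀ {x y z} → x ≡ 0F → y ≡ z → x + y ≡ z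
      +0ˡ e e′ = trans (cong₂ _+_ e e′) (+-identityˡ _)
      +0ʳ : ∀ {x y z} → x ≡ z → y ≡ 0F → x + y ≡ z
      +0ʳ e e′ = trans (cong₂ _+_ e e′) (+-identityʳ _)
      κX-p : ∀ c n → p (κR c *R XR) n ≡ c * xs n
      κX-p c n = κ*-p c XR n
      κX-q : ∀ c n → q (κR c *R XR) n ≡ 0F
      κX-q c n = trans (κ*-q c XR n) (zeroʳ c)
      XX-p : ∀ n → p (XR *R XR) n ≡ shift xs n
      XX-p = X*-p XR
      XX-q : ∀ n → q (XR *R XR) n ≡ 0F
      XX-q zero = X*-q XR zero
      XX-q (suc n) = X*-q XR (suc n)
      XXX-p : ∀ n → p (XR *R XR *R XR) n ≡ shift (shift xs) n
      XXX-p n = trans (proj₁ (CommutativeRing.*-comm R-ring (XR *R XR) XR) n) (trans (X*-p (XR *R XR) n) (shift-cong n))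
        where
        shift-cong : ∀ n → shift (p (XR *R XR)) n ≡ shift (shift xs) n
        shift-cong zero = refl
        shift-cong (suc n) = XX-p n
      XXX-q : ∀ n → q (XR *R XR *R XR) n ≡ 0F
      XXX-q n = trans (proj₂ (CommutativeRing.*-comm R-ring (XR *R XR) XR) n) (trans (X*-q (XR *R XR) n) (shift0 n))
        where
        shift0 : ∀ n → shift (q (XR *R XR)) n ≡ 0F
        shift0 zero = refl
        shift0 (suc n) = XX-q n
      Y²R : (YR *R YR) ≈R ((((XR *R XR *R XR) +R (κR g₂ *R (XR *R XR))) +R (κR g₁ *R XR)) +R κR g₀)
      Y²R = (λ n → trans (trans (Y*-p YR n) (trans (cst-⋆ 1F g n) (*-identityˡ _)))
                     (sym (trans (cong₂ _+_ (cong₂ _+_ (cong₂ _+_ (XXX-p n) (trans (κ*-p g₂ (XR *R XR) n) (*-congˡ (XX-p n)))) (κX-p g₁ n)) refl) (go n))))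
          , (λ n → trans (Y*-q YR n) (sym (+0ˡ (+0ˡ (+0ˡ (XXX-q n) (trans (κ*-q g₂ (XR *R XR) n) (trans (*-congˡ (XX-q n)) (zeroʳ _)))) (κX-q g₁ n)) refl)))
        where
        go : ∀ n → shift (shift xs) n + g₂ * shift xs n + g₁ * xs n + cst g₀ n ≡ g n
        go 0 = solve 3 (λ a b c → num 0 :+ a :* num 0 :+ b :* num 0 :+ c := c) refl g₂ g₁ g₀
        go 1 = solve 2 (λ a b → num 0 :+ a :* num 0 :+ b :* (:1) :+ num 0 := b) refl g₂ g₁
        go 2 = solve 2 (λ a b → num 0 :+ a :* (:1) :+ b :* num 0 :+ num 0 := a) refl g₂ g₁
        go 3 = solve 2 (λ a b → (:1) :+ a :* num 0 :+ b :* num 0 :+ num 0 := (:1)) refl g₂ g₁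
        go (suc (suc (suc (suc n)))) = solve 2 (λ a b → num 0 :+ a :* num 0 :+ b :* num 0 :+ num 0 := num 0) refl g₂ g₁
      lead-YR : ∀ d e → LeadR (YR +R ((κR d *R XR) +R κR e)) 3
      lead-YR d e = odd 0 (λ z → 1≢0 (trans (sym (+0ʳ refl (+0ˡ (κX-q d 0) refl))) z))
        (λ { (suc k) _ → +0ˡ refl (+0ˡ (κX-q d (suc k)) refl) })
        (λ { (suc (suc k)) _ → +0ˡ refl (+0ʳ (trans (κX-p d (suc (suc k))) (zeroʳ d)) refl) ; (suc zero) (s≤s ()) })
      order-0R : ∀ {f} → LeadR f 0 → ∃[ c ] (c ≢ 0F × f ≈R κR c)
      order-0R {f} l = go l refl
        where
        go : ∀ {d} → LeadR f d → d ≡ 0 → ∃[ c ] (c ≢ 0F × f ≈R κR c)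
        go (even zero c hp hq) _ = p f 0 , c , (λ { zero → refl ; (suc n) → hp (suc n) (s≤s z≤n) }) , (λ n → hq n z≤n)
      order-1R : ∀ {f} → ¬ LeadR f 1
      order-1R {f} l = go l refl
        where
        go : ∀ {d} → LeadR f d → d ≡ 1 → ⊥
        go (even (suc n) _ _ _) e with () ← trans (sym (ℕₚ.+-suc n n)) (ℕₚ.suc-injective e)
      order-2R : ∀ {f} → LeadR f 2 → ∃[ c ] ∃[ e ] (c ≢ 0F × f ≈R ((κR c *R XR) +R κR e))
      order-2R {f} l = go l refl
        where
        go : ∀ {d} → LeadR f d → d ≡ 2 → ∃[ c ] ∃[ e ] (c ≢ 0F × f ≈R ((κR c *R XR) +R κR e))
        go (even 1 c hp hq) _ = p f 1 , p f 0 , c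
          , (λ { 0 → sym (+0ˡ (trans (κX-p _ 0) (zeroʳ _)) refl)
               ; 1 → sym (+0ʳ (trans (κX-p _ 1) (*-identityʳ _)) refl)
               ; (suc (suc n)) → trans (hp (suc (suc n)) (s≤s (s≤s z≤n))) (sym (+0ˡ (trans (κX-p _ (suc (suc n))) (zeroʳ _)) refl)) })
          , (λ n → trans (hq n (s≤s z≤n)) (sym (+0ˡ (κX-q _ n) refl)))
        go (even (suc (suc n)) _ _ _) e with () ← trans (sym (ℕₚ.+-suc n (suc n))) (ℕₚ.suc-injective (ℕₚ.suc-injective e))
      order-3R : ∀ {f} → LeadR f 3 → ∃[ c ] ∃[ d ] ∃[ e ] (c ≢ 0F × f ≈R ((κR c *R YR) +R ((κR d *R XR) +R κR e)))
      order-3R {f} l = go l refl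
        where
        κY-p : ∀ c n → p (κR c *R YR) n ≡ 0F
        κY-p c n = trans (κ*-p c YR n) (zeroʳ c)
        go : ∀ {d} → LeadR f d → d ≡ 3 → ∃[ c ] ∃[ d ] ∃[ e ] (c ≢ 0F × f ≈R ((κR c *R YR) +R ((κR d *R XR) +R κR e)))
        go (odd 0 c hq hp) _ = q f 0 , p f 1 , p f 0 , c
          , (λ { 0 → sym (+0ˡ (κY-p _ 0) (+0ˡ (trans (κX-p _ 0) (zeroʳ _)) refl))
               ; 1 → sym (+0ˡ (κY-p _ 1) (+0ʳ (trans (κX-p _ 1) (*-identityʳ _)) refl))
               ; (suc (suc n)) → trans (hp (suc (suc n)) (s≤s (s≤s z≤n)))
                                   (sym (+0ˡ (κY-p _ (suc (suc n))) (+0ˡ (trans (κX-p _ (suc (suc n))) (zeroʳ _)) refl))) })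
          , (λ { 0 → sym (+0ʳ (trans (κ*-q _ YR 0) (*-identityʳ _)) (+0ˡ (κX-q _ 0) refl))
               ; (suc n) → trans (hq (suc n) (s≤s z≤n)) (sym (+0ˡ (trans (κ*-q _ YR (suc n)) (zeroʳ _)) (+0ˡ (κX-q _ (suc n)) refl))) })
        go (odd (suc n) _ _ _) ()
        go (even 1 _ _ _) ()
        go (even (suc (suc n)) _ _ _) e with () ← trans (sym (ℕₚ.+-suc n n)) (ℕₚ.suc-injective (trans (sym (ℕₚ.+-suc n (suc n))) (ℕₚ.suc-injective (ℕₚ.suc-injective e))))
      independentR : ∀ {c₀ c₁ c₂ d₀ d₁} →
        ((((κR c₀ +R (κR c₁ *R XR)) +R (κR c₂ *R (XR *R XR))) +R ((κR d₀ +R (κR d₁ *R XR)) *R YR)) ≈R 0R) →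
        (c₀ ≡ 0F × c₁ ≡ 0F × c₂ ≡ 0F) × (d₀ ≡ 0F × d₁ ≡ 0F)
      independentR {c₀} {c₁} {c₂} {d₀} {d₁} (e , e′) =
        (trans (sym (P0 0 (solve 3 (λ x y z → x :+ y :* num 0 :+ z :* num 0 := x) refl c₀ c₁ c₂))) (e 0)
        , trans (sym (P0 1 (solve 2 (λ y z → num 0 :+ y :* (:1) :+ z :* num 0 := y) refl c₁ c₂))) (e 1)
        , trans (sym (P0 2 (solve 2 (λ y z → num 0 :+ y :* num 0 :+ z :* (:1) := z) refl c₁ c₂))) (e 2))
        , (trans (sym (Q0 0 (+0ʳ refl (zeroʳ d₁)))) (e′ 0) , trans (sym (Q0 1 (+0ˡ refl (*-identityʳ d₁)))) (e′ 1))
        where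
        L : Element
        L = κR d₀ +R (κR d₁ *R XR)
        LY-p : ∀ n → p (L *R YR) n ≡ 0F
        LY-p n = trans (proj₁ (CommutativeRing.*-comm R-ring L YR) n)
                   (trans (Y*-p L n) (⋆-zero (λ k → +0ˡ refl (κX-q d₁ k)) g n))
        P0 : ∀ n {z} → cst c₀ n + c₁ * xs n + c₂ * shift xs n ≡ z →
             p ((((κR c₀ +R (κR c₁ *R XR)) +R (κR c₂ *R (XR *R XR))) +R (L *R YR))) n ≡ z
        P0 n h = +0ʳ (trans (cong₂ _+_ (+-congˡ (κX-p c₁ n)) (trans (κ*-p c₂ (XR *R XR) n) (*-congˡ (XX-p n)))) h) (LY-p n)
        Q0 : ∀ n {z} → cst d₀ n + d₁ * xs n ≡ z →
             q ((((κR c₀ +R (κR c₁ *R XR)) +R (κR c₂ *R (XR *R XR))) +R (L *R YR))) n ≡ z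
        Q0 n h = +0ˡ (+0ˡ (+0ˡ refl (κX-q c₁ n)) (trans (κ*-q c₂ (XR *R XR) n) (trans (*-congˡ (XX-q n)) (zeroʳ _))))
                   (trans (proj₂ (CommutativeRing.*-comm R-ring L YR) n) (trans (Y*-q L n) (trans (+-congˡ (κX-p d₁ n)) h)))

-- Ideal classes of points

module IdealClassComparison where
  open RingSolving
  open PowerSeries
  open CoordinateRings
  open import Data.Fin using (Fin; zero; suc; #_)
  open import Data.Integer as ℤ using (ℤ)
  open import Data.Nat as ℕ using (ℕ; zero; suc; _≤_; z≤n; s≤s)
  import Data.Nat.Properties as ℕₚ
  open import Data.Product using (_×_; _,_; proj₁; proj₂; ∃-syntax)
  open import Data.Sum using (_⊎_; inj₁; inj₂)
  open import Data.Empty using (⊥; ⊥-elim)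
  open import Data.Unit using (⊤; tt)
  open import Data.Vec as Vec using (Vec; []; _∷_)
  open import Relation.Nullary using (¬_; yes; no; Dec)
  open import Relation.Binary.PropositionalEquality as ≡ using (_≡_; _≢_; refl; cong; cong₂; subst; module ≡-Reasoning)

  module Comparison (𝔽 : DecField) where
    open DecField 𝔽
    open ≡-Reasoning

    -- Final computation of `aff-class`: e = -cx says that the function cX + e vanishes at x, while
    -- it also vanishes at x′. In the same way `compare-y` compares the zeros of cY + e, after the
    -- coefficient d has been found to be 0.
    compare-x : ∀ {c c₁ e x x′} → c ≢ 0F → c - c₁ ≡ 0F → e + c₁ * x ≡ 0F → c * x′ + e ≡ 0F → x ≡ x′
    compare-x {c} {c₁} {e} {x} {x′} c≢0 h h₁ h₂ = -≡0⇒≡ (cancelˡ c c≢0 (begin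
      c * (x - x′)                                ≡⟨ solve 5 (λ c c₁ x x′ e → c :* (x :- x′) := (e :+ c₁ :* x) :- (c :* x′ :+ e) :+ (c :- c₁) :* x) refl c c₁ x x′ e ⟩
      e + c₁ * x - (c * x′ + e) + (c - c₁) * x    ≡⟨ cong₂ _+_ (cong₂ _-_ h₁ h₂) (cong (_* x) h) ⟩
      0F - 0F + 0F * x                            ≡⟨ solve 1 (λ x → num 0 :- num 0 :+ num 0 :* x := num 0) refl x ⟩
      0F                                          ∎))

    compare-y : ∀ {c c₁ d e x x′ y y′} → c ≢ 0F → c - c₁ ≡ 0F → - (c * y) + d * x - e ≡ 0F → - d ≡ 0F →
                c₁ * y′ + (d * x′ + e) ≡ 0F → y ≡ y′
    compare-y {c} {c₁} {d} {e} {x} {x′} {y} {y′} c≢0 h h₁ h₂ h₃ = -≡0⇒≡ (cancelˡ c c≢0 (begin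
      c * (y - y′)
        ≡⟨ solve 8 (λ c c₁ d e x x′ y y′ → c :* (y :- y′)
             := :- (:- (c :* y) :+ d :* x :- e) :- (c₁ :* y′ :+ (d :* x′ :+ e)) :+ ((:- (:- d)) :* (x :+ x′) :- (c :- c₁) :* y′)) refl c c₁ d e x x′ y y′ ⟩
      - (- (c * y) + d * x - e) - (c₁ * y′ + (d * x′ + e)) + (- (- d) * (x + x′) - (c - c₁) * y′)
        ≡⟨ cong₂ _+_ (cong₂ (λ u v → - u - v) h₁ h₃) (cong₂ (λ u v → - u * (x + x′) - v * y′) h₂ h) ⟩
      - 0F - 0F + (- 0F * (x + x′) - 0F * y′)
        ≡⟨ solve 3 (λ x x′ y′ → :- (num 0) :- num 0 :+ ((:- (num 0)) :* (x :+ x′) :- num 0 :* y′) := num 0) refl x x′ y′ ⟩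
      0F ∎))

  module IdealClasses {𝔽 : DecField} {g₂ g₁ g₀ : DecField.F 𝔽} (CR : CoordinateRing 𝔽 g₂ g₁ g₀) where
    private module 𝔽 = DecField 𝔽
    open 𝔽 using (F; 0F; 1F)
    open Comparison 𝔽
    open CoordinateRing CR hiding (zero) renaming (refl to ≈-refl; sym to ≈-sym; trans to ≈-trans)
    open RingSolver coordinates using (solve) renaming (⟦_⟧E to ⟦_⟧R; ⟦_⟧ℤ to ⟦_⟧ℤR)
    private module FS = RingSolver 𝔽.ring
    open import Relation.Binary.Reasoning.Setoid setoid

    κ-ℕ : ∀ n → κ FS.⟦ ℤ.+ n ⟧ℤ ≈ ⟦ ℤ.+ n ⟧ℤR
    κ-ℕ zero    = κ-0
    κ-ℕ (suc n) = ≈-trans (κ-+ _ _) (+-cong κ-1 (κ-ℕ n))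

    κ-ℤ : ∀ z → κ FS.⟦ z ⟧ℤ ≈ ⟦ z ⟧ℤR
    κ-ℤ (ℤ.+ n)    = κ-ℕ n
    κ-ℤ ℤ.-[1+ n ] = ≈-trans (κ-‿ _) (-‿cong (κ-ℕ (suc n)))

    κ-expr : ∀ {n} (e : Expr n) ρ → κ (FS.⟦ e ⟧E ρ) ≈ ⟦ e ⟧R (Vec.map κ ρ)
    κ-expr (con z)   ρ = κ-ℤ z
    κ-expr :1        ρ = κ-1
    κ-expr (var i)   ρ = κ-var i ρ
      where
      κ-var : ∀ {n} (i : Fin n) ρ → κ (Vec.lookup ρ i) ≈ Vec.lookup (Vec.map κ ρ) i
      κ-var zero    (x ∷ ρ) = ≈-refl
      κ-var (suc i) (x ∷ ρ) = κ-var i ρ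
    κ-expr (e :+ e′) ρ = ≈-trans (κ-+ _ _) (+-cong (κ-expr e ρ) (κ-expr e′ ρ))
    κ-expr (e :* e′) ρ = ≈-trans (κ-* _ _) (*-cong (κ-expr e ρ) (κ-expr e′ ρ))
    κ-expr (:- e)    ρ = ≈-trans (κ-‿ _) (-‿cong (κ-expr e ρ))

    -- Equations between coordinates of points enter computations in the coordinate ring this way: κ
    -- is pushed down to the variables of a reified expression.
    lift : ∀ {n} (e e′ : Expr n) ρ → FS.⟦ e ⟧E ρ ≡ FS.⟦ e′ ⟧E ρ → ⟦ e ⟧R (Vec.map κ ρ) ≈ ⟦ e′ ⟧R (Vec.map κ ρ)
    lift e e′ ρ h = ≈-trans (≈-sym (κ-expr e ρ)) (≈-trans (reflexive (cong κ h)) (κ-expr e′ ρ))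

    -- Orders of poles add, so a product of two elements that have an order cannot be 0: the ring is
    -- a domain.
    cancel-lead : ∀ {α d f h} → Lead α d → α * f ≈ α * h → f ≈ h
    cancel-lead {α} {d} {f} {h} l e with lead? (f - h)
    ... | inj₁ z = begin
      f            ≈⟨ solve 2 (λ f h → f := (f :- h) :+ h) refl f h ⟩
      (f - h) + h  ≈⟨ +-congʳ z ⟩
      0# + h       ≈⟨ +-identityˡ h ⟩
      h            ∎
    ... | inj₂ (_ , l′) = ⊥-elim (lead-0 (lead-resp zero′ (lead-* l l′)))
      where
      zero′ : α * (f - h) ≈ 0#
      zero′ = begin
        α * (f - h)    ≈⟨ solve 3 (λ α f h → α :* (f :- h) := α :* f :- α :* h) refl α f h ⟩
        α * f - α * h  ≈⟨ +-congʳ e ⟩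
        α * h - α * h  ≈⟨ -‿inverseʳ _ ⟩
        0#             ∎

    Subset : Set₁
    Subset = Carrier → Set

    -- The additive closure of the products ab. Closure under the whole ring is not built in; for
    -- ideals of points it follows by absorbing a scalar into the left factor, as in `·-scale`.
    data _·_ (I J : Subset) : Subset where
      mul : ∀ {a b r} → I a → J b → r ≈ a * b → (I · J) r
      add : ∀ {r s t} → (I · J) r → (I · J) s → t ≈ r + s → (I · J) t

    ·-resp : ∀ {I J r s} → r ≈ s → (I · J) r → (I · J) s
    ·-resp e (mul i j h) = mul i j (≈-trans (≈-sym e) h)
    ·-resp e (add m n h) = add m n (≈-trans (≈-sym e) h)

    -- αI = βJ for nonzero α and β
    record _~_ (I J : Subset) : Set where
      field
        {α β} : Carrier
        {d e} : ℕ
        α-lead : Lead α d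
        β-lead : Lead β e
        to   : ∀ r → I r → ∃[ s ] (J s × α * r ≈ β * s)
        from : ∀ s → J s → ∃[ r ] (I r × β * s ≈ α * r)

    1-lead : Lead 1# 0
    1-lead = lead-resp κ-1 (lead-const 𝔽.1≢0)

    ~-sym : ∀ {I J} → I ~ J → J ~ I
    ~-sym h = record { α-lead = β-lead ; β-lead = α-lead ; to = from ; from = to }
      where open _~_ h

    ~-trans : ∀ {I J K} → I ~ J → J ~ K → I ~ K
    ~-trans h h′ = record
      { α-lead = lead-* (α-lead h) (α-lead h′)
      ; β-lead = lead-* (β-lead h) (β-lead h′)
      ; to = λ r i → let s , j , e = to h r i ; t , k , e′ = to h′ s j in t , k , (begin
          α h * α h′ * r    ≈⟨ solve 3 (λ a c r → a :* c :* r := c :* (a :* r)) refl (α h) (α h′) r ⟩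
          α h′ * (α h * r)  ≈⟨ *-congˡ e ⟩
          α h′ * (β h * s)  ≈⟨ solve 3 (λ a c r → c :* (a :* r) := a :* (c :* r)) refl (β h) (α h′) s ⟩
          β h * (α h′ * s)  ≈⟨ *-congˡ e′ ⟩
          β h * (β h′ * t)  ≈⟨ *-assoc _ _ _ ⟨
          β h * β h′ * t    ∎)
      ; from = λ t k → let s , j , e = from h′ t k ; r , i , e′ = from h s j in r , i , (begin
          β h * β h′ * t    ≈⟨ *-assoc _ _ _ ⟩
          β h * (β h′ * t)  ≈⟨ *-congˡ e ⟩
          β h * (α h′ * s)  ≈⟨ solve 3 (λ a c r → c :* (a :* r) := a :* (c :* r)) refl (α h′) (β h) s ⟩
          α h′ * (β h * s)  ≈⟨ *-congˡ e′ ⟩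
          α h′ * (α h * r)  ≈⟨ solve 3 (λ a c r → c :* (a :* r) := a :* c :* r) refl (α h) (α h′) r ⟩
          α h * α h′ * r    ∎)
      }
      where open _~_

    ·-mono : ∀ {I J α β} K → (∀ r → I r → ∃[ s ] (J s × α * r ≈ β * s)) →
             ∀ r → (I · K) r → ∃[ s ] ((J · K) s × α * r ≈ β * s)
    ·-mono {I} {J} {α} {β} K h r (mul {a} {b} i k e) with h a i
    ... | s , j , e′ = s * b , mul j k ≈-refl , (begin
      α * r        ≈⟨ *-congˡ e ⟩
      α * (a * b)  ≈⟨ *-assoc _ _ _ ⟨
      α * a * b    ≈⟨ *-congʳ e′ ⟩
      β * s * b    ≈⟨ *-assoc _ _ _ ⟩
      β * (s * b)  ∎)
    ·-mono {I} {J} {α} {β} K h r (add {u} {v} m n e) with ·-mono K h u m | ·-mono K h v n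
    ... | s , j , e₁ | t , k , e₂ = s + t , add j k ≈-refl , (begin
      α * r          ≈⟨ *-congˡ e ⟩
      α * (u + v)    ≈⟨ distribˡ _ _ _ ⟩
      α * u + α * v  ≈⟨ +-cong e₁ e₂ ⟩
      β * s + β * t  ≈⟨ distribˡ _ _ _ ⟨
      β * (s + t)    ∎)

    ·-congʳ : ∀ {I J} K → I ~ J → (I · K) ~ (J · K)
    ·-congʳ K h = record { α-lead = α-lead ; β-lead = β-lead ; to = ·-mono K to ; from = ·-mono K from }
      where open _~_ h

    ⊆⊇⇒~ : ∀ {I J} → (∀ r → I r → J r) → (∀ r → J r → I r) → I ~ J
    ⊆⊇⇒~ to from = record { α-lead = 1-lead ; β-lead = 1-lead
      ; to = λ r i → r , to r i , ≈-refl ; from = λ r j → r , from r j , ≈-refl }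

    ·-swap : ∀ {I J} r → (I · J) r → (J · I) r
    ·-swap r (mul i j e) = mul j i (≈-trans e (*-comm _ _))
    ·-swap r (add m n e) = add (·-swap _ m) (·-swap _ n) e

    ·-comm : ∀ I J → (I · J) ~ (J · I)
    ·-comm I J = ⊆⊇⇒~ ·-swap ·-swap

    ·-congˡ : ∀ {I J} K → I ~ J → (K · I) ~ (K · J)
    ·-congˡ {I} {J} K h = ~-trans (·-comm K I) (~-trans (·-congʳ K h) (·-comm J K))

    ·-assoc : ∀ I J K → ((I · J) · K) ~ (I · (J · K))
    ·-assoc I J K = ⊆⊇⇒~ right left
      where
      right₁ : ∀ {u k} → (I · J) u → K k → (I · (J · K)) (u * k)
      right₁ (mul i j e) k = mul i (mul j k ≈-refl) (≈-trans (*-congʳ e) (*-assoc _ _ _))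
      right₁ (add m n e) k = add (right₁ m k) (right₁ n k) (≈-trans (*-congʳ e) (distribʳ _ _ _))
      right : ∀ r → ((I · J) · K) r → (I · (J · K)) r
      right r (mul m k e) = ·-resp (≈-sym e) (right₁ m k)
      right r (add m n e) = add (right _ m) (right _ n) e
      left₁ : ∀ {i u} → I i → (J · K) u → ((I · J) · K) (i * u)
      left₁ i (mul j k e) = mul (mul i j ≈-refl) k (≈-trans (*-congˡ e) (≈-sym (*-assoc _ _ _)))
      left₁ i (add m n e) = add (left₁ i m) (left₁ i n) (≈-trans (*-congˡ e) (distribˡ _ _ _))
      left : ∀ r → (I · (J · K)) r → ((I · J) · K) r
      left r (mul i m e) = ·-resp (≈-sym e) (left₁ i m)
      left r (add m n e) = add (left _ m) (left _ n) e

    data Pt : Set where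
      O   : Pt
      aff : F → F → Pt

    On : Pt → Set
    On O = ⊤
    On (aff x y) = y 𝔽.* y ≡ x 𝔽.* x 𝔽.* x 𝔽.+ g₂ 𝔽.* (x 𝔽.* x) 𝔽.+ g₁ 𝔽.* x 𝔽.+ g₀

    ξ η : F → Carrier
    ξ x = X - κ x
    η y = Y - κ y

    -- An affine point gives its maximal ideal, generated by X - x and Y - y. The point at infinity
    -- gives the unit ideal, which represents the trivial class.
    Ideal : Pt → Subset
    Ideal O r = ⊤
    Ideal (aff x y) r = ∃[ u ] ∃[ w ] r ≈ u * ξ x + w * η y

    ξ∈ : ∀ {x y} → Ideal (aff x y) (ξ x)
    ξ∈ {x} {y} = 1# , 0# , solve 2 (λ a b → a := :1 :* a :+ num 0 :* b) refl (ξ x) (η y)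

    η∈ : ∀ {x y} → Ideal (aff x y) (η y)
    η∈ {x} {y} = 0# , 1# , solve 2 (λ a b → b := num 0 :* a :+ :1 :* b) refl (ξ x) (η y)

    ideal-* : ∀ P c {r} → Ideal P r → Ideal P (c * r)
    ideal-* O c _ = tt
    ideal-* (aff x y) c (u , w , e) = c * u , c * w , ≈-trans (*-congˡ e)
      (solve 5 (λ c u w a b → c :* (u :* a :+ w :* b) := c :* u :* a :+ c :* w :* b) refl c u w (ξ x) (η y))

    ideal-resp : ∀ P {r s} → r ≈ s → Ideal P r → Ideal P s
    ideal-resp O _ _ = tt
    ideal-resp (aff x y) e (u , w , h) = u , w , ≈-trans (≈-sym e) h

    ideal-+ : ∀ P {r s} → Ideal P r → Ideal P s → Ideal P (r + s)
    ideal-+ O _ _ = tt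
    ideal-+ (aff x y) (u , w , e) (u′ , w′ , e′) = u + u′ , w + w′ , ≈-trans (+-cong e e′)
      (solve 6 (λ u w u′ w′ a b → (u :* a :+ w :* b) :+ (u′ :* a :+ w′ :* b) := (u :+ u′) :* a :+ (w :+ w′) :* b) refl u w u′ w′ (ξ x) (η y))

    ·-scale : ∀ P Q c {r} → (Ideal P · Ideal Q) r → (Ideal P · Ideal Q) (c * r)
    ·-scale P Q c (mul i j e) = mul (ideal-* P c i) j (≈-trans (*-congˡ e) (≈-sym (*-assoc _ _ _)))
    ·-scale P Q c (add m n e) = add (·-scale P Q c m) (·-scale P Q c n) (≈-trans (*-congˡ e) (distribˡ _ _ _))

    ξ-lead : ∀ x → Lead (ξ x) 2
    ξ-lead x = lead-resp (+-congˡ (κ-‿ x)) (lead-X (𝔽.- x))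

    η-lead : ∀ y → Lead (η y) 3
    η-lead y = lead-resp (≈-trans (+-congˡ (+-cong (*-congʳ κ-0) (κ-‿ y)))
      (solve 3 (λ Y X y → Y :+ (num 0 :* X :- y) := Y :- y) refl Y X (κ y))) (lead-Y 0F (𝔽.- y))

    -- The four coefficients of (Y² − L²) = (X − x₁)(X − x₂)(X − x₃), for the line L = y₁ + Λ(X − x₁).
    record Secant (x₁ y₁ x₂ x₃ Λ : F) : Set where
      constructor secant
      field
        quadratic : g₂ 𝔽.- Λ 𝔽.* Λ 𝔽.+ (x₁ 𝔽.+ x₂ 𝔽.+ x₃) ≡ 0F
        linear    : g₁ 𝔽.- (Λ 𝔽.* (y₁ 𝔽.- Λ 𝔽.* x₁) 𝔽.+ Λ 𝔽.* (y₁ 𝔽.- Λ 𝔽.* x₁)) 𝔽.- (x₁ 𝔽.* x₂ 𝔽.+ x₁ 𝔽.* x₃ 𝔽.+ x₂ 𝔽.* x₃) ≡ 0F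
        constant  : g₀ 𝔽.- (y₁ 𝔽.- Λ 𝔽.* x₁) 𝔽.* (y₁ 𝔽.- Λ 𝔽.* x₁) 𝔽.+ x₁ 𝔽.* x₂ 𝔽.* x₃ ≡ 0F

    -- The line ℓ meets the curve in P₁, P₂ and the reflection of P₃, so its conjugate ℓ̄ vanishes
    -- at P₃ itself.
    module Line {x₁ y₁ x₂ y₂ x₃ y₃ Λ : F} (sec : Secant x₁ y₁ x₂ x₃ Λ)
                (through₂ : y₂ ≡ y₁ 𝔽.+ Λ 𝔽.* (x₂ 𝔽.- x₁)) (through₃ : y₃ ≡ 𝔽.- (y₁ 𝔽.+ Λ 𝔽.* (x₃ 𝔽.- x₁))) where
      open Secant sec
      L ℓ ℓ̄ : Carrier
      L = κ y₁ + κ Λ * ξ x₁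
      ℓ = Y - L
      ℓ̄ = Y + L

      ℓ-lead : Lead ℓ 3
      ℓ-lead = lead-resp (begin
        Y + (κ (𝔽.- Λ) * X + κ (Λ 𝔽.* x₁ 𝔽.- y₁))
          ≈⟨ +-congˡ (+-cong (*-congʳ (κ-‿ Λ)) (κ-expr (var (# 0) :* var (# 1) :- var (# 2)) (Λ ∷ x₁ ∷ y₁ ∷ []))) ⟩
        Y + (- κ Λ * X + (κ Λ * κ x₁ - κ y₁))
          ≈⟨ solve 5 (λ Y X Λ x y → Y :+ ((:- Λ) :* X :+ (Λ :* x :- y)) := Y :- (y :+ Λ :* (X :- x))) refl Y X (κ Λ) (κ x₁) (κ y₁) ⟩
        ℓ ∎) (lead-Y (𝔽.- Λ) (Λ 𝔽.* x₁ 𝔽.- y₁))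

      η₁ : η y₁ ≈ ℓ + κ Λ * ξ x₁
      η₁ = solve 5 (λ Y X Λ x y → Y :- y := Y :- (y :+ Λ :* (X :- x)) :+ Λ :* (X :- x)) refl Y X (κ Λ) (κ x₁) (κ y₁)

      η₂ : η y₂ ≈ ℓ + κ Λ * ξ x₂
      η₂ = begin
        Y - κ y₂   ≈⟨ +-congˡ (-‿cong (lift (var (# 3)) (var (# 1) :+ var (# 4) :* (var (# 2) :- var (# 0))) (x₁ ∷ y₁ ∷ x₂ ∷ y₂ ∷ Λ ∷ []) through₂)) ⟩
        Y - (κ y₁ + κ Λ * (κ x₂ - κ x₁))
          ≈⟨ solve 6 (λ Y X Λ x y x′ → Y :- (y :+ Λ :* (x′ :- x)) := Y :- (y :+ Λ :* (X :- x)) :+ Λ :* (X :- x′)) refl Y X (κ Λ) (κ x₁) (κ y₁) (κ x₂) ⟩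
        ℓ + κ Λ * ξ x₂ ∎

      η₃ : η y₃ ≈ ℓ̄ - κ Λ * ξ x₃
      η₃ = begin
        Y - κ y₃   ≈⟨ +-congˡ (-‿cong (lift (var (# 3)) (:- (var (# 1) :+ var (# 4) :* (var (# 2) :- var (# 0)))) (x₁ ∷ y₁ ∷ x₃ ∷ y₃ ∷ Λ ∷ []) through₃)) ⟩
        Y - - (κ y₁ + κ Λ * (κ x₃ - κ x₁))
          ≈⟨ solve 6 (λ Y X Λ x y x′ → Y :- (:- (y :+ Λ :* (x′ :- x))) := Y :+ (y :+ Λ :* (X :- x)) :- Λ :* (X :- x′)) refl Y X (κ Λ) (κ x₁) (κ y₁) (κ x₃) ⟩
        ℓ̄ - κ Λ * ξ x₃ ∎

      -- The norm Y² - L² of ℓ is a monic cubic in X, and `Secant` says coefficient by coefficient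
      -- that its roots are x₁, x₂ and x₃.
      ℓℓ̄ : ℓ * ℓ̄ ≈ ξ x₁ * ξ x₂ * ξ x₃
      ℓℓ̄ = begin
        ℓ * ℓ̄            ≈⟨ solve 2 (λ Y L → (Y :- L) :* (Y :+ L) := Y :* Y :- L :* L) refl Y L ⟩
        Y * Y - L * L    ≈⟨ +-congʳ Y² ⟩
        (X * X * X + κ g₂ * (X * X) + κ g₁ * X + κ g₀) - L * L
          ≈⟨ solve 9 (λ X g₂ g₁ g₀ x₁ y₁ x₂ x₃ Λ →
               let L = y₁ :+ Λ :* (X :- x₁) ; ν = y₁ :- Λ :* x₁ in
               (X :* X :* X :+ g₂ :* (X :* X) :+ g₁ :* X :+ g₀) :- L :* L
               := (X :- x₁) :* (X :- x₂) :* (X :- x₃)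
                  :+ ((g₂ :- Λ :* Λ :+ (x₁ :+ x₂ :+ x₃)) :* (X :* X)
                  :+ (g₁ :- (Λ :* ν :+ Λ :* ν) :- (x₁ :* x₂ :+ x₁ :* x₃ :+ x₂ :* x₃)) :* X
                  :+ (g₀ :- ν :* ν :+ x₁ :* x₂ :* x₃)))
               refl X (κ g₂) (κ g₁) (κ g₀) (κ x₁) (κ y₁) (κ x₂) (κ x₃) (κ Λ) ⟩
        ξ x₁ * ξ x₂ * ξ x₃ + (_ * (X * X) + _ * X + _)
          ≈⟨ +-congˡ (+-cong (+-cong (*-congʳ q₀) (*-congʳ l₀)) c₀) ⟩
        ξ x₁ * ξ x₂ * ξ x₃ + (0# * (X * X) + 0# * X + 0#)
          ≈⟨ solve 2 (λ a X → a :+ (num 0 :* (X :* X) :+ num 0 :* X :+ num 0) := a) refl _ X ⟩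
        ξ x₁ * ξ x₂ * ξ x₃ ∎
        where
        ρ : Vec F 8
        ρ = g₂ ∷ g₁ ∷ g₀ ∷ x₁ ∷ y₁ ∷ x₂ ∷ x₃ ∷ Λ ∷ []
        :ν : Expr 8
        :ν = var (# 4) :- var (# 7) :* var (# 3)
        q₀ = lift (var (# 0) :- var (# 7) :* var (# 7) :+ (var (# 3) :+ var (# 5) :+ var (# 6))) (num 0) ρ quadratic
        l₀ = lift (var (# 1) :- (var (# 7) :* :ν :+ var (# 7) :* :ν) :- (var (# 3) :* var (# 5) :+ var (# 3) :* var (# 6) :+ var (# 5) :* var (# 6))) (num 0) ρ linear
        c₀ = lift (var (# 2) :- :ν :* :ν :+ var (# 3) :* var (# 5) :* var (# 6)) (num 0) ρ constant

      P₁ P₂ P₃ : Pt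
      P₁ = aff x₁ y₁
      P₂ = aff x₂ y₂
      P₃ = aff x₃ y₃

      ℓ∈₁ : Ideal P₁ ℓ
      ℓ∈₁ = - κ Λ , 1# , solve 5 (λ Y X Λ x y → Y :- (y :+ Λ :* (X :- x)) := (:- Λ) :* (X :- x) :+ :1 :* (Y :- y)) refl Y X (κ Λ) (κ x₁) (κ y₁)

      ℓ∈₂ : Ideal P₂ ℓ
      ℓ∈₂ = - κ Λ , 1# , (begin
        ℓ                                    ≈⟨ solve 3 (λ l Λ x → l := (:- Λ) :* x :+ :1 :* (l :+ Λ :* x)) refl ℓ (κ Λ) (ξ x₂) ⟩
        - κ Λ * ξ x₂ + 1# * (ℓ + κ Λ * ξ x₂) ≈⟨ +-congˡ (*-congˡ η₂) ⟨
        - κ Λ * ξ x₂ + 1# * η y₂             ∎)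

      -- The equivalence is ξ₃·I₁I₂ = ℓ·I₃. Writing η₁ and η₂ through ℓ, a product (Uξ₁ + wℓ)(U′ξ₂ +
      -- w′ℓ) has a single term free of ℓ, namely UU′ξ₁ξ₂, and multiplied by ξ₃ this becomes UU′ℓℓ̄.
      -- The converse requires ℓ itself to lie in I₁I₂; that is where chords and tangents differ, so
      -- it is left as a hypothesis.
      class : (Ideal P₁ · Ideal P₂) ℓ → (Ideal P₁ · Ideal P₂) ~ Ideal P₃
      class ℓ∈ = record { α-lead = ξ-lead x₃ ; β-lead = ℓ-lead ; to = to ; from = from }
        where
        to : ∀ r → (Ideal P₁ · Ideal P₂) r → ∃[ s ] (Ideal P₃ s × ξ x₃ * r ≈ ℓ * s)
        to r (add {r₁} {r₂} m n e) with to r₁ m | to r₂ n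
        ... | s , i , h | s′ , i′ , h′ = s + s′ , ideal-+ P₃ i i′ , (begin
          ξ x₃ * r                 ≈⟨ *-congˡ e ⟩
          ξ x₃ * (r₁ + r₂)         ≈⟨ distribˡ _ _ _ ⟩
          ξ x₃ * r₁ + ξ x₃ * r₂    ≈⟨ +-cong h h′ ⟩
          ℓ * s + ℓ * s′           ≈⟨ distribˡ _ _ _ ⟨
          ℓ * (s + s′)             ∎)
        to r (mul {a} {b} (u , w , ea) (u′ , w′ , eb) e) = s , s∈ , (begin
          ξ x₃ * r
            ≈⟨ *-congˡ (≈-trans e (*-cong (≈-trans ea (+-congˡ (*-congˡ η₁))) (≈-trans eb (+-congˡ (*-congˡ η₂))))) ⟩
          ξ x₃ * ((u * ξ x₁ + w * (ℓ + κ Λ * ξ x₁)) * (u′ * ξ x₂ + w′ * (ℓ + κ Λ * ξ x₂)))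
            ≈⟨ solve 9 (λ x₁ x₂ x₃ l Λ u w u′ w′ →
                 let U = u :+ w :* Λ ; U′ = u′ :+ w′ :* Λ in
                 x₃ :* ((u :* x₁ :+ w :* (l :+ Λ :* x₁)) :* (u′ :* x₂ :+ w′ :* (l :+ Λ :* x₂)))
                 := (U :* U′) :* (x₁ :* x₂ :* x₃) :+ l :* ((U :* x₁ :* w′ :+ w :* U′ :* x₂ :+ w :* w′ :* l) :* x₃))
                 refl (ξ x₁) (ξ x₂) (ξ x₃) ℓ (κ Λ) u w u′ w′ ⟩
          (U * U′) * (ξ x₁ * ξ x₂ * ξ x₃) + ℓ * (V * ξ x₃)
            ≈⟨ +-congʳ (*-congˡ ℓℓ̄) ⟨
          (U * U′) * (ℓ * ℓ̄) + ℓ * (V * ξ x₃)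
            ≈⟨ solve 4 (λ u l m v → u :* (l :* m) :+ l :* v := l :* (u :* m :+ v)) refl (U * U′) ℓ ℓ̄ (V * ξ x₃) ⟩
          ℓ * s ∎)
          where
          U U′ V s : Carrier
          U  = u + w * κ Λ
          U′ = u′ + w′ * κ Λ
          V  = U * ξ x₁ * w′ + w * U′ * ξ x₂ + w * w′ * ℓ
          s  = U * U′ * ℓ̄ + V * ξ x₃
          s∈ : Ideal P₃ s
          s∈ = U * U′ * κ Λ + V , U * U′ , (begin
            s  ≈⟨ solve 5 (λ t m v x Λ → t :* m :+ v :* x := (t :* Λ :+ v) :* x :+ t :* (m :- Λ :* x)) refl (U * U′) ℓ̄ V (ξ x₃) (κ Λ) ⟩
            (U * U′ * κ Λ + V) * ξ x₃ + U * U′ * (ℓ̄ - κ Λ * ξ x₃)  ≈⟨ +-congˡ (*-congˡ η₃) ⟨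
            (U * U′ * κ Λ + V) * ξ x₃ + U * U′ * η y₃  ∎)
        from : ∀ s → Ideal P₃ s → ∃[ r ] ((Ideal P₁ · Ideal P₂) r × ℓ * s ≈ ξ x₃ * r)
        from s (u , w , e) = (u - w * κ Λ) * ℓ + w * (ξ x₁ * ξ x₂)
          , add (·-scale P₁ P₂ _ ℓ∈) (·-scale P₁ P₂ _ (mul (ξ∈ {x₁} {y₁}) (ξ∈ {x₂} {y₂}) ≈-refl)) ≈-refl , (begin
          ℓ * s                                       ≈⟨ *-congˡ (≈-trans e (+-congˡ (*-congˡ η₃))) ⟩
          ℓ * (u * ξ x₃ + w * (ℓ̄ - κ Λ * ξ x₃))
            ≈⟨ solve 6 (λ u w Λ l m x → l :* (u :* x :+ w :* (m :- Λ :* x)) := x :* ((u :- w :* Λ) :* l) :+ w :* (l :* m)) refl u w (κ Λ) ℓ ℓ̄ (ξ x₃) ⟩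
          ξ x₃ * ((u - w * κ Λ) * ℓ) + w * (ℓ * ℓ̄)    ≈⟨ +-congˡ (*-congˡ ℓℓ̄) ⟩
          ξ x₃ * ((u - w * κ Λ) * ℓ) + w * (ξ x₁ * ξ x₂ * ξ x₃)
            ≈⟨ solve 5 (λ t w a b x → x :* t :+ w :* (a :* b :* x) := x :* (t :+ w :* (a :* b))) refl ((u - w * κ Λ) * ℓ) w (ξ x₁) (ξ x₂) (ξ x₃) ⟩
          ξ x₃ * ((u - w * κ Λ) * ℓ + w * (ξ x₁ * ξ x₂)) ∎)

    unscale : ∀ P Q c f → c ≢ 0F → (Ideal P · Ideal Q) (κ c * f) → (Ideal P · Ideal Q) f
    unscale P Q c f c≢0 m with 𝔽.inverse c c≢0
    ... | d , cd = ·-resp (begin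
      κ d * (κ c * f)   ≈⟨ solve 3 (λ d c f → d :* (c :* f) := c :* d :* f) refl (κ d) (κ c) f ⟩
      κ c * κ d * f     ≈⟨ *-congʳ (κ-* c d) ⟨
      κ (c 𝔽.* d) * f   ≈⟨ *-congʳ (reflexive (cong κ cd)) ⟩
      κ 1F * f          ≈⟨ *-congʳ κ-1 ⟩
      1# * f            ≈⟨ *-identityˡ f ⟩
      f                 ∎) (·-scale P Q (κ d) m)

    -- The nonzero constant x₂ - x₁ equals ξ₁ - ξ₂, and ℓ lies in both ideals, so (x₂ - x₁)ℓ = ξ₁ℓ -
    -- ℓξ₂ is in their product.
    class-chord : ∀ {x₁ y₁ x₂ y₂ x₃ y₃ Λ} (sec : Secant x₁ y₁ x₂ x₃ Λ) →
      y₂ ≡ y₁ 𝔽.+ Λ 𝔽.* (x₂ 𝔽.- x₁) → y₃ ≡ 𝔽.- (y₁ 𝔽.+ Λ 𝔽.* (x₃ 𝔽.- x₁)) → x₁ ≢ x₂ →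
      (Ideal (aff x₁ y₁) · Ideal (aff x₂ y₂)) ~ Ideal (aff x₃ y₃)
    class-chord {x₁} {y₁} {x₂} {y₂} sec t₂ t₃ x₁≢x₂ = class
      (unscale P₁ P₂ (x₂ 𝔽.- x₁) ℓ (λ e → x₁≢x₂ (≡.sym (𝔽.-≡0⇒≡ e)))
        (add (mul (ξ∈ {x₁} {y₁}) ℓ∈₂ ≈-refl) (mul (ideal-* P₁ (- 1#) ℓ∈₁) (ξ∈ {x₂} {y₂}) ≈-refl) (begin
          κ (x₂ 𝔽.- x₁) * ℓ           ≈⟨ *-congʳ (≈-trans (κ-+ _ _) (+-congˡ (κ-‿ _))) ⟩
          (κ x₂ - κ x₁) * ℓ           ≈⟨ solve 4 (λ X x₁ x₂ l → (x₂ :- x₁) :* l := (X :- x₁) :* l :+ (:- :1) :* l :* (X :- x₂)) refl X (κ x₁) (κ x₂) ℓ ⟩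
          ξ x₁ * ℓ + - 1# * ℓ * ξ x₂  ∎)))
      where open Line sec t₂ t₃

    -- The constant is now 2y₁ = ℓ̄ - ℓ - 2Λξ₁. Multiplied by ℓ it gives -ℓ² + ℓℓ̄ - 2Λξ₁ℓ, where
    -- ℓℓ̄ = ξ₁²ξ₃, so every term lies in the square of the ideal.
    class-tangent : ∀ {x₁ y₁ x₃ y₃ Λ} (sec : Secant x₁ y₁ x₁ x₃ Λ) →
      y₁ ≡ y₁ 𝔽.+ Λ 𝔽.* (x₁ 𝔽.- x₁) → y₃ ≡ 𝔽.- (y₁ 𝔽.+ Λ 𝔽.* (x₃ 𝔽.- x₁)) → y₁ 𝔽.+ y₁ ≢ 0F →
      (Ideal (aff x₁ y₁) · Ideal (aff x₁ y₁)) ~ Ideal (aff x₃ y₃)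
    class-tangent {x₁} {y₁} {x₃} {y₃} {Λ} sec t₂ t₃ 2y≢0 = class
      (unscale P₁ P₁ (y₁ 𝔽.+ y₁) ℓ 2y≢0
        (add (mul (ideal-* P₁ (- 1#) ℓ∈₁) ℓ∈₂ ≈-refl)
             (mul (ξ∈ {x₁} {y₁}) (ideal-+ P₁ (ideal-* P₁ (ξ x₃) (ξ∈ {x₁} {y₁})) (ideal-* P₁ (- (κ Λ + κ Λ)) ℓ∈₁)) ≈-refl) (begin
          κ (y₁ 𝔽.+ y₁) * ℓ                  ≈⟨ *-congʳ (κ-+ _ _) ⟩
          (κ y₁ + κ y₁) * ℓ
            ≈⟨ solve 5 (λ Y X Λ x y → let L = y :+ Λ :* (X :- x) ; l = Y :- L in
                 (y :+ y) :* l := (:- :1) :* l :* l :+ (l :* (Y :+ L) :+ (X :- x) :* ((:- (Λ :+ Λ)) :* l))) refl Y X (κ Λ) (κ x₁) (κ y₁) ⟩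
          - 1# * ℓ * ℓ + (ℓ * ℓ̄ + ξ x₁ * (- (κ Λ + κ Λ) * ℓ))
            ≈⟨ +-congˡ (+-congʳ ℓℓ̄) ⟩
          - 1# * ℓ * ℓ + (ξ x₁ * ξ x₁ * ξ x₃ + ξ x₁ * (- (κ Λ + κ Λ) * ℓ))
            ≈⟨ +-congˡ (solve 3 (λ a b c → a :* a :* b :+ a :* c := a :* (b :* a :+ c)) refl (ξ x₁) (ξ x₃) (- (κ Λ + κ Λ) * ℓ)) ⟩
          - 1# * ℓ * ℓ + ξ x₁ * (ξ x₃ * ξ x₁ + - (κ Λ + κ Λ) * ℓ)  ∎)))
      where open Line sec t₂ t₃

    -- The quotient (g(X) - g(x))/(X - x) for the cubic g; at X = x it takes the value g′(x).
    cofactor : F → Carrier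
    cofactor x = X * X + X * κ x + κ x * κ x + κ g₂ * (X + κ x) + κ g₁

    η-conjugates : ∀ {x y} → On (aff x y) → η y * η (𝔽.- y) ≈ ξ x * cofactor x
    η-conjugates {x} {y} on = begin
      (Y - κ y) * (Y - κ (𝔽.- y))  ≈⟨ *-congˡ (+-congˡ (-‿cong (κ-‿ y))) ⟩
      (Y - κ y) * (Y - - κ y)      ≈⟨ solve 2 (λ Y y → (Y :- y) :* (Y :- (:- y)) := Y :* Y :- y :* y) refl Y (κ y) ⟩
      Y * Y - κ y * κ y            ≈⟨ +-cong Y² (-‿cong (lift (var (# 1) :* var (# 1)) (var (# 0) :* var (# 0) :* var (# 0) :+ var (# 2) :* (var (# 0) :* var (# 0)) :+ var (# 3) :* var (# 0) :+ var (# 4)) (x ∷ y ∷ g₂ ∷ g₁ ∷ g₀ ∷ []) on)) ⟩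
      _                            ≈⟨ solve 5 (λ X x g₂ g₁ g₀ → (X :* X :* X :+ g₂ :* (X :* X) :+ g₁ :* X :+ g₀) :- (x :* x :* x :+ g₂ :* (x :* x) :+ g₁ :* x :+ g₀)
                                       := (X :- x) :* (X :* X :+ X :* x :+ x :* x :+ g₂ :* (X :+ x) :+ g₁)) refl X (κ x) (κ g₂) (κ g₁) (κ g₀) ⟩
      ξ x * cofactor x             ∎

    -- Among the products of generators only η(y)η(-y) has no visible factor ξ, and `η-conjugates`
    -- supplies one.
    ·-opposite : ∀ {x y} → On (aff x y) → ∀ r → (Ideal (aff x y) · Ideal (aff x (𝔽.- y))) r → ∃[ s ] r ≈ ξ x * s
    ·-opposite {x} {y} on r (add {r₁} {r₂} m n e) with ·-opposite on r₁ m | ·-opposite on r₂ n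
    ... | s , h | s′ , h′ = s + s′ , ≈-trans e (≈-trans (+-cong h h′) (≈-sym (distribˡ _ _ _)))
    ·-opposite {x} {y} on r (mul {a} {b} (u , w , ea) (u′ , w′ , eb) e) = _ , (begin
      r                                                                  ≈⟨ ≈-trans e (*-cong ea eb) ⟩
      (u * ξ x + w * η y) * (u′ * ξ x + w′ * η (𝔽.- y))
        ≈⟨ solve 7 (λ u w u′ w′ x y y′ → (u :* x :+ w :* y) :* (u′ :* x :+ w′ :* y′)
             := w :* w′ :* (y :* y′) :+ x :* (u :* u′ :* x :+ u :* w′ :* y′ :+ w :* u′ :* y)) refl u w u′ w′ (ξ x) (η y) (η (𝔽.- y)) ⟩
      w * w′ * (η y * η (𝔽.- y)) + ξ x * (u * u′ * ξ x + u * w′ * η (𝔽.- y) + w * u′ * η y)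
        ≈⟨ +-congʳ (*-congˡ (η-conjugates on)) ⟩
      w * w′ * (ξ x * cofactor x) + ξ x * (u * u′ * ξ x + u * w′ * η (𝔽.- y) + w * u′ * η y)
        ≈⟨ solve 4 (λ x t c v → t :* (x :* c) :+ x :* v := x :* (t :* c :+ v)) refl (ξ x) (w * w′) (cofactor x) _ ⟩
      ξ x * (w * w′ * cofactor x + (u * u′ * ξ x + u * w′ * η (𝔽.- y) + w * u′ * η y)) ∎)

    -- As 2 ≠ 0, a singular point must have y = 0, and there smoothness means g′(x) ≠ 0.
    Nonsingular : Set
    Nonsingular = ∀ x → On (aff x 0F) → x 𝔽.* x 𝔽.+ x 𝔽.* x 𝔽.+ x 𝔽.* x 𝔽.+ g₂ 𝔽.* (x 𝔽.+ x) 𝔽.+ g₁ ≢ 0F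

    class-opposite : Nonsingular → ∀ {x y} → On (aff x y) → (Ideal (aff x y) · Ideal (aff x (𝔽.- y))) ~ Ideal O
    class-opposite ns {x} {y} on = record
      { α-lead = 1-lead
      ; β-lead = ξ-lead x
      ; to   = λ r m → let s , e = ·-opposite on r m in s , tt , ≈-trans (*-identityˡ r) e
      ; from = λ s _ → s * ξ x , ·-scale P Q s ξ∈PQ , ≈-trans (*-comm _ _) (≈-sym (*-identityˡ _)) }
      where
      P Q : Pt
      P = aff x y
      Q = aff x (𝔽.- y)
      ξ∈PQ : (Ideal P · Ideal Q) (ξ x)
      ξ∈PQ with y 𝔽.≟ 0F
      -- Here ξ(Y + y) - (Y - y)ξ = 2yξ.
      ... | no y≢0 = unscale P Q (y 𝔽.+ y) (ξ x) 2y≢0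
        (add (mul (ξ∈ {x} {y}) (η∈ {x} {𝔽.- y}) ≈-refl) (mul (ideal-* P (- 1#) (η∈ {x} {y})) (ξ∈ {x} {𝔽.- y}) ≈-refl) (begin
          κ (y 𝔽.+ y) * ξ x                        ≈⟨ *-congʳ (κ-+ _ _) ⟩
          (κ y + κ y) * ξ x                        ≈⟨ solve 3 (λ x y Y → (y :+ y) :* x := x :* (Y :- (:- y)) :+ (:- :1) :* (Y :- y) :* x) refl (ξ x) (κ y) Y ⟩
          ξ x * (Y - - κ y) + - 1# * η y * ξ x     ≈⟨ +-congʳ (*-congˡ (+-congˡ (-‿cong (κ-‿ y)))) ⟨
          ξ x * η (𝔽.- y) + - 1# * η y * ξ x       ∎))
        where
        2y≢0 : y 𝔽.+ y ≢ 0F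
        2y≢0 e = 𝔽.*-≢0 𝔽.2≢0 y≢0 (≡.trans (𝔽.solve 1 (λ y → (:1 :+ :1) :* y := y :+ y) refl y) e)
      -- Modulo ξ the cofactor is the constant n = g′(x), so η(0)η(-0) = ξ·cofactor differs from nξ
      -- by a multiple of ξ². This is where nonsingularity is used.
      ... | yes refl = unscale P Q n (ξ x) (ns x on)
        (add (mul (η∈ {x} {0F}) (η∈ {x} {𝔽.- 0F}) ≈-refl)
             (mul (ideal-* P (- (X + κ x + κ x + κ g₂)) (ξ∈ {x} {0F})) (ξ∈ {x} {𝔽.- 0F}) ≈-refl) (begin
          κ n * ξ x   ≈⟨ *-congʳ (κ-expr (var (# 0) :* var (# 0) :+ var (# 0) :* var (# 0) :+ var (# 0) :* var (# 0) :+ var (# 1) :* (var (# 0) :+ var (# 0)) :+ var (# 2)) (x ∷ g₂ ∷ g₁ ∷ [])) ⟩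
          (κ x * κ x + κ x * κ x + κ x * κ x + κ g₂ * (κ x + κ x) + κ g₁) * ξ x
            ≈⟨ solve 4 (λ X x g₂ g₁ → (x :* x :+ x :* x :+ x :* x :+ g₂ :* (x :+ x) :+ g₁) :* (X :- x)
                 := (X :- x) :* (X :* X :+ X :* x :+ x :* x :+ g₂ :* (X :+ x) :+ g₁) :+ (:- (X :+ x :+ x :+ g₂)) :* (X :- x) :* (X :- x))
                 refl X (κ x) (κ g₂) (κ g₁) ⟩
          ξ x * cofactor x + - (X + κ x + κ x + κ g₂) * ξ x * ξ x      ≈⟨ +-congʳ (η-conjugates on) ⟨
          η 0F * η (𝔽.- 0F) + - (X + κ x + κ x + κ g₂) * ξ x * ξ x     ∎))
        where
        n : F
        n = x 𝔽.* x 𝔽.+ x 𝔽.* x 𝔽.+ x 𝔽.* x 𝔽.+ g₂ 𝔽.* (x 𝔽.+ x) 𝔽.+ g₁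

    class-O : ∀ P → (Ideal O · Ideal P) ~ Ideal P
    class-O P = ⊆⊇⇒~ to (λ r i → mul tt i (≈-sym (*-identityˡ r)))
      where
      to : ∀ r → (Ideal O · Ideal P) r → Ideal P r
      to r (mul {a} _ i e) = ideal-resp P (≈-sym e) (ideal-* P a i)
      to r (add m n e) = ideal-resp P (≈-sym e) (ideal-+ P (to _ m) (to _ n))

    -- If c ≠ 0, then c·η(-y) lies in the product of the ideals of P and -P, hence equals ξ·s for
    -- some s. Comparing poles, 3 = 2 + 1, so s would have order 1.
    constant∉ : ∀ {x y c} → On (aff x y) → Ideal (aff x y) (κ c) → c ≡ 0F
    constant∉ {x} {y} {c} on i = decide (c 𝔽.≟ 0F)
      where
      factor : ∃[ s ] κ c * η (𝔽.- y) ≈ ξ x * s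
      factor = ·-opposite on (κ c * η (𝔽.- y)) (mul i (η∈ {x} {𝔽.- y}) ≈-refl)
      s : Carrier
      s = proj₁ factor
      order-of-s : ∀ d → 3 ≡ 2 ℕ.+ d → d ≡ 1
      order-of-s .1 refl = refl
      module _ (c≢0 : c ≢ 0F) where
        lhs-lead : Lead (κ c * η (𝔽.- y)) 3
        lhs-lead = lead-* (lead-const c≢0) (η-lead (𝔽.- y))
        absurd : (s ≈ 0# ⊎ ∃[ d ] Lead s d) → ⊥
        absurd (inj₁ z) = lead-0 (lead-resp (≈-trans (proj₂ factor) (≈-trans (*-congˡ z) (zeroʳ (ξ x)))) lhs-lead)
        absurd (inj₂ (d , l)) = order-1 (subst (Lead s) (order-of-s d (lead-unique (lead-resp (proj₂ factor) lhs-lead) (lead-* (ξ-lead x) l))) l)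
      decide : Dec (c ≡ 0F) → c ≡ 0F
      decide (yes e) = e
      decide (no c≢0) = ⊥-elim (absurd c≢0 (lead? s))

    ideal-order : ∀ {x y r} d → On (aff x y) → Ideal (aff x y) r → Lead r d → 2 ≤ d
    ideal-order {x} {y} {r} 0 on i l = ⊥-elim (constant (order-0 l))
      where
      constant : ¬ (∃[ c ] (c ≢ 0F × r ≈ κ c))
      constant (c , c≢0 , e) = c≢0 (constant∉ on (ideal-resp (aff x y) e i))
    ideal-order 1 on i l = ⊥-elim (order-1 l)
    ideal-order (suc (suc d)) on i l = s≤s (s≤s z≤n)

    nonzero-factor : ∀ {α β f d} → Lead α d → α ≈ β * f → ∃[ e ] Lead f e
    nonzero-factor {α} {β} {f} l e = decide (lead? f)
      where
      decide : (f ≈ 0# ⊎ ∃[ d ] Lead f d) → ∃[ d ] Lead f d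
      decide (inj₂ p) = p
      decide (inj₁ z) = ⊥-elim (lead-0 (lead-resp (≈-trans e (≈-trans (*-congˡ z) (zeroʳ β))) l))

    -- Subtracting cξ from f leaves its value at the point: a constant in the ideal, hence 0.
    ideal-linear : ∀ {x y f c e} → On (aff x y) → Ideal (aff x y) f → f ≈ κ c * X + κ e → c 𝔽.* x 𝔽.+ e ≡ 0F
    ideal-linear {x} {y} {f} {c} {e} on i h = constant∉ on (ideal-resp (aff x y) (begin
      f + - κ c * ξ x                  ≈⟨ +-congʳ h ⟩
      (κ c * X + κ e) + - κ c * ξ x    ≈⟨ solve 4 (λ X c e x → (c :* X :+ e) :+ (:- c) :* (X :- x) := c :* x :+ e) refl X (κ c) (κ e) (κ x) ⟩
      κ c * κ x + κ e                  ≈⟨ κ-expr (var (# 0) :* var (# 1) :+ var (# 2)) (c ∷ x ∷ e ∷ []) ⟨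
      κ (c 𝔽.* x 𝔽.+ e)                ∎) (ideal-+ (aff x y) i (ideal-* (aff x y) (- κ c) (ξ∈ {x} {y}))))

    ideal-cubic : ∀ {x y f c d e} → On (aff x y) → Ideal (aff x y) f → f ≈ κ c * Y + (κ d * X + κ e) → c 𝔽.* y 𝔽.+ (d 𝔽.* x 𝔽.+ e) ≡ 0F
    ideal-cubic {x} {y} {f} {c} {d} {e} on i h = constant∉ on (ideal-resp (aff x y) (begin
      f + (- κ c * η y + - κ d * ξ x)    ≈⟨ +-congʳ h ⟩
      (κ c * Y + (κ d * X + κ e)) + (- κ c * η y + - κ d * ξ x)
        ≈⟨ solve 7 (λ Y X c d e x y → (c :* Y :+ (d :* X :+ e)) :+ ((:- c) :* (Y :- y) :+ (:- d) :* (X :- x)) := c :* y :+ (d :* x :+ e)) refl Y X (κ c) (κ d) (κ e) (κ x) (κ y) ⟩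
      κ c * κ y + (κ d * κ x + κ e)      ≈⟨ κ-expr (var (# 0) :* var (# 1) :+ (var (# 2) :* var (# 3) :+ var (# 4))) (c ∷ y ∷ d ∷ x ∷ e ∷ []) ⟨
      κ (c 𝔽.* y 𝔽.+ (d 𝔽.* x 𝔽.+ e))    ∎)
      (ideal-+ (aff x y) i (ideal-+ (aff x y) (ideal-* (aff x y) (- κ c) (η∈ {x} {y})) (ideal-* (aff x y) (- κ d) (ξ∈ {x} {y})))))

    -- Were the ideal principal, its generators ξ and η of orders 2 and 3 would be multiples of one
    -- function. In terms of the orders: f, the image of 1, has order at least 2; ξ forces this
    -- order to be exactly 2, and then η leaves a quotient of order 1.
    O-class : ∀ {x y} → On (aff x y) → ¬ (Ideal O ~ Ideal (aff x y))
    O-class {x} {y} on h = absurd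
      where
      open _~_ h
      f = to 1# tt
      g = from (ξ x) ξ∈
      k = from (η y) η∈
      lf = nonzero-factor (lead-resp (*-comm _ _) (lead-* 1-lead α-lead)) (proj₂ (proj₂ f))
      lg = nonzero-factor (lead-* β-lead (ξ-lead x)) (proj₂ (proj₂ g))
      lk = nonzero-factor (lead-* β-lead (η-lead y)) (proj₂ (proj₂ k))
      d≡ : d ≡ e ℕ.+ proj₁ lf
      d≡ = lead-unique (lead-resp (*-comm _ _) (lead-* 1-lead α-lead)) (lead-resp (≈-sym (proj₂ (proj₂ f))) (lead-* β-lead (proj₂ lf)))
      e+2≡ : e ℕ.+ 2 ≡ d ℕ.+ proj₁ lg
      e+2≡ = lead-unique (lead-* β-lead (ξ-lead x)) (lead-resp (≈-sym (proj₂ (proj₂ g))) (lead-* α-lead (proj₂ lg)))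
      e+3≡ : e ℕ.+ 3 ≡ d ℕ.+ proj₁ lk
      e+3≡ = lead-unique (lead-* β-lead (η-lead y)) (lead-resp (≈-sym (proj₂ (proj₂ k))) (lead-* α-lead (proj₂ lk)))
      cancel : ∀ {m} n → e ℕ.+ m ≡ d ℕ.+ n → m ≡ proj₁ lf ℕ.+ n
      cancel n h = ℕₚ.+-cancelˡ-≡ e _ _ (≡.trans h (≡.trans (cong (ℕ._+ n) d≡) (ℕₚ.+-assoc e _ n)))
      2≤ : 2 ≤ proj₁ lf
      2≤ = ideal-order _ on (proj₁ (proj₂ f)) (proj₂ lf)
      order-lk : ∀ {a b c} → 2 ≤ a → 2 ≡ a ℕ.+ b → 3 ≡ a ℕ.+ c → c ≡ 1
      order-lk {suc (suc zero)} (s≤s (s≤s z≤n)) _ refl = refl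
      order-lk {suc (suc (suc a))} (s≤s (s≤s z≤n)) ()
      absurd : ⊥
      absurd = order-1 (subst (Lead _) (order-lk 2≤ (cancel _ e+2≡) (cancel _ e+3≡)) (proj₂ lk))

    -- Nonzero elements of either ideal have order at least 2, and ξ attains it, so α and β have the
    -- same order. Then ξ and η correspond to functions f of order 2 and k of order 3 in the other
    -- ideal, with fη = kξ. Over the monomials 1, X, X², Y, XY this forces f = cξ and k = cη, and
    -- both vanish at (x′, y′).
    aff-class : ∀ {x y x′ y′} → On (aff x y) → On (aff x′ y′) → Ideal (aff x y) ~ Ideal (aff x′ y′) → aff x y ≡ aff x′ y′
    aff-class {x} {y} {x′} {y′} on on′ h = conclude (order-2 (subst (Lead (proj₁ f)) lf-2 (proj₂ lf))) (order-3 (subst (Lead (proj₁ k)) lk-3 (proj₂ lk)))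
      where
      open _~_ h
      f = to (ξ x) ξ∈
      k = to (η y) η∈
      f′ = from (ξ x′) ξ∈
      lf  = nonzero-factor (lead-* α-lead (ξ-lead x)) (proj₂ (proj₂ f))
      lk  = nonzero-factor (lead-* α-lead (η-lead y)) (proj₂ (proj₂ k))
      lf′ = nonzero-factor (lead-* β-lead (ξ-lead x′)) (proj₂ (proj₂ f′))
      d+2≡ : d ℕ.+ 2 ≡ e ℕ.+ proj₁ lf
      d+2≡ = lead-unique (lead-* α-lead (ξ-lead x)) (lead-resp (≈-sym (proj₂ (proj₂ f))) (lead-* β-lead (proj₂ lf)))
      d+3≡ : d ℕ.+ 3 ≡ e ℕ.+ proj₁ lk
      d+3≡ = lead-unique (lead-* α-lead (η-lead y)) (lead-resp (≈-sym (proj₂ (proj₂ k))) (lead-* β-lead (proj₂ lk)))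
      e+2≡ : e ℕ.+ 2 ≡ d ℕ.+ proj₁ lf′
      e+2≡ = lead-unique (lead-* β-lead (ξ-lead x′)) (lead-resp (≈-sym (proj₂ (proj₂ f′))) (lead-* α-lead (proj₂ lf′)))
      e≤d : e ≤ d
      e≤d = ℕₚ.+-cancelʳ-≤ 2 e d (ℕₚ.≤-trans (ℕₚ.+-monoʳ-≤ e (ideal-order _ on′ (proj₁ (proj₂ f)) (proj₂ lf))) (ℕₚ.≤-reflexive (≡.sym d+2≡)))
      d≤e : d ≤ e
      d≤e = ℕₚ.+-cancelʳ-≤ 2 d e (ℕₚ.≤-trans (ℕₚ.+-monoʳ-≤ d (ideal-order _ on (proj₁ (proj₂ f′)) (proj₂ lf′))) (ℕₚ.≤-reflexive (≡.sym e+2≡)))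
      d≡e : d ≡ e
      d≡e = ℕₚ.≤-antisym d≤e e≤d
      lf-2 : proj₁ lf ≡ 2
      lf-2 = ≡.sym (ℕₚ.+-cancelˡ-≡ e _ _ (≡.trans (cong (ℕ._+ 2) (≡.sym d≡e)) d+2≡))
      lk-3 : proj₁ lk ≡ 3
      lk-3 = ≡.sym (ℕₚ.+-cancelˡ-≡ e _ _ (≡.trans (cong (ℕ._+ 3) (≡.sym d≡e)) d+3≡))
      cross : proj₁ f * η y ≈ proj₁ k * ξ x
      cross = cancel-lead β-lead (begin
        β * (proj₁ f * η y)     ≈⟨ *-assoc _ _ _ ⟨
        β * proj₁ f * η y       ≈⟨ *-congʳ (proj₂ (proj₂ f)) ⟨
        α * ξ x * η y           ≈⟨ solve 3 (λ a x y → a :* x :* y := a :* y :* x) refl α (ξ x) (η y) ⟩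
        α * η y * ξ x           ≈⟨ *-congʳ (proj₂ (proj₂ k)) ⟩
        β * proj₁ k * ξ x       ≈⟨ *-assoc _ _ _ ⟩
        β * (proj₁ k * ξ x)     ∎)
      -- with f = cX + e₀ and k = c₁Y + d₁X + e₁, compare the coefficients of f·(Y − y) = k·(X − x)
      module Coefficients {c e₀ c₁ d₁ e₁ : F} (c≢0 : c ≢ 0F) (hf : proj₁ f ≈ κ c * X + κ e₀) (hk : proj₁ k ≈ κ c₁ * Y + (κ d₁ * X + κ e₁)) where
        ρ : Vec F 7
        ρ = c ∷ e₀ ∷ c₁ ∷ d₁ ∷ e₁ ∷ x ∷ y ∷ []
        :c :e₀ :c₁ :d₁ :e₁ :x :y : Expr 7
        :c = var (# 0)
        :e₀ = var (# 1)
        :c₁ = var (# 2)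
        :d₁ = var (# 3)
        :e₁ = var (# 4)
        :x = var (# 5)
        :y = var (# 6)
        difference : κ (𝔽.- (e₀ 𝔽.* y) 𝔽.+ e₁ 𝔽.* x) + κ (𝔽.- (c 𝔽.* y) 𝔽.+ d₁ 𝔽.* x 𝔽.- e₁) * X + κ (𝔽.- d₁) * (X * X)
                     + (κ (e₀ 𝔽.+ c₁ 𝔽.* x) + κ (c 𝔽.- c₁) * X) * Y ≈ 0#
        difference = ≈-trans
          (+-cong (+-cong (+-cong (κ-expr (:- (:e₀ :* :y) :+ :e₁ :* :x) ρ) (*-congʳ (κ-expr (:- (:c :* :y) :+ :d₁ :* :x :- :e₁) ρ))) (*-congʳ (κ-‿ d₁)))
                  (*-congʳ (+-cong (κ-expr (:e₀ :+ :c₁ :* :x) ρ) (*-congʳ (κ-expr (:c :- :c₁) ρ)))))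
          (≈-trans
            (solve 9 (λ X Y c e₀ c₁ d₁ e₁ x y →
                 (:- (e₀ :* y) :+ e₁ :* x) :+ (:- (c :* y) :+ d₁ :* x :- e₁) :* X :+ (:- d₁) :* (X :* X) :+ ((e₀ :+ c₁ :* x) :+ (c :- c₁) :* X) :* Y
                 := (c :* X :+ e₀) :* (Y :- y) :- (c₁ :* Y :+ (d₁ :* X :+ e₁)) :* (X :- x))
                 refl X Y (κ c) (κ e₀) (κ c₁) (κ d₁) (κ e₁) (κ x) (κ y))
            (begin
              (κ c * X + κ e₀) * η y - (κ c₁ * Y + (κ d₁ * X + κ e₁)) * ξ x
                ≈⟨ +-cong (*-congʳ hf) (-‿cong (*-congʳ hk)) ⟨
              proj₁ f * η y - proj₁ k * ξ x   ≈⟨ +-congʳ cross ⟩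
              proj₁ k * ξ x - proj₁ k * ξ x   ≈⟨ -‿inverseʳ (proj₁ k * ξ x) ⟩
              0# ∎))
        same : (c₁c : (𝔽.- (e₀ 𝔽.* y) 𝔽.+ e₁ 𝔽.* x ≡ 0F × 𝔽.- (c 𝔽.* y) 𝔽.+ d₁ 𝔽.* x 𝔽.- e₁ ≡ 0F × 𝔽.- d₁ ≡ 0F) × (e₀ 𝔽.+ c₁ 𝔽.* x ≡ 0F × c 𝔽.- c₁ ≡ 0F)) →
               aff x y ≡ aff x′ y′
        same ((_ , h₁ , h₂) , (h₃ , h₄)) = cong₂ aff
          (compare-x c≢0 h₄ h₃ (ideal-linear on′ (proj₁ (proj₂ f)) hf))
          (compare-y c≢0 h₄ h₁ h₂ (ideal-cubic on′ (proj₁ (proj₂ k)) hk))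
      conclude : ∃[ c ] ∃[ e₀ ] (c ≢ 0F × proj₁ f ≈ κ c * X + κ e₀) →
                 ∃[ c₁ ] ∃[ d₁ ] ∃[ e₁ ] (c₁ ≢ 0F × proj₁ k ≈ κ c₁ * Y + (κ d₁ * X + κ e₁)) → aff x y ≡ aff x′ y′
      conclude (c , e₀ , c≢0 , hf) (c₁ , d₁ , e₁ , _ , hk) = same (independent difference)
        where open Coefficients {c} {e₀} {c₁} {d₁} {e₁} c≢0 hf hk

    class-injective : ∀ P Q → On P → On Q → Ideal P ~ Ideal Q → P ≡ Q
    class-injective O O _ _ _ = refl
    class-injective O (aff x y) _ on h = ⊥-elim (O-class on h)
    class-injective (aff x y) O on _ h = ⊥-elim (O-class on (~-sym h))
    class-injective (aff x y) (aff x′ y′) on on′ h = aff-class on on′ h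

-- Chords and tangents form an abelian group

module GroupLaw where
  open RingSolving
  open PowerSeries
  open CoordinateRings
  open IdealClassComparison
  open import Algebra.Bundles using (AbelianGroup)
  open import Data.Product using (_×_; _,_; proj₁; proj₂; ∃-syntax; Σ)
  open import Data.Empty using (⊥-elim)
  open import Data.Unit using (tt)
  open import Level using (0ℓ)
  open import Axiom.UniquenessOfIdentityProofs.WithK using () renaming (uip to ≡-irrelevant)
  open import Relation.Nullary using (yes; no; Dec)
  open import Relation.Binary.PropositionalEquality as ≡ using (_≡_; _≢_; refl; sym; trans; cong; cong₂; subst; module ≡-Reasoning)

  module EllipticCurve (𝔽 : DecField) (g₂ g₁ g₀ : DecField.F 𝔽) where
    open DecField 𝔽
    open IdealClasses (Construction.coordinateRing 𝔽 g₂ g₁ g₀) public using (Pt; O; aff; On; Nonsingular)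
    private module I = IdealClasses (Construction.coordinateRing 𝔽 g₂ g₁ g₀)
    open I using (Secant; secant)

    cubic-at : F → F
    cubic-at x = x * x * x + g₂ * (x * x) + g₁ * x + g₀

    slope-at : F → F
    slope-at x = x * x + x * x + x * x + g₂ * (x + x) + g₁

    third-x : F → F → F → F
    third-x Λ x₁ x₂ = Λ * Λ - g₂ - x₁ - x₂

    third-y : F → F → F → F → F
    third-y Λ x₁ y₁ x₃ = - (y₁ + Λ * (x₃ - x₁))

    -- A relation with the slope as a witness: a certificate can supply the slope, and checking it
    -- involves no division. `opposite` includes the doubling of points with y = 0.
    data Sum : Pt → Pt → Pt → Set where
      O-left   : ∀ {P} → Sum O P P
      O-right  : ∀ {P} → Sum P O P
      opposite : ∀ {x y} → Sum (aff x y) (aff x (- y)) O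
      chord    : ∀ {x₁ y₁ x₂ y₂} Λ → x₁ ≢ x₂ → Λ * (x₂ - x₁) ≡ y₂ - y₁ →
                 Sum (aff x₁ y₁) (aff x₂ y₂) (aff (third-x Λ x₁ x₂) (third-y Λ x₁ y₁ (third-x Λ x₁ x₂)))
      tangent  : ∀ {x y} Λ → y + y ≢ 0F → Λ * (y + y) ≡ slope-at x →
                 Sum (aff x y) (aff x y) (aff (third-x Λ x x) (third-y Λ x y (third-x Λ x x)))

    private
      ν : F → F → F → F
      ν Λ x y = y - Λ * x

      c₁ c₀ : F → F → F → F → F
      c₁ x₁ y₁ x₂ Λ = let x₃ = third-x Λ x₁ x₂ in
        g₁ - (Λ * ν Λ x₁ y₁ + Λ * ν Λ x₁ y₁) - (x₁ * x₂ + x₁ * x₃ + x₂ * x₃)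
      c₀ x₁ y₁ x₂ Λ = let x₃ = third-x Λ x₁ x₂ in g₀ - ν Λ x₁ y₁ * ν Λ x₁ y₁ + x₁ * x₂ * x₃

      secant-quadratic : ∀ x₁ x₂ Λ → g₂ - Λ * Λ + (x₁ + x₂ + third-x Λ x₁ x₂) ≡ 0F
      secant-quadratic x₁ x₂ Λ = solve 4 (λ x₁ x₂ Λ g₂ → g₂ :- Λ :* Λ :+ (x₁ :+ x₂ :+ (Λ :* Λ :- g₂ :- x₁ :- x₂)) := num 0) refl x₁ x₂ Λ g₂

      -- The cubic minus the square of the line minus the product of the X − xᵢ is c₁X + c₀.
      remainder-x₁ : ∀ x₁ y₁ x₂ Λ → c₁ x₁ y₁ x₂ Λ * x₁ + c₀ x₁ y₁ x₂ Λ ≡ cubic-at x₁ - y₁ * y₁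
      remainder-x₁ x₁ y₁ x₂ Λ = solve 7 (λ x₁ y₁ x₂ Λ g₂ g₁ g₀ →
        let x₃ = Λ :* Λ :- g₂ :- x₁ :- x₂ ; ν = y₁ :- Λ :* x₁ in
        (g₁ :- (Λ :* ν :+ Λ :* ν) :- (x₁ :* x₂ :+ x₁ :* x₃ :+ x₂ :* x₃)) :* x₁ :+ (g₀ :- ν :* ν :+ x₁ :* x₂ :* x₃)
        := (x₁ :* x₁ :* x₁ :+ g₂ :* (x₁ :* x₁) :+ g₁ :* x₁ :+ g₀) :- y₁ :* y₁) refl x₁ y₁ x₂ Λ g₂ g₁ g₀

      remainder : ∀ x₁ y₁ x₂ Λ x → c₁ x₁ y₁ x₂ Λ * x + c₀ x₁ y₁ x₂ Λ ≡
        cubic-at x - (y₁ + Λ * (x - x₁)) * (y₁ + Λ * (x - x₁)) - (x - x₁) * (x - x₂) * (x - third-x Λ x₁ x₂)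
      remainder x₁ y₁ x₂ Λ x = solve 8 (λ x₁ y₁ x₂ Λ x g₂ g₁ g₀ →
        let x₃ = Λ :* Λ :- g₂ :- x₁ :- x₂ ; ν = y₁ :- Λ :* x₁ ; L = y₁ :+ Λ :* (x :- x₁) in
        (g₁ :- (Λ :* ν :+ Λ :* ν) :- (x₁ :* x₂ :+ x₁ :* x₃ :+ x₂ :* x₃)) :* x :+ (g₀ :- ν :* ν :+ x₁ :* x₂ :* x₃)
        := (x :* x :* x :+ g₂ :* (x :* x) :+ g₁ :* x :+ g₀) :- L :* L :- (x :- x₁) :* (x :- x₂) :* (x :- x₃)) refl x₁ y₁ x₂ Λ x g₂ g₁ g₀

      remainder-slope : ∀ x y Λ → c₁ x y x Λ ≡ slope-at x - Λ * (y + y)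
      remainder-slope x y Λ = solve 5 (λ x y Λ g₂ g₁ →
        let x₃ = Λ :* Λ :- g₂ :- x :- x ; ν = y :- Λ :* x in
        g₁ :- (Λ :* ν :+ Λ :* ν) :- (x :* x :+ x :* x₃ :+ x :* x₃)
        := (x :* x :+ x :* x :+ x :* x :+ g₂ :* (x :+ x) :+ g₁) :- Λ :* (y :+ y)) refl x y Λ g₂ g₁

      c₀≡0 : ∀ {c c′ x} → c ≡ 0F → c * x + c′ ≡ 0F → c′ ≡ 0F
      c₀≡0 {c} {c′} {x} refl e = trans (solve 2 (λ x c′ → c′ := num 0 :* x :+ c′) refl x c′) e

      line-at : ∀ {x₁ y₁ x₂ y₂} Λ → Λ * (x₂ - x₁) ≡ y₂ - y₁ → y₂ ≡ y₁ + Λ * (x₂ - x₁)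
      line-at {x₁} {y₁} {x₂} {y₂} Λ e = trans (solve 2 (λ y₁ y₂ → y₂ := y₁ :+ (y₂ :- y₁)) refl y₁ y₂) (cong (y₁ +_) (sym e))

      -- The linear polynomial c₁X + c₀ vanishes at the two distinct abscissas, hence identically.
      chord-remainder : ∀ {x₁ y₁ x₂ y₂} Λ → On (aff x₁ y₁) → On (aff x₂ y₂) → x₁ ≢ x₂ → Λ * (x₂ - x₁) ≡ y₂ - y₁ →
                        c₁ x₁ y₁ x₂ Λ ≡ 0F × c₀ x₁ y₁ x₂ Λ ≡ 0F
      chord-remainder {x₁} {y₁} {x₂} {y₂} Λ on₁ on₂ x₁≢x₂ e = c₁≡0 , c₀≡0 c₁≡0 at₁
        where
        C D : F
        C = c₁ x₁ y₁ x₂ Λ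
        D = c₀ x₁ y₁ x₂ Λ
        at₁ : C * x₁ + D ≡ 0F
        at₁ = trans (remainder-x₁ x₁ y₁ x₂ Λ) (≡⇒-≡0 (sym on₁))
        at₂ : C * x₂ + D ≡ 0F
        at₂ = begin
          C * x₂ + D   ≡⟨ remainder x₁ y₁ x₂ Λ x₂ ⟩
          cubic-at x₂ - (y₁ + Λ * (x₂ - x₁)) * (y₁ + Λ * (x₂ - x₁)) - (x₂ - x₁) * (x₂ - x₂) * (x₂ - third-x Λ x₁ x₂)
            ≡⟨ cong₂ (λ u v → u - v * v - (x₂ - x₁) * (x₂ - x₂) * (x₂ - third-x Λ x₁ x₂)) (sym on₂) (sym (line-at Λ e)) ⟩
          y₂ * y₂ - y₂ * y₂ - (x₂ - x₁) * (x₂ - x₂) * (x₂ - third-x Λ x₁ x₂)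
            ≡⟨ solve 4 (λ y u x v → y :* y :- y :* y :- u :* (x :- x) :* v := num 0) refl y₂ (x₂ - x₁) x₂ (x₂ - third-x Λ x₁ x₂) ⟩
          0F ∎
          where open ≡-Reasoning
        c₁≡0 : C ≡ 0F
        c₁≡0 = cancelˡ (x₁ - x₂) (λ z → x₁≢x₂ (-≡0⇒≡ z)) (begin
          (x₁ - x₂) * C               ≡⟨ solve 4 (λ C D x₁ x₂ → (x₁ :- x₂) :* C := (C :* x₁ :+ D) :- (C :* x₂ :+ D)) refl C D x₁ x₂ ⟩
          C * x₁ + D - (C * x₂ + D)   ≡⟨ cong₂ _-_ at₁ at₂ ⟩
          0F - 0F                     ≡⟨ -‿inverseʳ 0F ⟩
          0F                          ∎)
          where open ≡-Reasoning

      -- Only one abscissa is available, but the tangent condition makes c₁ vanish by itself, and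
      -- then the root x gives c₀ = 0.
      tangent-remainder : ∀ {x y} Λ → On (aff x y) → Λ * (y + y) ≡ slope-at x → c₁ x y x Λ ≡ 0F × c₀ x y x Λ ≡ 0F
      tangent-remainder {x} {y} Λ on e = c₁≡0 , c₀≡0 c₁≡0 (trans (remainder-x₁ x y x Λ) (≡⇒-≡0 (sym on)))
        where
        c₁≡0 : c₁ x y x Λ ≡ 0F
        c₁≡0 = trans (remainder-slope x y Λ) (≡⇒-≡0 (sym e))

      third-on : ∀ {x₁ y₁ x₂} Λ → c₁ x₁ y₁ x₂ Λ ≡ 0F × c₀ x₁ y₁ x₂ Λ ≡ 0F →
                 On (aff (third-x Λ x₁ x₂) (third-y Λ x₁ y₁ (third-x Λ x₁ x₂)))
      third-on {x₁} {y₁} {x₂} Λ (e , e′) = sym (-≡0⇒≡ (begin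
        -- A product with the factor 0 is inserted, and 0 is then written x₃ - x₃, to reach the
        -- shape of `remainder` at x₃.
        cubic-at x₃ - - L * - L     ≡⟨ solve 3 (λ g L w → g :- (:- L) :* (:- L) := (g :- L :* L :- w :* (num 0)) ) refl (cubic-at x₃) L ((x₃ - x₁) * (x₃ - x₂)) ⟩
        cubic-at x₃ - L * L - (x₃ - x₁) * (x₃ - x₂) * 0F
          ≡⟨ cong (λ u → cubic-at x₃ - L * L - (x₃ - x₁) * (x₃ - x₂) * u) (-‿inverseʳ x₃) ⟨
        cubic-at x₃ - L * L - (x₃ - x₁) * (x₃ - x₂) * (x₃ - x₃)   ≡⟨ remainder x₁ y₁ x₂ Λ x₃ ⟨
        c₁ x₁ y₁ x₂ Λ * x₃ + c₀ x₁ y₁ x₂ Λ                        ≡⟨ cong₂ (λ u v → u * x₃ + v) e e′ ⟩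
        0F * x₃ + 0F                ≡⟨ solve 1 (λ x → num 0 :* x :+ num 0 := num 0) refl x₃ ⟩
        0F                          ∎))
        where
        open ≡-Reasoning
        x₃ L : F
        x₃ = third-x Λ x₁ x₂
        L = y₁ + Λ * (x₃ - x₁)

    on-neg : ∀ {x y} → On (aff x y) → On (aff x (- y))
    on-neg {x} {y} on = trans (solve 1 (λ y → (:- y) :* (:- y) := y :* y) refl y) on

    sum-on : ∀ {P Q S} → Sum P Q S → On P → On Q → On S
    sum-on O-left _ on = on
    sum-on O-right on _ = on
    sum-on opposite _ _ = tt
    sum-on (chord {x₁} {y₁} {x₂} Λ x₁≢x₂ e) on₁ on₂ = third-on {x₁} {y₁} {x₂} Λ (chord-remainder Λ on₁ on₂ x₁≢x₂ e)
    sum-on (tangent {x} {y} Λ _ e) on _ = third-on {x} {y} {x} Λ (tangent-remainder Λ on e)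

    module Group (nonsingular : Nonsingular) where
      open I using (Ideal; _·_; _~_; ~-sym; ~-trans)

      sum-class : ∀ {P Q S} → Sum P Q S → On P → On Q → (Ideal P · Ideal Q) ~ Ideal S
      sum-class {Q = Q} O-left _ _ = I.class-O Q
      sum-class {P = P} O-right _ _ = ~-trans (I.·-comm _ _) (I.class-O P)
      sum-class opposite on _ = I.class-opposite nonsingular on
      sum-class (chord {x₁} {y₁} {x₂} Λ x₁≢x₂ e) on₁ on₂ =
        I.class-chord (secant (secant-quadratic x₁ x₂ Λ) (proj₁ r) (proj₂ r)) (line-at Λ e) refl x₁≢x₂
        where r = chord-remainder Λ on₁ on₂ x₁≢x₂ e
      sum-class (tangent {x} {y} Λ 2y≢0 e) on _ =
        I.class-tangent (secant (secant-quadratic x x Λ) (proj₁ r) (proj₂ r))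
          (solve 3 (λ x y Λ → y := y :+ Λ :* (x :- x)) refl x y Λ) refl 2y≢0
        where r = tangent-remainder Λ on e

      -- Neither constructors nor slopes are compared: both sums represent the class of the product
      -- of the ideals of P and Q.
      sum-unique : ∀ {P Q S S′} → On P → On Q → Sum P Q S → Sum P Q S′ → S ≡ S′
      sum-unique {S = S} {S′} onP onQ s s′ = I.class-injective S S′ (sum-on s onP onQ) (sum-on s′ onP onQ)
        (~-trans (~-sym (sum-class s onP onQ)) (sum-class s′ onP onQ))

      sum-comm : ∀ {P Q S S′} → On P → On Q → Sum P Q S → Sum Q P S′ → S ≡ S′
      sum-comm {S = S} {S′} onP onQ s s′ = I.class-injective S S′ (sum-on s onP onQ) (sum-on s′ onQ onP)
        (~-trans (~-sym (sum-class s onP onQ)) (~-trans (I.·-comm _ _) (sum-class s′ onQ onP)))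

      sum-assoc : ∀ {P Q R A B S S′} → On P → On Q → On R → Sum P Q A → Sum A R S → Sum Q R B → Sum P B S′ → S ≡ S′
      sum-assoc {P} {Q} {R} {A} {B} {S} {S′} onP onQ onR pq ar qr pb = I.class-injective S S′ (sum-on ar onA onR) (sum-on pb onP onB)
        (~-trans (~-sym (sum-class ar onA onR)) (~-trans (I.·-congʳ (Ideal R) (~-sym (sum-class pq onP onQ)))
          (~-trans (I.·-assoc (Ideal P) (Ideal Q) (Ideal R)) (~-trans (I.·-congˡ (Ideal P) (sum-class qr onQ onR)) (sum-class pb onP onB)))))
        where
        onA = sum-on pq onP onQ
        onB = sum-on qr onQ onR

      sum-exists : ∀ P Q → On P → On Q → ∃[ S ] Sum P Q S
      sum-exists O Q _ _ = Q , O-left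
      sum-exists (aff x y) O _ _ = aff x y , O-right
      sum-exists (aff x₁ y₁) (aff x₂ y₂) on₁ on₂ = decide (x₁ ≟ x₂)
        where
        open ≡-Reasoning
        quotient : ∀ u v d → v * d ≡ 1F → u * d * v ≡ u
        quotient u v d e = begin
          u * d * v     ≡⟨ solve 3 (λ u d v → u :* d :* v := v :* d :* u) refl u d v ⟩
          v * d * u     ≡⟨ cong (_* u) e ⟩
          1F * u        ≡⟨ *-identityˡ u ⟩
          u             ∎
        distinct : x₁ ≢ x₂ → ∃[ S ] Sum (aff x₁ y₁) (aff x₂ y₂) S
        distinct x₁≢x₂ = let d , e = inverse (x₂ - x₁) (λ h → x₁≢x₂ (sym (-≡0⇒≡ h))) in
          _ , chord ((y₂ - y₁) * d) x₁≢x₂ (quotient (y₂ - y₁) (x₂ - x₁) d e)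
        double : ∀ x y → y + y ≢ 0F → ∃[ S ] Sum (aff x y) (aff x y) S
        double x y 2y≢0 = let d , e = inverse (y + y) 2y≢0 in
          _ , tangent (slope-at x * d) 2y≢0 (quotient (slope-at x) (y + y) d e)
        vertical : x₁ ≡ x₂ → Dec (y₂ ≡ - y₁) → ∃[ S ] Sum (aff x₁ y₁) (aff x₂ y₂) S
        vertical refl (yes refl) = O , opposite
        vertical refl (no y₂≢-y₁) = subst (λ y → ∃[ S ] Sum (aff x₁ y₁) (aff x₁ y) S) y₁≡y₂ (double x₁ y₁ 2y≢0)
          where
          -- Equal abscissas give y₁² = y₂², and the sign -1 has been excluded.
          y₁≡y₂ : y₁ ≡ y₂
          y₁≡y₂ = -≡0⇒≡ (cancelˡ (y₂ - - y₁) (λ e → y₂≢-y₁ (-≡0⇒≡ e)) (begin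
            (y₂ - - y₁) * (y₁ - y₂)   ≡⟨ solve 2 (λ a b → (b :- (:- a)) :* (a :- b) := a :* a :- b :* b) refl y₁ y₂ ⟩
            y₁ * y₁ - y₂ * y₂         ≡⟨ ≡⇒-≡0 (trans on₁ (sym on₂)) ⟩
            0F                        ∎))
          2y≢0 : y₁ + y₁ ≢ 0F
          2y≢0 e = y₂≢-y₁ (trans (sym y₁≡y₂) (-≡0⇒≡ (trans (solve 1 (λ y → y :- (:- y) := y :+ y) refl y₁) e)))
        decide : Dec (x₁ ≡ x₂) → ∃[ S ] Sum (aff x₁ y₁) (aff x₂ y₂) S
        decide (yes e) = vertical e (y₂ ≟ (- y₁))
        decide (no x₁≢x₂) = distinct x₁≢x₂

      EPt : Set
      EPt = Σ Pt On

      EPt-≡ : {P Q : EPt} → proj₁ P ≡ proj₁ Q → P ≡ Q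
      EPt-≡ {O , tt} {O , tt} refl = refl
      EPt-≡ {aff x y , e} {aff .x .y , e′} refl = cong (aff x y ,_) (≡-irrelevant e e′)

      infixl 6 _⊕_
      abstract
        -- Kept opaque: later arguments use only `⊕-sum`, so that sums of concrete points are never
        -- evaluated by inverting field elements.
        _⊕_ : EPt → EPt → EPt
        (P , onP) ⊕ (Q , onQ) = proj₁ (sum-exists P Q onP onQ) , sum-on (proj₂ (sum-exists P Q onP onQ)) onP onQ

        ⊕-sum : ∀ P Q → Sum (proj₁ P) (proj₁ Q) (proj₁ (P ⊕ Q))
        ⊕-sum (P , onP) (Q , onQ) = proj₂ (sum-exists P Q onP onQ)

      ⊕-unique : ∀ {P Q S : EPt} → Sum (proj₁ P) (proj₁ Q) (proj₁ S) → P ⊕ Q ≡ S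
      ⊕-unique {P} {Q} s = EPt-≡ (sum-unique (proj₂ P) (proj₂ Q) (⊕-sum P Q) s)

      ⊖_ : EPt → EPt
      ⊖ (O , tt) = O , tt
      ⊖ (aff x y , on) = aff x (- y) , on-neg on

      0E : EPt
      0E = O , tt

      ⊕-comm : ∀ P Q → P ⊕ Q ≡ Q ⊕ P
      ⊕-comm P Q = EPt-≡ (sum-comm (proj₂ P) (proj₂ Q) (⊕-sum P Q) (⊕-sum Q P))

      ⊕-assoc : ∀ P Q R → (P ⊕ Q) ⊕ R ≡ P ⊕ (Q ⊕ R)
      ⊕-assoc P Q R = EPt-≡ (sum-assoc (proj₂ P) (proj₂ Q) (proj₂ R) (⊕-sum P Q) (⊕-sum (P ⊕ Q) R) (⊕-sum Q R) (⊕-sum P (Q ⊕ R)))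

      ⊕-identityˡ : ∀ P → 0E ⊕ P ≡ P
      ⊕-identityˡ P = ⊕-unique {0E} {P} {P} O-left

      ⊕-inverseʳ : ∀ P → P ⊕ (⊖ P) ≡ 0E
      ⊕-inverseʳ (O , tt) = ⊕-identityˡ 0E
      ⊕-inverseʳ (aff x y , on) = ⊕-unique {aff x y , on} {aff x (- y) , on-neg on} {0E} opposite

      group : AbelianGroup 0ℓ 0ℓ
      group = record
        { Carrier = EPt ; _≈_ = _≡_ ; _∙_ = _⊕_ ; ε = 0E ; _⁻¹ = ⊖_
        ; isAbelianGroup = record
          { isGroup = record
            { isMonoid = record
              { isSemigroup = record
                { isMagma = record { isEquivalence = ≡.isEquivalence ; ∙-cong = cong₂ _⊕_ }
                ; assoc = ⊕-assoc }
              ; identity = ⊕-identityˡ , λ P → trans (⊕-comm P 0E) (⊕-identityˡ P) }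
            ; inverse = (λ P → trans (⊕-comm (⊖ P) P) (⊕-inverseʳ P)) , ⊕-inverseʳ
            ; ⁻¹-cong = cong ⊖_ }
          ; comm = ⊕-comm } }

      -- x(2R) = x(Q), cleared of denominators
      halving : ∀ {x y X Y} → On (aff x y) → Sum (aff x y) (aff x y) (aff X Y) →
                x * x * x * x - (g₁ + g₁) * (x * x) - (g₀ + g₀ + g₀ + g₀ + g₀ + g₀ + g₀ + g₀) * x + (g₁ * g₁ - (g₂ + g₂ + g₂ + g₂) * g₀)
                ≡ (X + X + X + X) * cubic-at x
      halving on (chord Λ x≢x _) = ⊥-elim (x≢x refl)
      halving {x} {y} on (tangent Λ _ e) = begin
        x * x * x * x - (g₁ + g₁) * (x * x) - (g₀ + g₀ + g₀ + g₀ + g₀ + g₀ + g₀ + g₀) * x + (g₁ * g₁ - (g₂ + g₂ + g₂ + g₂) * g₀)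
          -- With D = g′(x) the quartic is D² - 4g(x)(g₂ + 2x), the numerator of the duplication
          -- formula.
          ≡⟨ solve 4 (λ x g₂ g₁ g₀ → let G = x :* x :* x :+ g₂ :* (x :* x) :+ g₁ :* x :+ g₀ ; D = x :* x :+ x :* x :+ x :* x :+ g₂ :* (x :+ x) :+ g₁ in
               x :* x :* x :* x :- (g₁ :+ g₁) :* (x :* x) :- (g₀ :+ g₀ :+ g₀ :+ g₀ :+ g₀ :+ g₀ :+ g₀ :+ g₀) :* x :+ (g₁ :* g₁ :- (g₂ :+ g₂ :+ g₂ :+ g₂) :* g₀)
               := D :* D :- (g₂ :+ x :+ x) :* (G :+ G :+ G :+ G)) refl x g₂ g₁ g₀ ⟩
        slope-at x * slope-at x - (g₂ + x + x) * (G + G + G + G)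
          ≡⟨ cong (λ u → u * u - (g₂ + x + x) * (G + G + G + G)) e ⟨
        Λ * (y + y) * (Λ * (y + y)) - (g₂ + x + x) * (G + G + G + G)
          ≡⟨ solve 5 (λ Λ y G g₂ x → Λ :* (y :+ y) :* (Λ :* (y :+ y)) :- (g₂ :+ x :+ x) :* (G :+ G :+ G :+ G)
               := Λ :* Λ :* (y :* y :+ y :* y :+ y :* y :+ y :* y) :- (g₂ :+ x :+ x) :* (G :+ G :+ G :+ G)) refl Λ y G g₂ x ⟩
        Λ * Λ * (y * y + y * y + y * y + y * y) - (g₂ + x + x) * (G + G + G + G)
          ≡⟨ cong (λ u → Λ * Λ * (u + u + u + u) - (g₂ + x + x) * (G + G + G + G)) on ⟩
        Λ * Λ * (G + G + G + G) - (g₂ + x + x) * (G + G + G + G)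
          ≡⟨ solve 4 (λ Λ G g₂ x → let X = Λ :* Λ :- g₂ :- x :- x in
               Λ :* Λ :* (G :+ G :+ G :+ G) :- (g₂ :+ x :+ x) :* (G :+ G :+ G :+ G) := (X :+ X :+ X :+ X) :* G) refl Λ G g₂ x ⟩
        (X + X + X + X) * G ∎
        where
        open ≡-Reasoning
        G X : F
        G = cubic-at x
        X = third-x Λ x x

      two-torsion : ∀ {x y} → On (aff x y) → Sum (aff x y) (aff x y) O → y ≡ 0F × cubic-at x ≡ 0F
      two-torsion {x} {y} on s = y≡0 , trans (sym on) (trans (cong (λ u → u * u) y≡0) (zeroˡ 0F))
        where
        from-sum : Sum (aff x y) (aff x y) O → y ≡ - y
        from-sum s = go s refl
          where
          go : ∀ {z} → Sum (aff x y) (aff x z) O → z ≡ y → y ≡ - y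
          go opposite e = sym e
        y≡0 : y ≡ 0F
        y≡0 = cancelˡ (1F + 1F) 2≢0 (trans (solve 1 (λ y → (:1 :+ :1) :* y := y :- (:- y)) refl y) (≡⇒-≡0 (from-sum s)))

-- Halving integer relations in an abelian group

module TwoDescent where
  open import Algebra.Bundles using (AbelianGroup)
  open import Data.Bool using (Bool; true; false; _∨_)
  open import Data.Integer as ℤ using (ℤ; +_; -[1+_])
  import Data.Integer.Properties as ℤₚ
  open import Data.Nat as ℕ using (ℕ; zero; suc; _<_; z≤n; s≤s)
  import Data.Nat.Properties as ℕₚ
  open import Data.Nat.Induction using (<-wellFounded)
  open import Induction.WellFounded using (Acc; acc)
  open import Data.Product using (_×_; _,_; proj₁; proj₂; ∃-syntax)
  open import Data.Vec as Vec using (Vec; []; _∷_; zipWith; replicate)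
  open import Data.Empty using (⊥-elim)
  open import Relation.Nullary using (¬_)
  open import Relation.Binary.PropositionalEquality using (_≡_; refl; sym; trans; cong; cong₂; subst)

  module IntegerMultiples {c ℓ} (G : AbelianGroup c ℓ) where
    open AbelianGroup G renaming (Carrier to A; refl to ≈-refl; sym to ≈-sym; trans to ≈-trans)
    open import Algebra.Properties.Monoid.Mult monoid using (×-homo-+) renaming (_×_ to _·ℕ_) public
    open import Algebra.Properties.AbelianGroup G using (⁻¹-∙-comm; ε⁻¹≈ε; ⁻¹-involutive)
    open import Algebra.Properties.CommutativeSemigroup commutativeSemigroup using (interchange)
    open import Relation.Binary.Reasoning.Setoid setoid

    infixr 8 _·_
    _·_ : ℤ → A → A
    (+ n)    · x = n ·ℕ x
    -[1+ n ] · x = (suc n ·ℕ x) ⁻¹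

    ⊖-homo : ∀ m n x → (m ℤ.⊖ n) · x ≈ m ·ℕ x ∙ (n ·ℕ x) ⁻¹
    ⊖-homo zero    zero    x = ≈-sym (inverseʳ ε)
    ⊖-homo zero    (suc n) x = ≈-sym (identityˡ _)
    ⊖-homo (suc m) zero    x = ≈-sym (≈-trans (∙-congˡ ε⁻¹≈ε) (identityʳ _))
    ⊖-homo (suc m) (suc n) x = begin
      (suc m ℤ.⊖ suc n) · x                       ≡⟨ cong (_· x) (ℤₚ.[1+m]⊖[1+n]≡m⊖n m n) ⟩
      (m ℤ.⊖ n) · x                               ≈⟨ ⊖-homo m n x ⟩
      m ·ℕ x ∙ (n ·ℕ x) ⁻¹                        ≈⟨ identityˡ _ ⟨
      ε ∙ (m ·ℕ x ∙ (n ·ℕ x) ⁻¹)                  ≈⟨ ∙-congʳ (inverseʳ x) ⟨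
      (x ∙ x ⁻¹) ∙ (m ·ℕ x ∙ (n ·ℕ x) ⁻¹)         ≈⟨ interchange _ _ _ _ ⟩
      (x ∙ m ·ℕ x) ∙ (x ⁻¹ ∙ (n ·ℕ x) ⁻¹)         ≈⟨ ∙-congˡ (⁻¹-∙-comm _ _) ⟩
      suc m ·ℕ x ∙ (suc n ·ℕ x) ⁻¹                ∎

    ·-homo-+ : ∀ i j x → (i ℤ.+ j) · x ≈ i · x ∙ j · x
    ·-homo-+ (+ m)    (+ n)    x = ×-homo-+ x m n
    ·-homo-+ (+ m)    -[1+ n ] x = ⊖-homo m (suc n) x
    ·-homo-+ -[1+ m ] (+ n)    x = ≈-trans (⊖-homo n (suc m) x) (comm _ _)
    ·-homo-+ -[1+ m ] -[1+ n ] x = begin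
      (suc (suc (m ℕ.+ n)) ·ℕ x) ⁻¹         ≡⟨ cong (λ k → (suc k ·ℕ x) ⁻¹) (ℕₚ.+-suc m n) ⟨
      ((suc m ℕ.+ suc n) ·ℕ x) ⁻¹           ≈⟨ ⁻¹-cong (×-homo-+ x (suc m) (suc n)) ⟩
      (suc m ·ℕ x ∙ suc n ·ℕ x) ⁻¹          ≈⟨ ⁻¹-∙-comm _ _ ⟨
      (suc m ·ℕ x) ⁻¹ ∙ (suc n ·ℕ x) ⁻¹     ∎

    ·-homo-neg : ∀ i x → (ℤ.- i) · x ≈ (i · x) ⁻¹
    ·-homo-neg (+ zero)  x = ≈-sym ε⁻¹≈ε
    ·-homo-neg (+ suc n) x = ≈-refl
    ·-homo-neg -[1+ n ]  x = ≈-sym (⁻¹-involutive _)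

  bit : Bool → ℤ
  bit true  = + 1
  bit false = + 0

  half-ℕ : ∀ n → ∃[ h ] ∃[ b ] (+ n ≡ (+ h ℤ.+ + h) ℤ.+ bit b)
  half-ℕ zero = 0 , false , refl
  half-ℕ (suc n) with half-ℕ n
  ... | h , false , e = h , true , trans (cong (ℤ._+_ (+ 1)) e) (trans (cong (ℤ._+_ (+ 1)) (ℤₚ.+-identityʳ (+ h ℤ.+ + h))) (ℤₚ.+-comm (+ 1) (+ h ℤ.+ + h)))
  ... | h , true , e = suc h , false , trans (cong (ℤ._+_ (+ 1)) e)
        (cong +_ (trans (cong suc (ℕₚ.+-comm (h ℕ.+ h) 1)) (trans (cong suc (sym (ℕₚ.+-suc h h))) (sym (ℕₚ.+-identityʳ _)))))

  half : ∀ z → ∃[ q ] ∃[ b ] (z ≡ (q ℤ.+ q) ℤ.+ bit b)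
  half (+ n) with half-ℕ n
  ... | h , b , e = + h , b , e
  half -[1+ n ] with half-ℕ (suc n)
  ... | h , false , e = ℤ.- + h , false , trans (cong ℤ.-_ (trans e (ℤₚ.+-identityʳ _))) (trans (ℤₚ.neg-distrib-+ (+ h) (+ h)) (sym (ℤₚ.+-identityʳ _)))
  -- Remainders stay in {0, 1} for negative numbers too: -(2h + 1) = 2(-1 - h) + 1.
  ... | h , true , e = -[1+ h ] , true , trans (cong ℤ.-_ (trans e (cong +_ (ℕₚ.+-comm (h ℕ.+ h) 1)))) refl

  -- The measure of the descent: doubling a vector doubles it, so halving a nonzero vector lowers it
  -- strictly. It is applied to the coefficients of the Pᵢ only, as those of the torsion generators
  -- may grow.
  norm₁ : ∀ {k} → Vec ℤ k → ℕ
  norm₁ []      = 0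
  norm₁ (z ∷ v) = ℤ.∣ z ∣ ℕ.+ norm₁ v

  norm₁-zero : ∀ {k} (v : Vec ℤ k) → norm₁ v ≡ 0 → v ≡ replicate k (+ 0)
  norm₁-zero [] _ = refl
  norm₁-zero (z ∷ v) e = cong₂ _∷_ (ℤₚ.∣i∣≡0⇒i≡0 (ℕₚ.m+n≡0⇒m≡0 _ e)) (norm₁-zero v (ℕₚ.m+n≡0⇒n≡0 ℤ.∣ z ∣ e))

  norm₁-double : ∀ {k} (v : Vec ℤ k) → norm₁ (zipWith ℤ._+_ v v) ≡ norm₁ v ℕ.+ norm₁ v
  norm₁-double [] = refl
  norm₁-double (z ∷ v) = trans (cong₂ ℕ._+_ (double z) (norm₁-double v)) (interchange ℤ.∣ z ∣ ℤ.∣ z ∣ (norm₁ v) (norm₁ v))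
    where
    open import Algebra.Properties.CommutativeSemigroup ℕₚ.+-commutativeSemigroup using (interchange)
    double : ∀ z → ℤ.∣ z ℤ.+ z ∣ ≡ ℤ.∣ z ∣ ℕ.+ ℤ.∣ z ∣
    double (+ n) = refl
    double -[1+ n ] = cong suc (sym (ℕₚ.+-suc n n))

  some : ∀ {k} → Vec Bool k → Bool
  some []      = false
  some (b ∷ v) = b ∨ some v

  module Independence {c ℓ} (G : AbelianGroup c ℓ) where
    open AbelianGroup G renaming (Carrier to A; refl to ≈-refl; sym to ≈-sym; trans to ≈-trans)
    open IntegerMultiples G
    open import Algebra.Properties.AbelianGroup G using (⁻¹-∙-comm; ε⁻¹≈ε; inverseʳ-unique; ⁻¹-involutive)
    open import Algebra.Properties.CommutativeSemigroup commutativeSemigroup using (interchange)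
    open import Relation.Binary.Reasoning.Setoid setoid

    combination : ∀ {k} → Vec ℤ k → Vec A k → A
    combination []      []      = ε
    combination (z ∷ v) (x ∷ P) = z · x ∙ combination v P

    select : ∀ {k} → Vec Bool k → Vec A k → A
    select []          []      = ε
    select (true ∷ v)  (x ∷ P) = x ∙ select v P
    select (false ∷ v) (x ∷ P) = select v P

    combination-+ : ∀ {k} (u v : Vec ℤ k) P → combination (zipWith ℤ._+_ u v) P ≈ combination u P ∙ combination v P
    combination-+ [] [] [] = ≈-sym (identityˡ ε)
    combination-+ (y ∷ u) (z ∷ v) (x ∷ P) = ≈-trans (∙-cong (·-homo-+ y z x) (combination-+ u v P)) (interchange _ _ _ _)

    combination-neg : ∀ {k} (u : Vec ℤ k) P → combination (Vec.map ℤ.-_ u) P ≈ (combination u P) ⁻¹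
    combination-neg [] [] = ≈-sym ε⁻¹≈ε
    combination-neg (y ∷ u) (x ∷ P) = ≈-trans (∙-cong (·-homo-neg y x) (combination-neg u P)) (⁻¹-∙-comm _ _)

    combination-0 : ∀ {k} (P : Vec A k) → combination (replicate k (+ 0)) P ≈ ε
    combination-0 []      = ≈-refl
    combination-0 (x ∷ P) = ≈-trans (identityˡ _) (combination-0 P)

    combination-bit : ∀ {k} (v : Vec Bool k) P → combination (Vec.map bit v) P ≈ select v P
    combination-bit [] [] = ≈-refl
    combination-bit (true ∷ v)  (x ∷ P) = ∙-cong (identityʳ x) (combination-bit v P)
    combination-bit (false ∷ v) (x ∷ P) = ≈-trans (identityˡ _) (combination-bit v P)

    halves : ∀ {k} (v : Vec ℤ k) → ∃[ q ] ∃[ b ] v ≡ zipWith ℤ._+_ (zipWith ℤ._+_ q q) (Vec.map bit b)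
    halves [] = [] , [] , refl
    halves (z ∷ v) with half z | halves v
    ... | q , b , e | qs , bs , es = q ∷ qs , b ∷ bs , cong₂ _∷_ e es

    expand : ∀ {k} (q : Vec ℤ k) b P →
      combination (zipWith ℤ._+_ (zipWith ℤ._+_ q q) (Vec.map bit b)) P ≈ (combination q P ∙ combination q P) ∙ select b P
    expand q b P = ≈-trans (combination-+ (zipWith ℤ._+_ q q) (Vec.map bit b) P) (∙-cong (combination-+ q q P) (combination-bit b P))

    none : ∀ {k} (b : Vec Bool k) → some b ≡ false → (P : Vec A k) → select b P ≡ ε
    none [] _ [] = refl
    none (false ∷ b) e (x ∷ P) = none b e P

    none-double : ∀ {k} (q : Vec ℤ k) b → some b ≡ false → zipWith ℤ._+_ (zipWith ℤ._+_ q q) (Vec.map bit b) ≡ zipWith ℤ._+_ q q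
    none-double [] [] _ = refl
    none-double (z ∷ q) (false ∷ b) e = cong₂ _∷_ (ℤₚ.+-identityʳ _) (none-double q b e)

    ∨-false : ∀ {x y} → x ∨ y ≡ false → x ≡ false × y ≡ false
    ∨-false {false} e = refl , e

    -- A relation with an odd coefficient would make a nonempty subsum divisible by 2; a relation with even
    -- coefficients can be halved, up to 2-torsion, which involves only the τ.
    module _ {r m} (P : Vec A r) (τ : Vec A m)
      (indivisible : ∀ δ ε′ → some δ ∨ some ε′ ≡ true → ∀ R → ¬ (R ∙ R ≈ select δ P ∙ select ε′ τ))
      (two-torsion : ∀ R → R ∙ R ≈ ε → ∃[ w ] R ≈ combination w τ) where

      independent : ∀ v u → combination v P ∙ combination u τ ≈ ε → v ≡ replicate r (+ 0)
      independent v u = go v u (<-wellFounded (norm₁ v))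
        where
        go : ∀ v u → Acc _<_ (norm₁ v) → combination v P ∙ combination u τ ≈ ε → v ≡ replicate r (+ 0)
        go v u (acc rec) h with halves v | halves u
        ... | q , b , refl | q′ , b′ , refl with some b ∨ some b′ in eq
        -- The relation reads 2R + subsum = 0, so the subsum is twice -R.
        ...   | true = ⊥-elim (indivisible b b′ eq (R ⁻¹) (begin
                  R ⁻¹ ∙ R ⁻¹                                 ≈⟨ ⁻¹-∙-comm R R ⟩
                  (R ∙ R) ⁻¹                                  ≈⟨ inverseʳ-unique _ _ (≈-trans (≈-sym split) h) ⟨
                  select b P ∙ select b′ τ                    ∎))
          where
          R : A
          R = combination q P ∙ combination q′ τ
          split : combination (zipWith ℤ._+_ (zipWith ℤ._+_ q q) (Vec.map bit b)) P ∙ combination (zipWith ℤ._+_ (zipWith ℤ._+_ q′ q′) (Vec.map bit b′)) τ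
                  ≈ (R ∙ R) ∙ (select b P ∙ select b′ τ)
          split = ≈-trans (∙-cong (expand q b P) (expand q′ b′ τ)) (≈-trans (interchange _ _ _ _) (∙-congʳ (interchange _ _ _ _)))
        ...   | false = conclude
          where
          none-b : some b ≡ false
          none-b = proj₁ (∨-false eq)
          none-b′ : some b′ ≡ false
          none-b′ = proj₂ (∨-false {some b} eq)
          R : A
          R = combination q P ∙ combination q′ τ
          R∙R≈ε : R ∙ R ≈ ε
          R∙R≈ε = begin
            R ∙ R   ≈⟨ interchange _ _ _ _ ⟩
            (combination q P ∙ combination q P) ∙ (combination q′ τ ∙ combination q′ τ)
              ≈⟨ ∙-cong (combination-+ q q P) (combination-+ q′ q′ τ) ⟨
            combination (zipWith ℤ._+_ q q) P ∙ combination (zipWith ℤ._+_ q′ q′) τ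
              ≡⟨ cong₂ (λ u v → combination u P ∙ combination v τ) (none-double q b none-b) (none-double q′ b′ none-b′) ⟨
            _ ≈⟨ h ⟩
            ε ∎
          -- Now 2R = 0 only shows R to be 2-torsion. Expressing R by the τ and subtracting it
          -- restores a true relation, with unchanged coefficients q of the P.
          w : Vec ℤ m
          w = proj₁ (two-torsion R R∙R≈ε)
          u′ : Vec ℤ m
          u′ = zipWith ℤ._+_ q′ (Vec.map ℤ.-_ w)
          relation : combination q P ∙ combination u′ τ ≈ ε
          relation = begin
            combination q P ∙ combination u′ τ   ≈⟨ ∙-congˡ (≈-trans (combination-+ q′ (Vec.map ℤ.-_ w) τ) (∙-congˡ (combination-neg w τ))) ⟩
            combination q P ∙ (combination q′ τ ∙ (combination w τ) ⁻¹)   ≈⟨ assoc _ _ _ ⟨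
            R ∙ (combination w τ) ⁻¹             ≈⟨ ∙-congʳ (proj₂ (two-torsion R R∙R≈ε)) ⟩
            combination w τ ∙ (combination w τ) ⁻¹   ≈⟨ inverseʳ _ ⟩
            ε ∎
          conclude : zipWith ℤ._+_ (zipWith ℤ._+_ q q) (Vec.map bit b) ≡ replicate r (+ 0)
          conclude with norm₁ q in nq
          ... | zero = norm₁-zero _ (trans (cong norm₁ (none-double q b none-b)) (trans (norm₁-double q) (cong₂ ℕ._+_ nq nq)))
          -- For q ≠ 0 the measure drops, and the recursive call returns q = 0, a contradiction.
          ... | suc k = ⊥-elim (ℕₚ.1+n≢0 (trans (sym nq) (trans (cong norm₁ q≡0) (zero-norm r))))
            where
            q≡0 : q ≡ replicate r (+ 0)
            q≡0 = go q u′ (rec smaller) relation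
              where
              smaller : norm₁ q < norm₁ (zipWith ℤ._+_ (zipWith ℤ._+_ q q) (Vec.map bit b))
              smaller = subst (norm₁ q <_) (sym (trans (cong norm₁ (none-double q b none-b)) (norm₁-double q)))
                (ℕₚ.m<m+n (norm₁ q) (subst (0 <_) (sym nq) (s≤s z≤n)))
            zero-norm : ∀ r → norm₁ (replicate r (+ 0)) ≡ 0
            zero-norm zero = refl
            zero-norm (suc r) = zero-norm r

-- Reduction modulo p, and excluding roots in K

module ResidueRings where
  open RingSolving
  open CubicFields
  open import Defs
  open import Algebra.Bundles using (CommutativeRing)
  open import Data.Bool as Bool using (Bool; true; false; _∧_; _∨_; not)
  open import Data.Fin using (#_) renaming (zero to fzero; suc to fsuc)
  open import Data.Integer as ℤ using (ℤ; +_; -[1+_])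
  import Data.Integer.Properties as ℤₚ
  import Data.Integer.DivMod as ℤ÷
  open import Data.List using (List; []; _∷_)
  open import Data.List.Relation.Binary.Pointwise using (Pointwise; []; _∷_)
  open import Data.Nat as ℕ using (ℕ; zero; suc; _≤_; _<_; z≤n; s≤s)
  import Data.Nat.Properties as ℕₚ
  import Data.Nat.DivMod as ℕ÷
  open import Data.Nat.Induction using (<-wellFounded)
  open import Induction.WellFounded using (Acc; acc)
  open import Data.Rational as ℚ using (ℚ; 0ℚ; mkℚ; _/_; ↥_; ↧_)
  import Data.Rational.Properties as ℚₚ
  import Data.Rational.Unnormalised as ℚᵘ
  import Data.Rational.Unnormalised.Properties as ℚᵘₚ
  open import Data.Product using (_×_; _,_; proj₁; proj₂; ∃-syntax)
  open import Data.Sum using (inj₁; inj₂)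
  open import Data.Empty using (⊥; ⊥-elim)
  open import Data.Vec as Vec using (Vec; []; _∷_)
  open import Relation.Binary.PropositionalEquality using (_≡_; _≢_; refl; sym; trans; cong; cong₂; subst; module ≡-Reasoning)

  open RingSolver ℚₚ.+-*-commutativeRing using () renaming (solve to solveℚ; ⟦_⟧E to ⟦_⟧ℚ)
  open RingSolver ℤₚ.+-*-commutativeRing using () renaming (solve to solveℤ; ⟦_⟧E to ⟦_⟧ℤ)

  module HomExpr {c ℓ c′ ℓ′} (R : CommutativeRing c ℓ) (S : CommutativeRing c′ ℓ′) where
    private
      module R = CommutativeRing R
      module S = CommutativeRing S
      module RS = RingSolver R
      module SS = RingSolver S
    module _ (φ : R.Carrier → S.Carrier)
             (φ-+ : ∀ x y → φ (x R.+ y) S.≈ φ x S.+ φ y) (φ-* : ∀ x y → φ (x R.* y) S.≈ φ x S.* φ y)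
             (φ-‿ : ∀ x → φ (R.- x) S.≈ S.- φ x) (φ-0 : φ R.0# S.≈ S.0#) (φ-1 : φ R.1# S.≈ S.1#) where
      hom-ℕ : ∀ n → φ RS.⟦ + n ⟧ℤ S.≈ SS.⟦ + n ⟧ℤ
      hom-ℕ zero    = φ-0
      hom-ℕ (suc n) = S.trans (φ-+ _ _) (S.+-cong φ-1 (hom-ℕ n))

      hom-expr : ∀ {n} (e : Expr n) ρ → φ (RS.⟦ e ⟧E ρ) S.≈ SS.⟦ e ⟧E (Vec.map φ ρ)
      hom-expr (con (+ n))      ρ = hom-ℕ n
      hom-expr (con -[1+ n ])   ρ = S.trans (φ-‿ _) (S.-‿cong (hom-ℕ (suc n)))
      hom-expr :1               ρ = φ-1
      hom-expr (var fzero)    (x ∷ ρ) = S.refl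
      hom-expr (var (fsuc i)) (x ∷ ρ) = hom-expr (var i) ρ
      hom-expr (e :+ e′) ρ = S.trans (φ-+ _ _) (S.+-cong (hom-expr e ρ) (hom-expr e′ ρ))
      hom-expr (e :* e′) ρ = S.trans (φ-* _ _) (S.*-cong (hom-expr e ρ) (hom-expr e′ ρ))
      hom-expr (:- e)    ρ = S.trans (φ-‿ _) (S.-‿cong (hom-expr e ρ))

  fromℤ : ℤ → ℚ
  fromℤ z = z / 1

  private
    -- `z / 1` passes through a gcd and does not reduce for a variable z; this form exposes its
    -- numerator.
    mk : ℤ → ℚ
    mk z = mkℚ z 0 (Coprimality.sym (Coprimality.1-coprimeTo ℤ.∣ z ∣))
      where import Data.Nat.Coprimality as Coprimality

    fromℤ≡mk : ∀ z → fromℤ z ≡ mk z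
    fromℤ≡mk z = ℚₚ.↥p/↧p≡p (mk z)

  fromℤ-injective : ∀ {z w} → fromℤ z ≡ fromℤ w → z ≡ w
  fromℤ-injective {z} {w} e = cong ↥_ (trans (sym (fromℤ≡mk z)) (trans e (fromℤ≡mk w)))

  fromℤ-+ : ∀ z w → fromℤ (z ℤ.+ w) ≡ fromℤ z ℚ.+ fromℤ w
  fromℤ-+ z w = sym (trans (cong₂ ℚ._+_ (fromℤ≡mk z) (fromℤ≡mk w))
    (cong fromℤ (cong₂ ℤ._+_ (ℤₚ.*-identityʳ z) (ℤₚ.*-identityʳ w))))

  fromℤ-* : ∀ z w → fromℤ (z ℤ.* w) ≡ fromℤ z ℚ.* fromℤ w
  fromℤ-* z w = sym (cong₂ ℚ._*_ (fromℤ≡mk z) (fromℤ≡mk w))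

  fromℤ-neg : ∀ z → fromℤ (ℤ.- z) ≡ ℚ.- fromℤ z
  fromℤ-neg z = begin
    fromℤ (ℤ.- z)                                   ≡⟨ solveℚ 2 (λ m z → m := (m :+ z) :- z) refl (fromℤ (ℤ.- z)) (fromℤ z) ⟩
    fromℤ (ℤ.- z) ℚ.+ fromℤ z ℚ.- fromℤ z           ≡⟨ cong (ℚ._- fromℤ z) (fromℤ-+ (ℤ.- z) z) ⟨
    fromℤ (ℤ.- z ℤ.+ z) ℚ.- fromℤ z                 ≡⟨ cong (λ u → fromℤ u ℚ.- fromℤ z) (ℤₚ.+-inverseˡ z) ⟩
    0ℚ ℚ.- fromℤ z                                  ≡⟨ ℚₚ.+-identityˡ _ ⟩
    ℚ.- fromℤ z                                     ∎
    where open ≡-Reasoning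

  fromℤ-expr : ∀ {n} (e : Expr n) ρ → fromℤ (⟦ e ⟧ℤ ρ) ≡ ⟦ e ⟧ℚ (Vec.map fromℤ ρ)
  fromℤ-expr = HomExpr.hom-expr ℤₚ.+-*-commutativeRing ℚₚ.+-*-commutativeRing fromℤ fromℤ-+ fromℤ-* fromℤ-neg refl refl

  denominator-* : ∀ q → q ℚ.* fromℤ (↧ q) ≡ fromℤ (↥ q)
  denominator-* q@(mkℚ n d-1 _) = ℚₚ.toℚᵘ-injective (ℚᵘₚ.≃-trans
    (ℚᵘₚ.≃-reflexive (cong (λ r → ℚ.toℚᵘ (q ℚ.* r)) (fromℤ≡mk (+ suc d-1))))
    (ℚᵘₚ.≃-trans (ℚₚ.toℚᵘ-homo-* q (mk (+ suc d-1)))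
    (ℚᵘₚ.≃-trans (ℚᵘ.*≡* cross) (ℚᵘₚ.≃-reflexive (cong ℚ.toℚᵘ (sym (fromℤ≡mk n)))))))
    where
    cross : (n ℤ.* + suc d-1) ℤ.* + 1 ≡ n ℤ.* + (suc d-1 ℕ.* 1)
    cross = trans (ℤₚ.*-identityʳ _) (cong (λ k → n ℤ.* + k) (sym (ℕₚ.*-identityʳ (suc d-1))))

  integral : (A B C : ℤ) → MonicCubic
  integral A B C = cubic (fromℤ A) (fromℤ B) (fromℤ C)

  -- Coordinates are plain natural numbers so that exhaustive searches over p³ elements run on fast
  -- arithmetic. Being below p is a separate predicate, `Reduced`.
  record Triple : Set where
    constructor ⟪_,_,_⟫
    field t0 t1 t2 : ℕ
  open Triple

  allBelow : ℕ → (ℕ → Bool) → Bool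
  allBelow zero    P = true
  allBelow (suc n) P = P n ∧ allBelow n P

  ∧-left : ∀ {x y} → x ∧ y ≡ true → x ≡ true
  ∧-left {true} _ = refl

  ∧-right : ∀ {x y} → x ∧ y ≡ true → y ≡ true
  ∧-right {true} e = e

  allBelow-sound : ∀ n P → allBelow n P ≡ true → ∀ {k} → k < n → P k ≡ true
  allBelow-sound (suc n) P e {k} (s≤s k≤n) with ℕₚ.m≤n⇒m<n∨m≡n k≤n
  ... | inj₂ refl = ∧-left e
  ... | inj₁ k<n  = allBelow-sound n P (∧-right {P n} e) k<n

  isZero³ : Triple → Bool
  isZero³ ⟪ 0 , 0 , 0 ⟫ = true
  isZero³ _ = false

  someBelow : ℕ → (ℕ → Bool) → Bool
  someBelow zero    P = false
  someBelow (suc n) P = P n ∨ someBelow n P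

  someBelow-sound : ∀ n P → someBelow n P ≡ true → ∃[ k ] P k ≡ true
  someBelow-sound (suc n) P e with P n in eq
  ... | true  = n , eq
  ... | false = someBelow-sound n P e

  -- The ring (ℤ/p)[x]/(x³ + Ax² + Bx + C), with p = 2 + p-2.
  module Residues (A B C : ℤ) (p-2 : ℕ) where
    p-1 p : ℕ
    p-1 = suc p-2
    p   = suc p-1

    residue : ℤ → ℕ
    residue z = z ℤ÷.%ℕ p

    -C AC -B AB-C -A AA-B : ℕ
    -C   = residue (ℤ.- C)
    AC   = residue (A ℤ.* C)
    -B   = residue (ℤ.- B)
    AB-C = residue (A ℤ.* B ℤ.- C)
    -A   = residue (ℤ.- A)
    AA-B = residue (A ℤ.* A ℤ.- B)

    infixl 6 _⊞₃_
    infixl 7 _⊠₃_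

    _⊞₃_ : Triple → Triple → Triple
    ⟪ x , y , z ⟫ ⊞₃ ⟪ x′ , y′ , z′ ⟫ = ⟪ (x ℕ.+ x′) ℕ÷.% p , (y ℕ.+ y′) ℕ÷.% p , (z ℕ.+ z′) ℕ÷.% p ⟫

    neg₃ : Triple → Triple
    neg₃ ⟪ x , y , z ⟫ = ⟪ (p-1 ℕ.* x) ℕ÷.% p , (p-1 ℕ.* y) ℕ÷.% p , (p-1 ℕ.* z) ℕ÷.% p ⟫

    reduce : (c0 c1 c2 c3 c4 : ℕ) → Triple
    reduce c0 c1 c2 c3 c4 = ⟪ (c0 ℕ.+ -C ℕ.* c3 ℕ.+ AC ℕ.* c4) ℕ÷.% p
                            , (c1 ℕ.+ -B ℕ.* c3 ℕ.+ AB-C ℕ.* c4) ℕ÷.% p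
                            , (c2 ℕ.+ -A ℕ.* c3 ℕ.+ AA-B ℕ.* c4) ℕ÷.% p ⟫

    _⊠₃_ : Triple → Triple → Triple
    ⟪ x , y , z ⟫ ⊠₃ ⟪ x′ , y′ , z′ ⟫ =
      reduce (x ℕ.* x′) (x ℕ.* y′ ℕ.+ y ℕ.* x′) (x ℕ.* z′ ℕ.+ y ℕ.* y′ ℕ.+ z ℕ.* x′) (y ℕ.* z′ ℕ.+ z ℕ.* y′) (z ℕ.* z′)

    -- The list holds the lower coefficients from the top down; the start value `one₃` supplies the
    -- leading 1 of a monic polynomial.
    horner₃ : Triple → List Triple → Triple → Triple
    horner₃ n []       m = m
    horner₃ n (c ∷ cs) m = horner₃ n cs (m ⊠₃ n ⊞₃ c)

    -- Only the length of the list counts. The recursion follows `homogeneous`, of which this is the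
    -- reduction when p divides the denominator.
    power₃ : Triple → List Triple → Triple → Triple
    power₃ n []       m = m
    power₃ n (_ ∷ cs) m = power₃ n cs (m ⊠₃ n)

    one₃ : Triple
    one₃ = ⟪ 1 , 0 , 0 ⟫

    -- no root of the monic polynomial with lower coefficients cs, and no nonzero element with vanishing (length cs)-th power
    passes : List Triple → ℕ → ℕ → ℕ → Bool
    passes cs x y z = not (isZero³ (horner₃ ⟪ x , y , z ⟫ cs one₃))
      ∧ (not (isZero³ (power₃ ⟪ x , y , z ⟫ cs one₃)) ∨ isZero³ ⟪ x , y , z ⟫)

    rootless : List Triple → Bool
    rootless cs = allBelow p λ x → allBelow p λ y → allBelow p (passes cs x y)

    inverseOf : ℕ → ℕ → Bool
    inverseOf r s = ((suc r ℕ.* s) ℕ÷.% p) ℕ.≡ᵇ 1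

    -- The form in which primality of p is used: the residues 1, ..., p - 1 all have inverses. It is
    -- checked by search.
    invertibles : Bool
    invertibles = allBelow p-1 λ r → someBelow p (inverseOf r)

    f : MonicCubic
    f = integral A B C

    open Field f
    open KRing f

    Cong : ℤ → ℕ → Set
    Cong a n = ∃[ k ] a ≡ + n ℤ.+ k ℤ.* + p

    cong-residue : ∀ a → Cong a (residue a)
    cong-residue a = a ℤ÷./ℕ p , ℤ÷.a≡a%ℕn+[a/ℕn]*n a p

    cong-% : ∀ {a n} → Cong a n → Cong a (n ℕ÷.% p)
    cong-% {a} {n} (k , e) = + (n ℕ÷./ p) ℤ.+ k , (begin
      a                                                             ≡⟨ e ⟩
      + n ℤ.+ k ℤ.* + p                                             ≡⟨ cong (λ m → m ℤ.+ k ℤ.* + p) split ⟩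
      + (n ℕ÷.% p) ℤ.+ + (n ℕ÷./ p) ℤ.* + p ℤ.+ k ℤ.* + p
        ≡⟨ solveℤ 4 (λ r q k p → r :+ q :* p :+ k :* p := r :+ (q :+ k) :* p) refl (+ (n ℕ÷.% p)) (+ (n ℕ÷./ p)) k (+ p) ⟩
      + (n ℕ÷.% p) ℤ.+ (+ (n ℕ÷./ p) ℤ.+ k) ℤ.* + p                 ∎)
      where
      open ≡-Reasoning
      split : + n ≡ + (n ℕ÷.% p) ℤ.+ + (n ℕ÷./ p) ℤ.* + p
      split = trans (cong +_ (ℕ÷.m≡m%n+[m/n]*n n p)) (cong (λ m → + (n ℕ÷.% p) ℤ.+ m) (ℤₚ.pos-* (n ℕ÷./ p) p))

    cong-+ : ∀ {a b n m} → Cong a n → Cong b m → Cong (a ℤ.+ b) (n ℕ.+ m)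
    cong-+ {n = n} {m} (k , refl) (l , refl) = k ℤ.+ l ,
      solveℤ 5 (λ n m k l p → (n :+ k :* p) :+ (m :+ l :* p) := (n :+ m) :+ (k :+ l) :* p) refl (+ n) (+ m) k l (+ p)

    cong-* : ∀ {a b n m} → Cong a n → Cong b m → Cong (a ℤ.* b) (n ℕ.* m)
    cong-* {n = n} {m} (k , refl) (l , refl) = + n ℤ.* l ℤ.+ k ℤ.* + m ℤ.+ k ℤ.* l ℤ.* + p ,
      trans (solveℤ 5 (λ n m k l p → (n :+ k :* p) :* (m :+ l :* p) := n :* m :+ (n :* l :+ k :* m :+ k :* l :* p) :* p) refl (+ n) (+ m) k l (+ p))
            (cong (λ u → u ℤ.+ (+ n ℤ.* l ℤ.+ k ℤ.* + m ℤ.+ k ℤ.* l ℤ.* + p) ℤ.* + p) (sym (ℤₚ.pos-* n m)))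

    cong-neg : ∀ {a n} → Cong a n → Cong (ℤ.- a) (p-1 ℕ.* n)
    cong-neg {n = n} (k , refl) = ℤ.- (+ n) ℤ.- k , trans
      (solveℤ 3 (λ n k q → :- (n :+ k :* (:1 :+ q)) := q :* n :+ (:- n :- k) :* (:1 :+ q)) refl (+ n) k (+ p-1))
      (cong (λ u → u ℤ.+ (ℤ.- (+ n) ℤ.- k) ℤ.* + p) (sym (ℤₚ.pos-* p-1 n)))

    cong-≡ : ∀ {a b n} → a ≡ b → Cong a n → Cong b n
    cong-≡ refl c = c

    cong-0 : ∀ {a n} → a ≡ + 0 → Cong a n → n < p → n ≡ 0
    cong-0 {n = n} refl (k , e) n<p = small k e
      where
      small : ∀ k → + 0 ≡ + n ℤ.+ k ℤ.* + p → n ≡ 0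
      small (+ zero) e = sym (trans (ℤₚ.+-injective (trans e (ℤₚ.+-identityʳ (+ n)))) refl)
      small (+ suc k) e with () ← trans (ℤₚ.+-injective (trans e (cong (λ u → + n ℤ.+ u) (sym (ℤₚ.pos-* (suc k) p))))) (ℕₚ.+-suc n (p-1 ℕ.+ k ℕ.* p))
      small -[1+ k ] e = ⊥-elim (ℕₚ.<⇒≱ n<p (subst (p ≤_) (sym n≡) (ℕₚ.m≤m+n p (k ℕ.* p))))
        where
        n≡ : n ≡ p ℕ.+ k ℕ.* p
        n≡ = ℤₚ.+-injective (begin
          + n                                          ≡⟨ solveℤ 3 (λ n k p → n := (n :+ (:- (:1 :+ k)) :* p) :+ (:1 :+ k) :* p) refl (+ n) (+ k) (+ p) ⟩
          (+ n ℤ.+ -[1+ k ] ℤ.* + p) ℤ.+ + suc k ℤ.* + p  ≡⟨ cong (λ u → u ℤ.+ + suc k ℤ.* + p) (sym e) ⟩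
          + 0 ℤ.+ + suc k ℤ.* + p                      ≡⟨ ℤₚ.+-identityˡ _ ⟩
          + suc k ℤ.* + p                              ≡⟨ sym (ℤₚ.pos-* (suc k) p) ⟩
          + (p ℕ.+ k ℕ.* p)                            ∎)
          where open ≡-Reasoning

    -- z is integral at p, with residue n.
    record Red (z : K f) (n : Triple) : Set where
      field
        {d x₀ x₁ x₂} : ℤ
        -- A denominator prime to p can be scaled to be 1 modulo p, so residues of numerators are
        -- residues of z and no inverses appear in sums and products.
        d-cong : Cong d 1
        eq₀ : k0 z ℚ.* fromℤ d ≡ fromℤ x₀
        eq₁ : k1 z ℚ.* fromℤ d ≡ fromℤ x₁
        eq₂ : k2 z ℚ.* fromℤ d ≡ fromℤ x₂
        cong₀ : Cong x₀ (t0 n)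
        cong₁ : Cong x₁ (t1 n)
        cong₂′ : Cong x₂ (t2 n)
    open Red

    ι : ℤ → ℤ → ℤ → K f
    ι x y z = ⟨ fromℤ x , fromℤ y , fromℤ z ⟩

    red-ι : ∀ x y z → Red (ι x y z) ⟪ residue x , residue y , residue z ⟫
    red-ι x y z = record
      { d = + 1 ; d-cong = + 0 , refl
      ; eq₀ = ℚₚ.*-identityʳ (fromℤ x) ; eq₁ = ℚₚ.*-identityʳ (fromℤ y) ; eq₂ = ℚₚ.*-identityʳ (fromℤ z)
      ; cong₀ = cong-residue x ; cong₁ = cong-residue y ; cong₂′ = cong-residue z }

    red-+ : ∀ {z w n m} → Red z n → Red w m → Red (z +K w) (n ⊞₃ m)
    red-+ {z} {w} {n} {m} r s = record
      { d-cong = cong-* (d-cong r) (d-cong s)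
      ; eq₀ = component (k0 z) (k0 w) {x₀ r} {x₀ s} (eq₀ r) (eq₀ s)
      ; eq₁ = component (k1 z) (k1 w) {x₁ r} {x₁ s} (eq₁ r) (eq₁ s)
      ; eq₂ = component (k2 z) (k2 w) {x₂ r} {x₂ s} (eq₂ r) (eq₂ s)
      ; cong₀ = cong′ (cong₀ r) (cong₀ s) ; cong₁ = cong′ (cong₁ r) (cong₁ s) ; cong₂′ = cong′ (cong₂′ r) (cong₂′ s) }
      where
      component : ∀ u v {x y} → u ℚ.* fromℤ (d r) ≡ fromℤ x → v ℚ.* fromℤ (d s) ≡ fromℤ y →
                  (u ℚ.+ v) ℚ.* fromℤ (d r ℤ.* d s) ≡ fromℤ (x ℤ.* d s ℤ.+ d r ℤ.* y)
      component u v {x} {y} e e′ = begin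
        (u ℚ.+ v) ℚ.* fromℤ (d r ℤ.* d s)                      ≡⟨ cong ((u ℚ.+ v) ℚ.*_) (fromℤ-* (d r) (d s)) ⟩
        (u ℚ.+ v) ℚ.* (fromℤ (d r) ℚ.* fromℤ (d s))            ≡⟨ solveℚ 4 (λ u v d e → (u :+ v) :* (d :* e) := u :* d :* e :+ d :* (v :* e)) refl u v (fromℤ (d r)) (fromℤ (d s)) ⟩
        u ℚ.* fromℤ (d r) ℚ.* fromℤ (d s) ℚ.+ fromℤ (d r) ℚ.* (v ℚ.* fromℤ (d s))
          ≡⟨ cong₂ (λ a b → a ℚ.* fromℤ (d s) ℚ.+ fromℤ (d r) ℚ.* b) e e′ ⟩
        fromℤ x ℚ.* fromℤ (d s) ℚ.+ fromℤ (d r) ℚ.* fromℤ y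
          ≡⟨ fromℤ-expr (var (# 0) :* var (# 1) :+ var (# 2) :* var (# 3)) (x ∷ d s ∷ d r ∷ y ∷ []) ⟨
        fromℤ (x ℤ.* d s ℤ.+ d r ℤ.* y) ∎
        where open ≡-Reasoning
      cong′ : ∀ {x y n m} → Cong x n → Cong y m → Cong (x ℤ.* d s ℤ.+ d r ℤ.* y) ((n ℕ.+ m) ℕ÷.% p)
      cong′ {n = n} {m} c c′ = cong-% (subst (Cong _) (cong₂ ℕ._+_ (ℕₚ.*-identityʳ n) (ℕₚ.*-identityˡ m))
        (cong-+ (cong-* c (d-cong s)) (cong-* (d-cong r) c′)))

    red-neg : ∀ {z n} → Red z n → Red (-K z) (neg₃ n)
    red-neg {z} r = record
      { d-cong = d-cong r
      ; eq₀ = component (k0 z) {x₀ r} (eq₀ r) ; eq₁ = component (k1 z) {x₁ r} (eq₁ r) ; eq₂ = component (k2 z) {x₂ r} (eq₂ r)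
      ; cong₀ = cong-% (cong-neg (cong₀ r)) ; cong₁ = cong-% (cong-neg (cong₁ r)) ; cong₂′ = cong-% (cong-neg (cong₂′ r)) }
      where
      component : ∀ u {x} → u ℚ.* fromℤ (d r) ≡ fromℤ x → ℚ.- u ℚ.* fromℤ (d r) ≡ fromℤ (ℤ.- x)
      component u {x} e = trans (solveℚ 2 (λ u d → (:- u) :* d := :- (u :* d)) refl u (fromℤ (d r))) (trans (cong ℚ.-_ e) (sym (fromℤ-neg x)))

    private
      mul9 : Expr³ 9
      mul9 = mulE (var (# 0)) (var (# 1)) (var (# 2)) (E (var (# 3)) (var (# 4)) (var (# 5))) (E (var (# 6)) (var (# 7)) (var (# 8)))

    red-* : ∀ {z w n m} → Red z n → Red w m → Red (z *K w) (n ⊠₃ m)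
    red-* {z} {w} {n} {m} r s = record
      { d-cong = cong-* (d-cong r) (d-cong s)
      ; eq₀ = trans (trans (scaled (k0 (z *K w))) (solveℚ 11 (λ A B C x y z x′ y′ z′ d e → Expr³.e0 (mulE A B C (E x y z) (E x′ y′ z′)) :* (d :* e)
                  := Expr³.e0 (mulE A B C (E (x :* d) (y :* d) (z :* d)) (E (x′ :* e) (y′ :* e) (z′ :* e))))
                  refl (a f) (b f) (c f) (k0 z) (k1 z) (k2 z) (k0 w) (k1 w) (k2 w) (fromℤ (d r)) (fromℤ (d s)))) (integers (Expr³.e0 mul9))
      ; eq₁ = trans (trans (scaled (k1 (z *K w))) (solveℚ 11 (λ A B C x y z x′ y′ z′ d e → Expr³.e1 (mulE A B C (E x y z) (E x′ y′ z′)) :* (d :* e)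
                  := Expr³.e1 (mulE A B C (E (x :* d) (y :* d) (z :* d)) (E (x′ :* e) (y′ :* e) (z′ :* e))))
                  refl (a f) (b f) (c f) (k0 z) (k1 z) (k2 z) (k0 w) (k1 w) (k2 w) (fromℤ (d r)) (fromℤ (d s)))) (integers (Expr³.e1 mul9))
      ; eq₂ = trans (trans (scaled (k2 (z *K w))) (solveℚ 11 (λ A B C x y z x′ y′ z′ d e → Expr³.e2 (mulE A B C (E x y z) (E x′ y′ z′)) :* (d :* e)
                  := Expr³.e2 (mulE A B C (E (x :* d) (y :* d) (z :* d)) (E (x′ :* e) (y′ :* e) (z′ :* e))))
                  refl (a f) (b f) (c f) (k0 z) (k1 z) (k2 z) (k0 w) (k1 w) (k2 w) (fromℤ (d r)) (fromℤ (d s)))) (integers (Expr³.e2 mul9))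
      ; cong₀ = cong-% (cong-+ (cong-+ (cong-* (cong₀ r) (cong₀ s)) (negated C c3)) (cong-* (cong-residue (A ℤ.* C)) c4))
      ; cong₁ = cong-% (cong-+ (cong-+ (cong-+ (cong-* (cong₀ r) (cong₁ s)) (cong-* (cong₁ r) (cong₀ s))) (negated B c3)) (cong-* (cong-residue (A ℤ.* B ℤ.- C)) c4))
      ; cong₂′ = cong-% (cong-+ (cong-+ (cong-+ (cong-+ (cong-* (cong₀ r) (cong₂′ s)) (cong-* (cong₁ r) (cong₁ s))) (cong-* (cong₂′ r) (cong₀ s))) (negated A c3))
                   (cong-* (cong-residue (A ℤ.* A ℤ.- B)) c4)) }
      where
      scaled : ∀ u → u ℚ.* fromℤ (d r ℤ.* d s) ≡ u ℚ.* (fromℤ (d r) ℚ.* fromℤ (d s))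
      scaled u = cong (u ℚ.*_) (fromℤ-* (d r) (d s))
      ρ : Vec ℤ 9
      ρ = A ∷ B ∷ C ∷ x₀ r ∷ x₁ r ∷ x₂ r ∷ x₀ s ∷ x₁ s ∷ x₂ s ∷ []
      integers : ∀ e → ⟦ e ⟧ℚ (a f ∷ b f ∷ c f ∷ k0 z ℚ.* fromℤ (d r) ∷ k1 z ℚ.* fromℤ (d r) ∷ k2 z ℚ.* fromℤ (d r)
                             ∷ k0 w ℚ.* fromℤ (d s) ∷ k1 w ℚ.* fromℤ (d s) ∷ k2 w ℚ.* fromℤ (d s) ∷ []) ≡ fromℤ (⟦ e ⟧ℤ ρ)
      integers e rewrite eq₀ r | eq₁ r | eq₂ r | eq₀ s | eq₁ s | eq₂ s = sym (fromℤ-expr e ρ)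
      c3 = cong-+ (cong-* (cong₁ r) (cong₂′ s)) (cong-* (cong₂′ r) (cong₁ s))
      c4 = cong-* (cong₂′ r) (cong₂′ s)
      negated : ∀ D {x n} → Cong x n → Cong (ℤ.- (D ℤ.* x)) (residue (ℤ.- D) ℕ.* n)
      negated D {x} h = cong-≡ (sym (ℤₚ.neg-distribˡ-* D x)) (cong-* (cong-residue (ℤ.- D)) h)

    record Reduced (n : Triple) : Set where
      constructor reduced
      field
        r0 : t0 n < p
        r1 : t1 n < p
        r2 : t2 n < p

    private
      zero-numerator : ∀ {d x} → 0ℚ ℚ.* fromℤ d ≡ fromℤ x → x ≡ + 0
      zero-numerator {d} e = fromℤ-injective (trans (sym e) (ℚₚ.*-zeroˡ (fromℤ d)))

    red-0 : ∀ {n} → Red 0K n → Reduced n → isZero³ n ≡ true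
    red-0 {⟪ n₀ , n₁ , n₂ ⟫} r (reduced l0 l1 l2)
      with refl ← cong-0 {n = n₀} (zero-numerator {d r} (eq₀ r)) (cong₀ r) l0
         | refl ← cong-0 {n = n₁} (zero-numerator {d r} (eq₁ r)) (cong₁ r) l1
         | refl ← cong-0 {n = n₂} (zero-numerator {d r} (eq₂ r)) (cong₂′ r) l2 = refl

    ⊠-reduced : ∀ m n → Reduced (m ⊠₃ n)
    ⊠-reduced ⟪ x , y , z ⟫ ⟪ x′ , y′ , z′ ⟫ = reduce-reduced (x ℕ.* x′) (x ℕ.* y′ ℕ.+ y ℕ.* x′) (x ℕ.* z′ ℕ.+ y ℕ.* y′ ℕ.+ z ℕ.* x′) (y ℕ.* z′ ℕ.+ z ℕ.* y′) (z ℕ.* z′)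
      where
      reduce-reduced : ∀ c0 c1 c2 c3 c4 → Reduced (reduce c0 c1 c2 c3 c4)
      reduce-reduced c0 c1 c2 c3 c4 = reduced (ℕ÷.m%n<n (c0 ℕ.+ -C ℕ.* c3 ℕ.+ AC ℕ.* c4) p)
        (ℕ÷.m%n<n (c1 ℕ.+ -B ℕ.* c3 ℕ.+ AB-C ℕ.* c4) p) (ℕ÷.m%n<n (c2 ℕ.+ -A ℕ.* c3 ℕ.+ AA-B ℕ.* c4) p)

    ⊞-reduced : ∀ m n → Reduced (m ⊞₃ n)
    ⊞-reduced ⟪ x , y , z ⟫ ⟪ x′ , y′ , z′ ⟫ = reduced (ℕ÷.m%n<n (x ℕ.+ x′) p) (ℕ÷.m%n<n (y ℕ.+ y′) p) (ℕ÷.m%n<n (z ℕ.+ z′) p)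

    horner : K f → List (K f) → K f → K f
    horner x []       u = u
    horner x (c ∷ cs) u = horner x cs (u *K x +K c)

    red-horner : ∀ {x n cs ns u m} → Red x n → Pointwise Red cs ns → Red u m → Red (horner x cs u) (horner₃ n ns m)
    red-horner rx []       ru = ru
    red-horner rx (r ∷ rs) ru = red-horner rx rs (red-+ (red-* ru rx) r)

    horner-reduced : ∀ n ns m → Reduced m → Reduced (horner₃ n ns m)
    horner-reduced n []       m r = r
    horner-reduced n (c ∷ ns) m r = horner-reduced n ns (m ⊠₃ n ⊞₃ c) (⊞-reduced (m ⊠₃ n) c)

    power-reduced : ∀ n (ns : List Triple) m → Reduced m → Reduced (power₃ n ns m)
    power-reduced n []       m r = r
    power-reduced n (_ ∷ ns) m r = power-reduced n ns (m ⊠₃ n) (⊠-reduced m n)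

    -- dˡ times the value at x of a monic polynomial of degree l, as a polynomial in dx
    homogeneous : K f → List (K f) → K f → K f → K f → K f
    homogeneous t []       D P u = u
    homogeneous t (c ∷ cs) D P u = homogeneous t cs D (P *K D) (u *K t +K P *K D *K c)

    private
      module S = RingSolver K-commutativeRing

    -- Each coefficient consumed brings in one more factor D, so Q is P times a power of D. Its
    -- existence is enough, since it will multiply the value 0.
    homogeneous-horner : ∀ {x D t} → x *K D ≡ t → ∀ cs P u →
                         ∃[ Q ] homogeneous t cs D P (P *K u) ≡ Q *K horner x cs u
    homogeneous-horner e [] P u = P , refl
    homogeneous-horner {x} {D} refl (c ∷ cs) P u with homogeneous-horner {x} {D} refl cs (P *K D) (u *K x +K c)
    ... | Q , h = Q , trans (cong (homogeneous (x *K D) cs D (P *K D))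
      (S.solve 5 (λ P u x D c → P :* u :* (x :* D) :+ P :* D :* c := P :* D :* (u :* x :+ c)) refl P u x D c)) h


    zero₃ : Triple
    zero₃ = ⟪ 0 , 0 , 0 ⟫

    zero-⊠ : ∀ n → zero₃ ⊠₃ n ≡ zero₃
    zero-⊠ n = trans (cong₂ (λ u v → ⟪ (u ℕ.+ AC ℕ.* 0) ℕ÷.% p , (v ℕ.+ AB-C ℕ.* 0) ℕ÷.% p , (-A ℕ.* 0 ℕ.+ AA-B ℕ.* 0) ℕ÷.% p ⟫) (ℕₚ.*-zeroʳ -C) (ℕₚ.*-zeroʳ -B))
      (trans (cong₂ (λ u v → ⟪ u ℕ÷.% p , v ℕ÷.% p , (-A ℕ.* 0 ℕ.+ AA-B ℕ.* 0) ℕ÷.% p ⟫) (ℕₚ.*-zeroʳ AC) (ℕₚ.*-zeroʳ AB-C))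
             (cong₂ (λ u v → ⟪ 0 , 0 , (u ℕ.+ v) ℕ÷.% p ⟫) (ℕₚ.*-zeroʳ -A) (ℕₚ.*-zeroʳ AA-B)))

    ⊞-zero : ∀ {n} → Reduced n → n ⊞₃ zero₃ ≡ n
    ⊞-zero {⟪ x , y , z ⟫} (reduced l0 l1 l2) = trans (cong₂ (λ u v → ⟪ u , v , (z ℕ.+ 0) ℕ÷.% p ⟫) (same l0) (same l1)) (cong ⟪ x , y ,_⟫ (same l2))
      where
      same : ∀ {x} → x < p → (x ℕ.+ 0) ℕ÷.% p ≡ x
      same {x} l = trans (cong (ℕ÷._% p) (ℕₚ.+-identityʳ x)) (ℕ÷.m<n⇒m%n≡m l)

    -- Modulo p the denominator D is 0, so every term but the leading one disappears and a pure
    -- power of the numerator t remains.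
    red-homogeneous : ∀ {t D n} → Red t n → Red D zero₃ → ∀ {cs ns P q u m} → Pointwise Red cs ns → Red P q → Red u m →
                      Red (homogeneous t cs D P u) (power₃ n ns m)
    red-homogeneous rt rD [] rP ru = ru
    red-homogeneous {t} {D} {n} rt rD {ns = k ∷ _} {P = P} {q} {u} {m} (_∷_ {c} rc rs) rP ru =
      red-homogeneous rt rD rs (red-* rP rD)
        (subst (Red (u *K t +K P *K D *K c)) (⊞-zero (⊠-reduced m n))
          (red-+ (red-* ru rt) (subst (λ w → Red (w *K c) zero₃) (*K-comm D P)
            (subst (Red (D *K P *K c)) (zero-⊠ k) (red-* (subst (Red (D *K P)) (zero-⊠ q) (red-* rD rP)) rc)))))

    K-scale : ∀ z q → z *K emb q ≡ ⟨ k0 z ℚ.* q , k1 z ℚ.* q , k2 z ℚ.* q ⟩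
    K-scale z q = trans (*K-comm z (emb q)) (trans (*K-emb q (k0 z) (k1 z) (k2 z))
      (K-≡ (ℚₚ.*-comm q (k0 z)) (ℚₚ.*-comm q (k1 z)) (ℚₚ.*-comm q (k2 z))))

    record Fraction (x : K f) (n : ℕ) : Set where
      constructor fraction
      field
        {x₀ x₁ x₂} : ℤ
        num₀ : k0 x ℚ.* fromℤ (+ n) ≡ fromℤ x₀
        num₁ : k1 x ℚ.* fromℤ (+ n) ≡ fromℤ x₁
        num₂ : k2 x ℚ.* fromℤ (+ n) ≡ fromℤ x₂

    common-denominator : ∀ x → ∃[ n ] (0 < n × Fraction x n)
    common-denominator ⟨ u@(mkℚ _ d _) , v@(mkℚ _ d′ _) , w@(mkℚ _ d″ _) ⟩ = suc d ℕ.* suc d′ ℕ.* suc d″ , s≤s z≤n , fraction {x₀ = ↥ u ℤ.* (+ suc d′ ℤ.* + suc d″)} {↥ v ℤ.* (+ suc d ℤ.* + suc d″)} {↥ w ℤ.* (+ suc d ℤ.* + suc d′)}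
      (trans (cong (u ℚ.*_) split) (trans (solveℚ 4 (λ u a b c → u :* (a :* b :* c) := u :* a :* (b :* c)) refl u D D′ D″) (scaled u (+ suc d′) (+ suc d″) (denominator-* u))))
      (trans (cong (v ℚ.*_) split) (trans (solveℚ 4 (λ u a b c → u :* (a :* b :* c) := u :* b :* (a :* c)) refl v D D′ D″) (scaled v (+ suc d) (+ suc d″) (denominator-* v))))
      (trans (cong (w ℚ.*_) split) (trans (solveℚ 4 (λ u a b c → u :* (a :* b :* c) := u :* c :* (a :* b)) refl w D D′ D″) (scaled w (+ suc d) (+ suc d′) (denominator-* w))))
      where
      D D′ D″ : ℚ
      D  = fromℤ (+ suc d)
      D′ = fromℤ (+ suc d′)
      D″ = fromℤ (+ suc d″)
      split : fromℤ (+ (suc d ℕ.* suc d′ ℕ.* suc d″)) ≡ D ℚ.* D′ ℚ.* D″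
      split = trans (cong fromℤ (trans (ℤₚ.pos-* (suc d ℕ.* suc d′) (suc d″)) (cong (λ z → z ℤ.* + suc d″) (ℤₚ.pos-* (suc d) (suc d′)))))
        (fromℤ-expr (var (# 0) :* var (# 1) :* var (# 2)) (+ suc d ∷ + suc d′ ∷ + suc d″ ∷ []))
      scaled : ∀ q m n → q ℚ.* fromℤ (↧ q) ≡ fromℤ (↥ q) → q ℚ.* fromℤ (↧ q) ℚ.* (fromℤ m ℚ.* fromℤ n) ≡ fromℤ (↥ q ℤ.* (m ℤ.* n))
      scaled q m n e = trans (cong (ℚ._* (fromℤ m ℚ.* fromℤ n)) e) (sym (fromℤ-expr (var (# 0) :* (var (# 1) :* var (# 2))) (↥ q ∷ m ∷ n ∷ [])))

    ℚ-cancelʳ : ∀ {q r} s → s ≢ 0ℚ → q ℚ.* s ≡ r ℚ.* s → q ≡ r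
    ℚ-cancelʳ {q} {r} s s≢0 e with ℚ-inverse s s≢0
    ... | t , st = trans (unit q) (trans (cong (ℚ._* t) e) (sym (unit r)))
      where
      unit : ∀ q → q ≡ q ℚ.* s ℚ.* t
      unit q = sym (trans (ℚₚ.*-assoc q s t) (trans (cong (q ℚ.*_) st) (ℚₚ.*-identityʳ q)))

    module _ {cs : List (K f)} {ns : List Triple} (rs : Pointwise Red cs ns) (ok : rootless ns ≡ true) (inv : invertibles ≡ true) where
      private
        test : ∀ {x y z} → x < p → y < p → z < p → passes ns x y z ≡ true
        test {x} {y} lx ly lz = allBelow-sound p (passes ns x y)
          (allBelow-sound p (λ y → allBelow p (passes ns x y))
            (allBelow-sound p (λ x → allBelow p λ y → allBelow p (passes ns x y)) ok lx) ly) lz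

        residue< : ∀ z → residue z < p
        residue< z = ℤ÷.n%ℕd<d z p

        red-1 : Red 1K one₃
        red-1 = record { d = + 1 ; d-cong = + 0 , refl ; eq₀ = refl ; eq₁ = refl ; eq₂ = refl ; cong₀ = + 0 , refl ; cong₁ = + 0 , refl ; cong₂′ = + 0 , refl }

        one-reduced : Reduced one₃
        one-reduced = reduced (s≤s (s≤s z≤n)) (s≤s z≤n) (s≤s z≤n)

        isZero³-elim : ∀ {x y z} → isZero³ ⟪ x , y , z ⟫ ≡ true → x ≡ 0 × y ≡ 0 × z ≡ 0
        isZero³-elim {zero} {zero} {zero} _ = refl , refl , refl

        -- Induction on a common denominator n of x. If p does not divide n, then x has a residue,
        -- which would be a root modulo p. If p divides n, clearing denominators shows that a power
        -- of t = nx vanishes modulo p; the second half of `passes` gives t ≡ 0, and n can be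
        -- divided by p. Thus nothing is assumed about ℤ[α] at p beyond the search.
        descent : ∀ x → horner x cs 1K ≡ 0K → ∀ n → Acc _<_ n → 0 < n → Fraction x n → ⊥
        descent x root n (acc rec) 0<n (fraction {x₀} {x₁} {x₂} e₀ e₁ e₂) with n ℕ÷.% p in n%p
        ... | suc r = contradiction
          where
          r< : r < p-1
          r< = ℕ.s≤s⁻¹ (subst (_< p) n%p (ℕ÷.m%n<n n p))
          inverse : ∃[ s ] inverseOf r s ≡ true
          inverse = someBelow-sound p (inverseOf r) (allBelow-sound p-1 (λ r → someBelow p (inverseOf r)) inv r<)
          s : ℕ
          s = proj₁ inverse
          rs≡1 : (suc r ℕ.* s) ℕ÷.% p ≡ 1
          rs≡1 = ℕₚ.≡ᵇ⇒≡ _ 1 (subst Bool.T (sym (proj₂ inverse)) _)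
          component : ∀ q {z} → q ℚ.* fromℤ (+ n) ≡ fromℤ z → q ℚ.* fromℤ (+ n ℤ.* + s) ≡ fromℤ (z ℤ.* + s)
          component q {z} e = trans (cong (q ℚ.*_) (fromℤ-* (+ n) (+ s))) (trans (sym (ℚₚ.*-assoc q (fromℤ (+ n)) (fromℤ (+ s))))
            (trans (cong (ℚ._* fromℤ (+ s)) e) (sym (fromℤ-* z (+ s)))))
          residues : Triple
          residues = ⟪ residue (x₀ ℤ.* + s) , residue (x₁ ℤ.* + s) , residue (x₂ ℤ.* + s) ⟫
          rx : Red x residues
          rx = record
            -- s inverts n modulo p, so ns is a denominator congruent to 1, as `Red` demands.
            { d-cong = subst (Cong (+ n ℤ.* + s)) rs≡1 (cong-% (cong-* (subst (Cong (+ n)) n%p (cong-% (+ 0 , sym (ℤₚ.+-identityʳ (+ n))))) (+ 0 , sym (ℤₚ.+-identityʳ (+ s)))))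
            ; eq₀ = component (k0 x) {x₀} e₀ ; eq₁ = component (k1 x) {x₁} e₁ ; eq₂ = component (k2 x) {x₂} e₂
            ; cong₀ = cong-residue (x₀ ℤ.* + s) ; cong₁ = cong-residue (x₁ ℤ.* + s) ; cong₂′ = cong-residue (x₂ ℤ.* + s) }
          vanishes : isZero³ (horner₃ residues ns one₃) ≡ true
          vanishes = red-0 (subst (λ w → Red w (horner₃ residues ns one₃)) root (red-horner rx rs red-1)) (horner-reduced residues ns one₃ one-reduced)
          contradiction : ⊥
          contradiction with () ← trans (sym (∧-left (test (residue< (x₀ ℤ.* + s)) (residue< (x₁ ℤ.* + s)) (residue< (x₂ ℤ.* + s))))) (cong not vanishes)
        ... | zero = descent x root m (rec m<n) 0<m (fraction {x₀ = x₀ ℤ÷./ℕ p} {x₁ ℤ÷./ℕ p} {x₂ ℤ÷./ℕ p} (divide (k0 x) x₀ e₀ (proj₁ zeros)) (divide (k1 x) x₁ e₁ (proj₁ (proj₂ zeros))) (divide (k2 x) x₂ e₂ (proj₂ (proj₂ zeros))))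
          where
          m : ℕ
          m = n ℕ÷./ p
          n≡mp : n ≡ m ℕ.* p
          n≡mp = trans (ℕ÷.m≡m%n+[m/n]*n n p) (cong (ℕ._+ m ℕ.* p) n%p)
          0<m : 0 < m
          0<m with m in e
          ... | zero = ⊥-elim (ℕₚ.<⇒≢ 0<n (sym (trans n≡mp (cong (ℕ._* p) e))))
          ... | suc _ = s≤s z≤n
          m<n : m < n
          m<n = ℕ÷.m/n<m n p {{ℕ.>-nonZero 0<n}} {{_}} (s≤s (s≤s z≤n))
          D : K f
          D = emb (fromℤ (+ n))
          rD : Red D zero₃
          rD = subst (λ r → Red D ⟪ r , 0 , 0 ⟫) n%p (red-ι (+ n) (+ 0) (+ 0))
          residues : Triple
          residues = ⟪ residue x₀ , residue x₁ , residue x₂ ⟫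
          rt : Red (x *K D) residues
          rt = subst (λ w → Red w residues) (sym (trans (K-scale x (fromℤ (+ n))) (K-≡ e₀ e₁ e₂))) (red-ι x₀ x₁ x₂)
          H : ∃[ Q ] homogeneous (x *K D) cs D 1K (1K *K 1K) ≡ Q *K horner x cs 1K
          H = homogeneous-horner refl cs 1K 1K
          homogeneous≡0 : homogeneous (x *K D) cs D 1K 1K ≡ 0K
          homogeneous≡0 = trans (cong (homogeneous (x *K D) cs D 1K) (sym (*K-identityˡ 1K)))
            (trans (proj₂ H) (trans (cong (proj₁ H *K_) root) (CommutativeRing.zeroʳ K-commutativeRing (proj₁ H))))
          vanishes : isZero³ (power₃ residues ns one₃) ≡ true
          vanishes = red-0 (subst (λ w → Red w (power₃ residues ns one₃)) homogeneous≡0 (red-homogeneous rt rD rs red-1 red-1)) (power-reduced residues ns one₃ one-reduced)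
          zeros : residue x₀ ≡ 0 × residue x₁ ≡ 0 × residue x₂ ≡ 0
          zeros = isZero³-elim (trans (cong (λ b → not b ∨ isZero³ residues) (sym vanishes))
            (∧-right {not (isZero³ (horner₃ residues ns one₃))} (test (residue< x₀) (residue< x₁) (residue< x₂))))
          divide : ∀ q z → q ℚ.* fromℤ (+ n) ≡ fromℤ z → residue z ≡ 0 → q ℚ.* fromℤ (+ m) ≡ fromℤ (z ℤ÷./ℕ p)
          divide q z e r≡0 = ℚ-cancelʳ (fromℤ (+ p)) (λ h → p≢0 (fromℤ-injective h)) (begin
            q ℚ.* fromℤ (+ m) ℚ.* fromℤ (+ p)      ≡⟨ ℚₚ.*-assoc q _ _ ⟩
            q ℚ.* (fromℤ (+ m) ℚ.* fromℤ (+ p))    ≡⟨ cong (q ℚ.*_) (fromℤ-* (+ m) (+ p)) ⟨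
            q ℚ.* fromℤ (+ m ℤ.* + p)              ≡⟨ cong (λ k → q ℚ.* fromℤ k) (trans (sym (ℤₚ.pos-* m p)) (cong +_ (sym n≡mp))) ⟩
            q ℚ.* fromℤ (+ n)                      ≡⟨ e ⟩
            fromℤ z                                ≡⟨ cong fromℤ (trans (ℤ÷.a≡a%ℕn+[a/ℕn]*n z p) (trans (cong (λ r → + r ℤ.+ z ℤ÷./ℕ p ℤ.* + p) r≡0) (ℤₚ.+-identityˡ (z ℤ÷./ℕ p ℤ.* + p)))) ⟩
            fromℤ (z ℤ÷./ℕ p ℤ.* + p)              ≡⟨ fromℤ-* (z ℤ÷./ℕ p) (+ p) ⟩
            fromℤ (z ℤ÷./ℕ p) ℚ.* fromℤ (+ p)      ∎)
            where
            open ≡-Reasoning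
            p≢0 : + p ≢ + 0
            p≢0 ()

      no-root : ∀ x → horner x cs 1K ≢ 0K
      no-root x root = let n , 0<n , fr = common-denominator x in descent x root n (<-wellFounded n) 0<n fr

-- From relations among generators to embedded subgroups

module SubgroupEmbeddings where
  open import Defs
  open TwoDescent
  open import Algebra.Bundles using (AbelianGroup)
  open import Data.Fin using (Fin; toℕ)
  import Data.Fin.Properties as Finₚ
  open import Data.Integer as ℤ using (ℤ; +_; -[1+_])
  import Data.Integer.Properties as ℤₚ
  import Data.Integer.DivMod as ℤ÷
  open import Data.List using (List; []; _∷_)
  open import Data.Nat as ℕ using (ℕ; zero; suc; _≤_; _<_; z≤n; s≤s)
  import Data.Nat.Properties as ℕₚ
  import Data.Nat.DivMod as ℕ÷
  open import Data.Product using (_×_; _,_; proj₁; ∃-syntax)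
  open import Data.Sum using (_⊎_; inj₁; inj₂)
  open import Level using (0ℓ)
  open import Data.Unit using (⊤; tt)
  open import Data.Vec as Vec using (Vec; []; _∷_; replicate)
  open import Data.Bool using (true; _∨_)
  open import Data.Empty using (⊥-elim)
  open import Relation.Nullary using (¬_)
  open import Relation.Binary.PropositionalEquality using (_≡_; refl; sym; trans; cong; cong₂; subst)

  module Embedding (G : AbelianGroup 0ℓ 0ℓ) where
    open AbelianGroup G renaming (Carrier to A; refl to ≈-refl; sym to ≈-sym; trans to ≈-trans)
    open IntegerMultiples G public
    open Independence G public
    open import Algebra.Properties.AbelianGroup G using (⁻¹-∙-comm; ε⁻¹≈ε)
    open import Algebra.Properties.Monoid.Mult monoid using (×-congʳ)
    open import Algebra.Properties.CommutativeMonoid.Mult commutativeMonoid using (×-distrib-+)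
    open import Algebra.Properties.CommutativeSemigroup commutativeSemigroup using (interchange)
    open import Relation.Binary.Reasoning.Setoid setoid

    Generators : List Factor → Set
    Generators []       = ⊤
    Generators (_ ∷ φs) = A × Generators φs

    Coefficients : List Factor → Set
    Coefficients []       = ⊤
    Coefficients (_ ∷ φs) = ℤ × Coefficients φs

    linear : ∀ φs → Generators φs → Coefficients φs → A
    linear []       _        _        = ε
    linear (_ ∷ φs) (γ , γs) (z , zs) = z · γ ∙ linear φs γs zs

    coefficient : ∀ φ → FElem φ → ℤ
    coefficient (zmod n) i = + toℕ i
    coefficient zz       z = z

    coefficients : ∀ φs → Carrier φs → Coefficients φs
    coefficients []       _        = tt
    coefficients (φ ∷ φs) (x , xs) = coefficient φ x , coefficients φs xs

    -- The integer vectors that represent 0 in the abstract group; injectivity will mean that there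
    -- are no further relations among the generators.
    Trivial : ∀ φs → Coefficients φs → Set
    Trivial []            _        = ⊤
    Trivial (zmod n ∷ φs) (z , zs) = (∃[ k ] z ≡ k ℤ.* + n) × Trivial φs zs
    Trivial (zz ∷ φs)     (z , zs) = z ≡ + 0 × Trivial φs zs

    Orders : ∀ φs → Generators φs → Set
    Orders []            _        = ⊤
    Orders (zmod n ∷ φs) (γ , γs) = n ·ℕ γ ≈ ε × Orders φs γs
    Orders (zz ∷ φs)     (γ , γs) = Orders φs γs

    multiple-of-order : ∀ {n x} k → n ·ℕ x ≈ ε → (k ℕ.* n) ·ℕ x ≈ ε
    multiple-of-order {n} {x} zero h = ≈-refl
    multiple-of-order {n} {x} (suc k) h = ≈-trans (×-homo-+ x n (k ℕ.* n)) (≈-trans (∙-cong h (multiple-of-order k h)) (identityˡ ε))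

    ·ℕ-% : ∀ {n x} → suc n ·ℕ x ≈ ε → ∀ k → (k ℕ÷.% suc n) ·ℕ x ≈ k ·ℕ x
    ·ℕ-% {n} {x} h k = ≈-sym (begin
      k ·ℕ x                                                  ≡⟨ cong (_·ℕ x) (ℕ÷.m≡m%n+[m/n]*n k (suc n)) ⟩
      (k ℕ÷.% suc n ℕ.+ k ℕ÷./ suc n ℕ.* suc n) ·ℕ x          ≈⟨ ×-homo-+ x (k ℕ÷.% suc n) _ ⟩
      (k ℕ÷.% suc n) ·ℕ x ∙ (k ℕ÷./ suc n ℕ.* suc n) ·ℕ x     ≈⟨ ∙-congˡ (multiple-of-order (k ℕ÷./ suc n) h) ⟩
      (k ℕ÷.% suc n) ·ℕ x ∙ ε                                 ≈⟨ identityʳ _ ⟩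
      (k ℕ÷.% suc n) ·ℕ x                                     ∎)

    embed : ∀ φs → Generators φs → Carrier φs → A
    embed φs γs g = linear φs γs (coefficients φs g)

    embed-homo : ∀ φs γs → Orders φs γs → ∀ g g′ → embed φs γs g ∙ embed φs γs g′ ≈ embed φs γs (gadd φs g g′)
    embed-homo [] _ _ _ _ = identityˡ ε
    embed-homo (zmod (suc n) ∷ φs) (γ , γs) (o , os) (i , g) (j , g′) = ≈-trans (interchange _ _ _ _) (∙-cong head (embed-homo φs γs os g g′))
      where
      head : toℕ i ·ℕ γ ∙ toℕ j ·ℕ γ ≈ toℕ ((toℕ i ℕ.+ toℕ j) ℕ÷.mod suc n) ·ℕ γ
      head = ≈-sym (begin
        toℕ ((toℕ i ℕ.+ toℕ j) ℕ÷.mod suc n) ·ℕ γ     ≡⟨ cong (_·ℕ γ) (Finₚ.toℕ-fromℕ< (ℕ÷.m%n<n (toℕ i ℕ.+ toℕ j) (suc n))) ⟩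
        ((toℕ i ℕ.+ toℕ j) ℕ÷.% suc n) ·ℕ γ           ≈⟨ ·ℕ-% {n} {γ} o (toℕ i ℕ.+ toℕ j) ⟩
        (toℕ i ℕ.+ toℕ j) ·ℕ γ                        ≈⟨ ×-homo-+ γ (toℕ i) (toℕ j) ⟩
        toℕ i ·ℕ γ ∙ toℕ j ·ℕ γ                       ∎)
    embed-homo (zmod zero ∷ φs) _ _ (() , _) _
    embed-homo (zz ∷ φs) (γ , γs) os (i , g) (j , g′) = ≈-trans (interchange _ _ _ _) (∙-cong (≈-sym (·-homo-+ i j γ)) (embed-homo φs γs os g g′))

    -- Subtraction is done on integer coefficients because `gadd` provides addition only; a
    -- collision of images thereby becomes a relation among generators.
    difference : ∀ φs → Carrier φs → Carrier φs → Coefficients φs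
    difference []       _       _         = tt
    difference (φ ∷ φs) (x , g) (x′ , g′) = coefficient φ x ℤ.- coefficient φ x′ , difference φs g g′

    linear-difference : ∀ φs γs g g′ → linear φs γs (difference φs g g′) ≈ embed φs γs g ∙ (embed φs γs g′) ⁻¹
    linear-difference [] _ _ _ = ≈-sym (inverseʳ ε)
    linear-difference (φ ∷ φs) (γ , γs) (x , g) (x′ , g′) = begin
      (y ℤ.- y′) · γ ∙ linear φs γs (difference φs g g′)
        ≈⟨ ∙-cong (≈-trans (·-homo-+ y (ℤ.- y′) γ) (∙-congˡ (·-homo-neg y′ γ))) (linear-difference φs γs g g′) ⟩
      (y · γ ∙ (y′ · γ) ⁻¹) ∙ (embed φs γs g ∙ (embed φs γs g′) ⁻¹)   ≈⟨ interchange _ _ _ _ ⟩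
      (y · γ ∙ embed φs γs g) ∙ ((y′ · γ) ⁻¹ ∙ (embed φs γs g′) ⁻¹)   ≈⟨ ∙-congˡ (⁻¹-∙-comm _ _) ⟩
      _ ∎
      where
      y  = coefficient φ x
      y′ = coefficient φ x′

    -- Two representatives below n differ by less than n, so a difference divisible by n is 0.
    congruent : ∀ {n} (i j : Fin n) k → + toℕ i ℤ.- + toℕ j ≡ k ℤ.* + n → i ≡ j
    congruent {n} i j k e = Finₚ.toℕ-injective (ℕₚ.∣m-n∣≡0⇒m≡n (below (ℤ.∣ k ∣) (trans (cong ℤ.∣_∣ (trans (sym (ℤₚ.m-n≡m⊖n (toℕ i) (toℕ j))) e)) (ℤₚ.abs-* k (+ n)))))
      where
      distance : ℕ.∣ toℕ i - toℕ j ∣ < n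
      distance = ℕₚ.≤-<-trans (ℕₚ.∣m-n∣≤m⊔n (toℕ i) (toℕ j)) (ℕₚ.⊔-pres-<m (Finₚ.toℕ<n i) (Finₚ.toℕ<n j))
      abs⊖ : ∀ m n → ℤ.∣ m ℤ.⊖ n ∣ ≡ ℕ.∣ m - n ∣
      abs⊖ zero zero = refl
      abs⊖ zero (suc n) = refl
      abs⊖ (suc m) zero = refl
      abs⊖ (suc m) (suc n) = trans (cong ℤ.∣_∣ (ℤₚ.[1+m]⊖[1+n]≡m⊖n m n)) (abs⊖ m n)
      below : ∀ k → ℤ.∣ toℕ i ℤ.⊖ toℕ j ∣ ≡ k ℕ.* n → ℕ.∣ toℕ i - toℕ j ∣ ≡ 0
      below zero e = trans (sym (abs⊖ (toℕ i) (toℕ j))) e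
      below (suc k) e = ⊥-elim (ℕₚ.<⇒≱ distance (subst (n ≤_) (trans (sym e) (abs⊖ (toℕ i) (toℕ j))) (ℕₚ.m≤m+n n (k ℕ.* n))))

    trivial-difference : ∀ φs g g′ → Trivial φs (difference φs g g′) → g ≡ g′
    trivial-difference [] _ _ _ = refl
    trivial-difference (zmod n ∷ φs) (i , g) (j , g′) ((k , e) , t) = cong₂ _,_ (congruent i j k e) (trivial-difference φs g g′ t)
    trivial-difference (zz ∷ φs) (i , g) (j , g′) (e , t) = cong₂ _,_ (ℤₚ.i-j≡0⇒i≡j i j e) (trivial-difference φs g g′ t)

    embed-injective : ∀ φs γs → (∀ z → linear φs γs z ≈ ε → Trivial φs z) → ∀ g g′ → embed φs γs g ≈ embed φs γs g′ → g ≡ g′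
    embed-injective φs γs kernel g g′ e = trivial-difference φs g g′ (kernel _
      (≈-trans (linear-difference φs γs g g′) (≈-trans (∙-congʳ e) (inverseʳ _))))

    ExactOrder : ℕ → A → Set
    ExactOrder n x = n ·ℕ x ≈ ε × (∀ i → 0 < i → i < n → ¬ (i ·ℕ x ≈ ε))

    ·-order : ∀ {n x} k → n ·ℕ x ≈ ε → (k ℤ.* + n) · x ≈ ε
    ·-order {n} {x} (+ k) o = ≈-trans (reflexive (cong (_· x) (sym (ℤₚ.pos-* k n)))) (multiple-of-order k o)
    ·-order {n} {x} -[1+ k ] o = begin
      (-[1+ k ] ℤ.* + n) · x          ≡⟨ cong (_· x) (ℤₚ.neg-distribˡ-* (+ suc k) (+ n)) ⟨
      (ℤ.- (+ suc k ℤ.* + n)) · x     ≈⟨ ·-homo-neg (+ suc k ℤ.* + n) x ⟩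
      ((+ suc k ℤ.* + n) · x) ⁻¹      ≈⟨ ⁻¹-cong (·-order {n} {x} (+ suc k) o) ⟩
      ε ⁻¹                            ≈⟨ ε⁻¹≈ε ⟩
      ε                               ∎

    ·-%ℕ : ∀ {n-1 x} → suc n-1 ·ℕ x ≈ ε → ∀ z → z · x ≈ (z ℤ÷.%ℕ suc n-1) ·ℕ x
    ·-%ℕ {n-1} {x} o z = begin
      z · x                                                    ≡⟨ cong (_· x) (ℤ÷.a≡a%ℕn+[a/ℕn]*n z n) ⟩
      (+ (z ℤ÷.%ℕ n) ℤ.+ (z ℤ÷./ℕ n) ℤ.* + n) · x             ≈⟨ ·-homo-+ (+ (z ℤ÷.%ℕ n)) ((z ℤ÷./ℕ n) ℤ.* + n) x ⟩
      (z ℤ÷.%ℕ n) ·ℕ x ∙ ((z ℤ÷./ℕ n) ℤ.* + n) · x            ≈⟨ ∙-congˡ (·-order (z ℤ÷./ℕ n) o) ⟩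
      (z ℤ÷.%ℕ n) ·ℕ x ∙ ε                                    ≈⟨ identityʳ _ ⟩
      (z ℤ÷.%ℕ n) ·ℕ x                                        ∎
      where
      n : ℕ
      n = suc n-1

    exact-order : ∀ {n-1 x} → ExactOrder (suc n-1) x → ∀ z → z · x ≈ ε → ∃[ k ] z ≡ k ℤ.* + suc n-1
    exact-order {n-1} {x} (o , exact) z e with z ℤ÷.%ℕ suc n-1 in r
    ... | zero = z ℤ÷./ℕ suc n-1 , trans (ℤ÷.a≡a%ℕn+[a/ℕn]*n z (suc n-1))
                   (trans (cong (λ i → + i ℤ.+ (z ℤ÷./ℕ suc n-1) ℤ.* + suc n-1) r) (ℤₚ.+-identityˡ _))
    ... | suc i = ⊥-elim (exact (suc i) (s≤s z≤n) (subst (_< suc n-1) r (ℤ÷.n%ℕd<d z (suc n-1)))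
                    (≈-trans (≈-sym (≈-trans (·-%ℕ o z) (reflexive (cong (_·ℕ x) r)))) e))

    Indivisible : ∀ {r m} → Vec A r → Vec A m → Set
    Indivisible P τ = ∀ δ ε′ → some δ ∨ some ε′ ≡ true → ∀ R → ¬ (R ∙ R ≈ select δ P ∙ select ε′ τ)

    TwoTorsion : ∀ {m} → Vec A m → Set
    TwoTorsion τ = ∀ R → R ∙ R ≈ ε → ∃[ w ] R ≈ combination w τ

    -- Torsion of odd order n disappears from a relation after multiplication by n.
    kernel-odd : ∀ {r n-1 T} (P : Vec A r) → ExactOrder (suc n-1) T → Indivisible P [] → TwoTorsion [] →
                 ∀ t v → t · T ∙ combination v P ≈ ε → (∃[ k ] t ≡ k ℤ.* + suc n-1) × v ≡ replicate r (+ 0)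
    kernel-odd {r} {n-1} {T} P o indiv tors t v e = exact-order o t tT≈ε , v≡0
      where
      n : ℕ
      n = suc n-1
      scale : ∀ {k} → Vec ℤ k → Vec ℤ k
      scale = Vec.map (ℤ._* + n)
      ·-scale : ∀ z x → (z ℤ.* + n) · x ≈ n ·ℕ (z · x)
      ·-scale z x = ≈-trans (reflexive (cong (_· x) (ℤₚ.*-comm z (+ n)))) (go n)
        where
        go : ∀ n → (+ n ℤ.* z) · x ≈ n ·ℕ (z · x)
        go zero = ≈-refl
        go (suc n) = begin
          (+ suc n ℤ.* z) · x         ≡⟨ cong (_· x) (ℤₚ.suc-* (+ n) z) ⟩
          (z ℤ.+ + n ℤ.* z) · x       ≈⟨ ·-homo-+ z (+ n ℤ.* z) x ⟩
          z · x ∙ (+ n ℤ.* z) · x     ≈⟨ ∙-congˡ (go n) ⟩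
          z · x ∙ n ·ℕ (z · x)        ∎
      ·ℕ-ε : ∀ n → n ·ℕ ε ≈ ε
      ·ℕ-ε zero = ≈-refl
      ·ℕ-ε (suc n) = ≈-trans (identityˡ _) (·ℕ-ε n)
      combination-scale : ∀ {k} (v : Vec ℤ k) P → combination (scale v) P ≈ n ·ℕ combination v P
      combination-scale [] [] = ≈-sym (·ℕ-ε n)
      combination-scale (z ∷ v) (x ∷ P) = ≈-trans (∙-cong (·-scale z x) (combination-scale v P)) (≈-sym (×-distrib-+ (z · x) (combination v P) n))
      scaled : combination (scale v) P ∙ ε ≈ ε
      scaled = begin
        combination (scale v) P ∙ ε                       ≈⟨ identityʳ _ ⟩
        combination (scale v) P                           ≈⟨ combination-scale v P ⟩
        n ·ℕ combination v P                              ≈⟨ identityˡ _ ⟨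
        ε ∙ n ·ℕ combination v P                          ≈⟨ ∙-congʳ (≈-trans (≈-sym (·-scale t T)) (·-order t (proj₁ o))) ⟨
        n ·ℕ (t · T) ∙ n ·ℕ combination v P               ≈⟨ ×-distrib-+ (t · T) (combination v P) n ⟨
        n ·ℕ (t · T ∙ combination v P)                    ≈⟨ ×-congʳ n e ⟩
        n ·ℕ ε                                            ≈⟨ ·ℕ-ε n ⟩
        ε                                                 ∎
      unscale : ∀ {k} (v : Vec ℤ k) → scale v ≡ replicate k (+ 0) → v ≡ replicate k (+ 0)
      unscale [] _ = refl
      unscale (z ∷ v) h = cong₂ _∷_ (ℤₚ.*-cancelʳ-≡ z (+ 0) (+ n) (cong Vec.head h)) (unscale v (cong Vec.tail h))
      v≡0 : v ≡ replicate r (+ 0)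
      v≡0 = unscale v (independent P [] indiv tors (scale v) [] scaled)
      tT≈ε : t · T ≈ ε
      tT≈ε = begin
        t · T                        ≈⟨ identityʳ _ ⟨
        t · T ∙ ε                    ≈⟨ ∙-congˡ (combination-0 P) ⟨
        t · T ∙ combination (replicate r (+ 0)) P   ≡⟨ cong (λ v → t · T ∙ combination v P) v≡0 ⟨
        t · T ∙ combination v P      ≈⟨ e ⟩
        ε                            ∎

    -- T itself is taken as the torsion generator τ. Independence removes P from the relation, and
    -- what is left concerns the order of T alone.
    kernel-cyclic : ∀ {n-1 T P} → ExactOrder (suc n-1) T → Indivisible (P ∷ []) (T ∷ []) → TwoTorsion (T ∷ []) →
                    ∀ t v → t · T ∙ (v · P ∙ ε) ≈ ε → (∃[ k ] t ≡ k ℤ.* + suc n-1) × v ≡ + 0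
    kernel-cyclic {n-1} {T} {P} o indiv tors t v e = exact-order o t tT≈ε , v≡0
      where
      v≡0 : v ≡ + 0
      v≡0 = cong Vec.head (independent (P ∷ []) (T ∷ []) indiv tors (v ∷ []) (t ∷ [])
        (≈-trans (comm _ _) (≈-trans (∙-congʳ (identityʳ _)) e)))
      tT≈ε : t · T ≈ ε
      tT≈ε = ≈-trans (≈-sym (≈-trans (∙-congˡ (≈-trans (identityʳ _) (reflexive (cong (_· P) v≡0)))) (identityʳ _))) e

    -- After P has been removed, sS + tT = 0 remains. For odd s this would put S among the multiples
    -- of T, which `disjoint` forbids; so sS and tT vanish separately.
    kernel-bicyclic : ∀ {n-1 S T P} → ExactOrder 2 S → ExactOrder (suc n-1) T → (∀ i → i < suc n-1 → ¬ (i ·ℕ T ≈ S)) →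
                      Indivisible (P ∷ []) (S ∷ T ∷ []) → TwoTorsion (S ∷ T ∷ []) →
                      ∀ s t v → s · S ∙ (t · T ∙ (v · P ∙ ε)) ≈ ε → (∃[ k ] s ≡ k ℤ.* + 2) × (∃[ k ] t ≡ k ℤ.* + suc n-1) × v ≡ + 0
    kernel-bicyclic {n-1} {S} {T} {P} oS oT disjoint indiv tors s t v e = even , exact-order oT t tT≈ε , v≡0
      where
      v≡0 : v ≡ + 0
      v≡0 = cong Vec.head (independent (P ∷ []) (S ∷ T ∷ []) indiv tors (v ∷ []) (s ∷ t ∷ []) (begin
        (v · P ∙ ε) ∙ (s · S ∙ (t · T ∙ ε))      ≈⟨ ∙-congˡ (∙-congˡ (identityʳ _)) ⟩
        (v · P ∙ ε) ∙ (s · S ∙ t · T)            ≈⟨ comm _ _ ⟩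
        (s · S ∙ t · T) ∙ (v · P ∙ ε)            ≈⟨ assoc _ _ _ ⟩
        s · S ∙ (t · T ∙ (v · P ∙ ε))            ≈⟨ e ⟩
        ε ∎))
      torsion : s · S ∙ t · T ≈ ε
      torsion = ≈-trans (∙-congˡ (≈-sym (≈-trans (∙-congˡ (≈-trans (identityʳ _) (reflexive (cong (_· P) v≡0)))) (identityʳ _)))) e
      open import Algebra.Properties.AbelianGroup G using (inverseˡ-unique)
      cases : (s · S ≈ ε) ⊎ (s · S ≈ S)
      cases with s ℤ÷.%ℕ 2 in r | ℤ÷.n%ℕd<d s 2
      ... | 0 | _ = inj₁ (≈-trans (·-%ℕ (proj₁ oS) s) (reflexive (cong (_·ℕ S) r)))
      ... | 1 | _ = inj₂ (≈-trans (·-%ℕ (proj₁ oS) s) (≈-trans (reflexive (cong (_·ℕ S) r)) (identityʳ S)))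
      ... | suc (suc _) | s≤s (s≤s ())
      sS≈ε : s · S ≈ ε
      sS≈ε with cases
      ... | inj₁ h = h
      ... | inj₂ h = ⊥-elim (disjoint ((ℤ.- t) ℤ÷.%ℕ suc n-1) (ℤ÷.n%ℕd<d (ℤ.- t) (suc n-1)) (begin
        ((ℤ.- t) ℤ÷.%ℕ suc n-1) ·ℕ T   ≈⟨ ·-%ℕ (proj₁ oT) (ℤ.- t) ⟨
        (ℤ.- t) · T                    ≈⟨ ·-homo-neg t T ⟩
        (t · T) ⁻¹                     ≈⟨ inverseˡ-unique (s · S) (t · T) torsion ⟨
        s · S                          ≈⟨ h ⟩
        S                              ∎))
      even : ∃[ k ] s ≡ k ℤ.* + 2
      even = exact-order oS s sS≈ε
      tT≈ε : t · T ≈ ε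
      tT≈ε = ≈-trans (≈-sym (identityˡ _)) (≈-trans (∙-congʳ (≈-sym sS≈ε)) torsion)

    odd-kernel-1 : ∀ {n-1 T P} → ExactOrder (suc n-1) T → Indivisible (P ∷ []) [] → TwoTorsion [] →
                   ∀ z → linear (zmod (suc n-1) ∷ zz ∷ []) (T , P , tt) z ≈ ε → Trivial (zmod (suc n-1) ∷ zz ∷ []) z
    odd-kernel-1 {P = P} o indiv tors (t , v , tt) e =
      let k , h = kernel-odd (P ∷ []) o indiv tors t (v ∷ []) e in k , cong Vec.head h , tt

    odd-kernel-2 : ∀ {n-1 T P Q} → ExactOrder (suc n-1) T → Indivisible (P ∷ Q ∷ []) [] → TwoTorsion [] →
                   ∀ z → linear (zmod (suc n-1) ∷ zz ∷ zz ∷ []) (T , P , Q , tt) z ≈ ε → Trivial (zmod (suc n-1) ∷ zz ∷ zz ∷ []) z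
    odd-kernel-2 {P = P} {Q} o indiv tors (t , v , w , tt) e =
      let k , h = kernel-odd (P ∷ Q ∷ []) o indiv tors t (v ∷ w ∷ []) e in k , cong Vec.head h , cong (λ u → Vec.head (Vec.tail u)) h , tt

    cyclic-kernel : ∀ {n-1 T P} → ExactOrder (suc n-1) T → Indivisible (P ∷ []) (T ∷ []) → TwoTorsion (T ∷ []) →
                    ∀ z → linear (zmod (suc n-1) ∷ zz ∷ []) (T , P , tt) z ≈ ε → Trivial (zmod (suc n-1) ∷ zz ∷ []) z
    cyclic-kernel o indiv tors (t , v , tt) e = let k , h = kernel-cyclic o indiv tors t v e in k , h , tt

    bicyclic-kernel : ∀ {n-1 S T P} → ExactOrder 2 S → ExactOrder (suc n-1) T → (∀ i → i < suc n-1 → ¬ (i ·ℕ T ≈ S)) →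
                      Indivisible (P ∷ []) (S ∷ T ∷ []) → TwoTorsion (S ∷ T ∷ []) →
                      ∀ z → linear (zmod 2 ∷ zmod (suc n-1) ∷ zz ∷ []) (S , T , P , tt) z ≈ ε → Trivial (zmod 2 ∷ zmod (suc n-1) ∷ zz ∷ []) z
    bicyclic-kernel oS oT disjoint indiv tors (s , t , v , tt) e =
      let k , l , h = kernel-bicyclic oS oT disjoint indiv tors s t v e in k , l , h , tt

-- Checkable certificates for sums, orders and 2-torsion

module PointCertificates where
  open import Defs
  open RingSolving
  open PowerSeries
  open GroupLaw
  open ResidueRings
  open SubgroupEmbeddings
  open import Data.Bool using (Bool; true; false; _∧_; not; if_then_else_)
  open import Data.Integer using (+_)
  open import Data.List using (List; []; _∷_; length)
  open import Data.Nat as ℕ using (ℕ; zero; suc; _≤_; _<_; z≤n; s≤s)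
  import Data.Nat.Properties as ℕₚ
  open import Data.Product using (_×_; _,_; proj₁; proj₂; ∃-syntax)
  open import Data.Sum using (_⊎_; inj₁; inj₂)
  open import Data.Unit using (tt)
  open import Data.Vec using ([]; _∷_)
  open import Relation.Nullary using (¬_; Dec; yes; no; does)
  open import Relation.Binary.PropositionalEquality using (_≡_; _≢_; refl; sym; trans; cong; cong₂; subst; module ≡-Reasoning)

  does-yes : ∀ {a} {P : Set a} (d : Dec P) → does d ≡ true → P
  does-yes (yes p) _ = p

  does-no : ∀ {a} {P : Set a} (d : Dec P) → not (does d) ≡ true → ¬ P
  does-no (no ¬p) _ = ¬p

  module Certificates (𝔽 : DecField) (g₂ g₁ g₀ : DecField.F 𝔽) where
    open DecField 𝔽
    open EllipticCurve 𝔽 g₂ g₁ g₀ public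

    on? : Pt → Bool
    on? O = true
    on? (aff x y) = does (y * y ≟ cubic-at x)

    on-sound : ∀ P → on? P ≡ true → On P
    on-sound O _ = tt
    on-sound (aff x y) h = does-yes (y * y ≟ cubic-at x) h

    third? : (Λ x₁ y₁ x₂ x₃ y₃ : F) → Bool
    third? Λ x₁ y₁ x₂ x₃ y₃ = does (x₃ ≟ third-x Λ x₁ x₂) ∧ does (y₃ ≟ third-y Λ x₁ y₁ x₃)

    -- sum? P Λ Q S: the line through P and Q (tangent, if P = Q) has slope Λ and P + Q = S
    sum? : Pt → F → Pt → Pt → Bool
    sum? (aff x₁ y₁) Λ (aff x₂ y₂) (aff x₃ y₃) =
      (if does (x₁ ≟ x₂)
       then does (y₁ ≟ y₂) ∧ (not (does (y₁ + y₁ ≟ 0F)) ∧ does (Λ * (y₁ + y₁) ≟ slope-at x₁))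
       else does (Λ * (x₂ - x₁) ≟ (y₂ - y₁)))
      ∧ third? Λ x₁ y₁ x₂ x₃ y₃
    sum? (aff x₁ y₁) Λ (aff x₂ y₂) O = does (x₁ ≟ x₂) ∧ does (y₂ ≟ (- y₁))
    sum? _ _ _ _ = false

    sum-sound : ∀ P Λ Q S → sum? P Λ Q S ≡ true → Sum P Q S
    sum-sound (aff x₁ y₁) Λ (aff x₂ y₂) (aff x₃ y₃) h with x₁ ≟ x₂
    ... | yes refl
        with refl ← does-yes (y₁ ≟ y₂) (∧-left (∧-left h))
           | h₁ ← ∧-right {does (y₁ ≟ y₂)} (∧-left h)
           | h₂ ← ∧-right {does (y₁ ≟ y₂) ∧ (not (does (y₁ + y₁ ≟ 0F)) ∧ does (Λ * (y₁ + y₁) ≟ slope-at x₁))} h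
        with refl ← does-yes (x₃ ≟ third-x Λ x₁ x₁) (∧-left h₂)
        with refl ← does-yes (y₃ ≟ third-y Λ x₁ y₁ x₃) (∧-right {does (x₃ ≟ third-x Λ x₁ x₁)} h₂)
        = tangent Λ (does-no (y₁ + y₁ ≟ 0F) (∧-left h₁)) (does-yes (Λ * (y₁ + y₁) ≟ slope-at x₁) (∧-right {not (does (y₁ + y₁ ≟ 0F))} h₁))
    ... | no x₁≢x₂
        with h₂ ← ∧-right {does (Λ * (x₂ - x₁) ≟ (y₂ - y₁))} h
        with refl ← does-yes (x₃ ≟ third-x Λ x₁ x₂) (∧-left h₂)
        with refl ← does-yes (y₃ ≟ third-y Λ x₁ y₁ x₃) (∧-right {does (x₃ ≟ third-x Λ x₁ x₂)} h₂)
        = chord Λ x₁≢x₂ (does-yes (Λ * (x₂ - x₁) ≟ (y₂ - y₁)) (∧-left h))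
    sum-sound (aff x₁ y₁) Λ (aff x₂ y₂) O h
      with refl ← does-yes (x₁ ≟ x₂) (∧-left h) | refl ← does-yes (y₂ ≟ (- y₁)) (∧-right {does (x₁ ≟ x₂)} h) = opposite

    record Step : Set where
      constructor step
      field
        slope x y : F

    -- the successive multiples of T after `current`, up to O
    chain? : Pt → Pt → List Step → Bool
    -- The slope `0F` is a placeholder: `sum?` reads no slope when the result is O.
    chain? T current []                 = sum? T 0F current O
    chain? T current (step Λ x y ∷ qs) = sum? T Λ current (aff x y) ∧ chain? T (aff x y) qs

    -- Off by one: started at T, entry j is (j + 1)T, and O is reached just past the end of the
    -- list.
    at : Pt → List Step → ℕ → Pt
    at current qs                zero    = current
    at current []                (suc j) = O
    at current (step Λ x y ∷ qs) (suc j) = at (aff x y) qs j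

    at-aff : ∀ x y qs j → j ≤ length qs → at (aff x y) qs j ≢ O
    at-aff x y qs zero _ ()
    at-aff x y (step Λ x′ y′ ∷ qs) (suc j) (s≤s l) = at-aff x′ y′ qs j l

    -- Comparing abscissas is enough to keep S = (e, 0) out of the multiples of T.
    avoids? : F → F → List Step → Bool
    avoids? e x []                  = not (does (x ≟ e))
    avoids? e x (step _ x′ _ ∷ qs) = not (does (x ≟ e)) ∧ avoids? e x′ qs

    avoids-sound : ∀ e x y qs → avoids? e x qs ≡ true → ∀ j {z} → at (aff x y) qs j ≢ aff e z
    avoids-sound e x y [] h zero refl = does-no (x ≟ e) h refl
    avoids-sound e x y (step _ _ _ ∷ qs) h zero refl = does-no (x ≟ e) (∧-left h) refl
    avoids-sound e x y (step _ x′ y′ ∷ qs) h (suc j) = avoids-sound e x′ y′ qs (∧-right {not (does (x ≟ e))} h) j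

    module Points (nonsingular : Nonsingular) where
      open Group nonsingular public
      open Embedding group public

      ⊕-identityʳ : ∀ P → P ⊕ 0E ≡ P
      ⊕-identityʳ P = trans (⊕-comm P 0E) (⊕-identityˡ P)

      chain-multiples : ∀ (T : EPt) current k qs → chain? (proj₁ T) current qs ≡ true → proj₁ (k ·ℕ T) ≡ current →
                        ∀ j → j ≤ suc (length qs) → proj₁ ((j ℕ.+ k) ·ℕ T) ≡ at current qs j
      chain-multiples T current k qs h e zero _ = e
      chain-multiples T current k [] h refl (suc zero) (s≤s z≤n) =
        sum-unique (proj₂ T) (proj₂ (k ·ℕ T)) (⊕-sum T (k ·ℕ T)) (sum-sound (proj₁ T) 0F current O h)
      chain-multiples T current k (step Λ x y ∷ qs) h refl (suc j) (s≤s l) =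
        trans (cong (λ i → proj₁ (i ·ℕ T)) (sym (ℕₚ.+-suc j k)))
          (chain-multiples T (aff x y) (suc k) qs (∧-right {sum? (proj₁ T) Λ current (aff x y)} h)
            (sum-unique (proj₂ T) (proj₂ (k ·ℕ T)) (⊕-sum T (k ·ℕ T)) (sum-sound (proj₁ T) Λ current (aff x y) (∧-left h))) j l)

      module Torsion (x y : F) (on : On (aff x y)) (qs : List Step) (h : chain? (aff x y) (aff x y) qs ≡ true) where
        T : EPt
        T = aff x y , on

        -- The list holds 2T, ..., (n - 1)T, that is n - 2 points; T and O account for the other
        -- two.
        order : ℕ
        order = suc (suc (length qs))

        multiples : ∀ j → j ≤ suc (length qs) → proj₁ (suc j ·ℕ T) ≡ at (aff x y) qs j
        multiples j l = trans (cong (λ i → proj₁ (i ·ℕ T)) (sym (ℕₚ.+-comm j 1)))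
          (chain-multiples T (aff x y) 1 qs h (cong proj₁ (⊕-identityʳ T)) j l)

        at-end : ∀ c qs → at c qs (suc (length qs)) ≡ O
        at-end c [] = refl
        at-end c (step _ _ _ ∷ qs) = at-end _ qs

        exact : ExactOrder order T
        exact = EPt-≡ (trans (multiples (suc (length qs)) ℕₚ.≤-refl) (at-end (aff x y) qs))
              , λ { (suc i) _ (s≤s i<) e → at-aff x y qs i (ℕ.s≤s⁻¹ i<) (trans (sym (multiples i (ℕₚ.<⇒≤ i<))) (cong proj₁ e)) }

        avoids : ∀ {e z} (onS : On (aff e z)) → avoids? e x qs ≡ true → ∀ i → i < order → ¬ (i ·ℕ T ≡ (aff e z , onS))
        avoids onS av zero _ h with () ← cong proj₁ h
        avoids {e} onS av (suc i) (s≤s i<) h = avoids-sound e x y qs av i (trans (sym (multiples i (ℕₚ.<⇒≤ i<))) (cong proj₁ h))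

      Unhalved : EPt → Set
      Unhalved Q = ∀ R → R ⊕ R ≢ Q

      -- `select` closes every subsum with ε, hence the neutral summands here and in `last-two`.
      sum-of : ∀ P Q S → Sum (proj₁ P) (proj₁ Q) (proj₁ S) → (P ⊕ 0E) ⊕ (Q ⊕ 0E) ≡ S
      sum-of P Q S s = trans (cong₂ _⊕_ (⊕-identityʳ P) (⊕-identityʳ Q)) (⊕-unique {P} {Q} {S} s)

      last-two : ∀ P Q S → Sum (proj₁ P) (proj₁ Q) (proj₁ S) → P ⊕ (Q ⊕ 0E) ≡ S
      last-two P Q S s = trans (cong (P ⊕_) (⊕-identityʳ Q)) (⊕-unique {P} {Q} {S} s)

      indivisible-1-0 : ∀ {P} → Unhalved P → Indivisible (P ∷ []) []
      indivisible-1-0 {P} u (true ∷ []) [] _ R e = u R (trans e (trans (⊕-identityʳ _) (⊕-identityʳ P)))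
      indivisible-1-0 u (false ∷ []) [] ()

      indivisible-2-0 : ∀ {P Q PQ} → Sum (proj₁ P) (proj₁ Q) (proj₁ PQ) → Unhalved P → Unhalved Q → Unhalved PQ → Indivisible (P ∷ Q ∷ []) []
      indivisible-2-0 {P} {Q} {PQ} s u v w (true ∷ true ∷ []) [] _ R e =
        w R (trans e (trans (⊕-identityʳ _) (last-two P Q PQ s)))
      indivisible-2-0 {P} s u v w (true ∷ false ∷ []) [] _ R e = u R (trans e (trans (⊕-identityʳ _) (⊕-identityʳ P)))
      indivisible-2-0 {Q = Q} s u v w (false ∷ true ∷ []) [] _ R e = v R (trans e (trans (⊕-identityʳ _) (⊕-identityʳ Q)))
      indivisible-2-0 s u v w (false ∷ false ∷ []) [] ()

      indivisible-1-1 : ∀ {P T PT} → Sum (proj₁ P) (proj₁ T) (proj₁ PT) → Unhalved P → Unhalved T → Unhalved PT → Indivisible (P ∷ []) (T ∷ [])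
      indivisible-1-1 {P} {T} {PT} s u v w (true ∷ []) (true ∷ []) _ R e = w R (trans e (sum-of P T PT s))
      indivisible-1-1 {P} s u v w (true ∷ []) (false ∷ []) _ R e = u R (trans e (trans (⊕-identityʳ _) (⊕-identityʳ P)))
      indivisible-1-1 {T = T} s u v w (false ∷ []) (true ∷ []) _ R e = v R (trans e (trans (⊕-identityˡ _) (⊕-identityʳ T)))
      indivisible-1-1 s u v w (false ∷ []) (false ∷ []) ()

      -- Three generators have seven nonempty subsums, and each needs its own obstruction to
      -- halving.
      indivisible-1-2 : ∀ {P S T PS PT ST PST} →
        Sum (proj₁ P) (proj₁ S) (proj₁ PS) → Sum (proj₁ P) (proj₁ T) (proj₁ PT) → Sum (proj₁ S) (proj₁ T) (proj₁ ST) → Sum (proj₁ P) (proj₁ ST) (proj₁ PST) →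
        Unhalved P → Unhalved S → Unhalved T → Unhalved PS → Unhalved PT → Unhalved ST → Unhalved PST → Indivisible (P ∷ []) (S ∷ T ∷ [])
      indivisible-1-2 {P} {S} {T} {PS} {PT} {ST} {PST} ps pt st pst uP uS uT uPS uPT uST uPST = λ where
        (true ∷ []) (true ∷ true ∷ []) _ R e → uPST R (trans e (trans (cong₂ _⊕_ (⊕-identityʳ P) (last-two S T ST st)) (⊕-unique {P} {ST} {PST} pst)))
        (true ∷ []) (true ∷ false ∷ []) _ R e → uPS R (trans e (sum-of P S PS ps))
        (true ∷ []) (false ∷ true ∷ []) _ R e → uPT R (trans e (sum-of P T PT pt))
        (true ∷ []) (false ∷ false ∷ []) _ R e → uP R (trans e (trans (⊕-identityʳ _) (⊕-identityʳ P)))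
        (false ∷ []) (true ∷ true ∷ []) _ R e → uST R (trans e (trans (⊕-identityˡ _) (last-two S T ST st)))
        (false ∷ []) (true ∷ false ∷ []) _ R e → uS R (trans e (trans (⊕-identityˡ _) (⊕-identityʳ S)))
        (false ∷ []) (false ∷ true ∷ []) _ R e → uT R (trans e (trans (⊕-identityˡ _) (⊕-identityʳ T)))
        (false ∷ []) (false ∷ false ∷ []) ()

      halves-of-O : ∀ R → R ⊕ R ≡ 0E → R ≡ 0E ⊎ ∃[ x ] (cubic-at x ≡ 0F × proj₁ R ≡ aff x 0F)
      halves-of-O (O , tt) _ = inj₁ refl
      halves-of-O R@(aff x y , on) e with two-torsion on (subst (Sum (aff x y) (aff x y)) (cong proj₁ e) (⊕-sum R R))
      ... | refl , c = inj₂ (x , c , refl)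

      half-root : ∀ {X Y} (onQ : On (aff X Y)) R → R ⊕ R ≡ (aff X Y , onQ) →
                  ∃[ x ] x * x * x * x - (g₁ + g₁) * (x * x) - (g₀ + g₀ + g₀ + g₀ + g₀ + g₀ + g₀ + g₀) * x + (g₁ * g₁ - (g₂ + g₂ + g₂ + g₂) * g₀)
                         ≡ (X + X + X + X) * cubic-at x
      half-root onQ (O , tt) e with () ← cong proj₁ (trans (sym (⊕-identityˡ 0E)) e)
      half-root onQ R@(aff x y , on) e = x , halving on (subst (Sum (aff x y) (aff x y)) (cong proj₁ e) (⊕-sum R R))

    -- The quadratic is the quotient of the cubic by X - e.
    root-of-quadratic : ∀ {e x} → cubic-at e ≡ 0F → cubic-at x ≡ 0F → x ≢ e → x * x + (g₂ + e) * x + (g₁ + e * (g₂ + e)) ≡ 0F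
    root-of-quadratic {e} {x} he hx x≢e = cancelˡ (x - e) (λ h → x≢e (-≡0⇒≡ h)) (begin
      (x - e) * (x * x + (g₂ + e) * x + (g₁ + e * (g₂ + e)))
        ≡⟨ solve 5 (λ x e g₂ g₁ g₀ → (x :- e) :* (x :* x :+ (g₂ :+ e) :* x :+ (g₁ :+ e :* (g₂ :+ e)))
             := (x :* x :* x :+ g₂ :* (x :* x) :+ g₁ :* x :+ g₀) :- (e :* e :* e :+ g₂ :* (e :* e) :+ g₁ :* e :+ g₀)) refl x e g₂ g₁ g₀ ⟩
      cubic-at x - cubic-at e    ≡⟨ cong₂ _-_ hx he ⟩
      0F - 0F                    ≡⟨ -‿inverseʳ 0F ⟩
      0F                         ∎)
      where open ≡-Reasoning

    -- Vieta: two roots x and e′ of the same quadratic have sum -(g₂ + e), seen by subtracting its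
    -- values and cancelling x - e′.
    third-root : ∀ {e e′ x} → cubic-at e ≡ 0F → cubic-at e′ ≡ 0F → e′ ≢ e → cubic-at x ≡ 0F → x ≢ e → x ≢ e′ → x ≡ - g₂ - e - e′
    third-root {e} {e′} {x} he he′ e′≢e hx x≢e x≢e′ = -≡0⇒≡ (cancelˡ (x - e′) (λ h → x≢e′ (-≡0⇒≡ h)) (begin
      (x - e′) * (x - (- g₂ - e - e′))
        ≡⟨ solve 5 (λ x e e′ g₂ g₁ → (x :- e′) :* (x :- (:- g₂ :- e :- e′))
             := (x :* x :+ (g₂ :+ e) :* x :+ (g₁ :+ e :* (g₂ :+ e))) :- (e′ :* e′ :+ (g₂ :+ e) :* e′ :+ (g₁ :+ e :* (g₂ :+ e)))) refl x e e′ g₂ g₁ ⟩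
      _ ≡⟨ cong₂ _-_ (root-of-quadratic he hx x≢e) (root-of-quadratic he he′ e′≢e) ⟩
      0F - 0F   ≡⟨ -‿inverseʳ 0F ⟩
      0F        ∎))
      where open ≡-Reasoning

-- Curves over K with coefficients in ℤ[α]

module IntegralModels where
  open import Defs
  open RingSolving
  open CubicFields
  open PowerSeries
  open ResidueRings
  open PointCertificates
  open import Algebra.Bundles using (CommutativeRing)
  open import Data.Bool using (Bool; true; _∧_; not)
  open import Data.Integer using (ℤ; +_; -[1+_])
  open import Data.List using (List; []; _∷_; map)
  open import Data.List.Relation.Binary.Pointwise using (Pointwise; []; _∷_)
  open import Data.Nat using (ℕ)
  open import Data.Product using (_,_; proj₁; proj₂)
  open import Data.Rational as ℚ using (ℚ; 0ℚ; 1ℚ)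
  import Data.Rational.Properties as ℚₚ
  open import Data.Unit using (tt)
  open import Data.Vec using ([]; _∷_)
  open import Relation.Nullary using (does)
  open import Relation.Binary.PropositionalEquality using (_≡_; _≢_; refl; sym; trans; cong; cong₂; subst; module ≡-Reasoning)

  open RingSolver ℚₚ.+-*-commutativeRing using () renaming (solve to solveℚ)

  -- A root of f modulo p is a root in every factor of (ℤ/p)[x]/(x³ − x).
  irreducible? : (A B C : ℤ) (p-2 : ℕ) → Bool
  irreducible? A B C p-2 = R.rootless (⟪ R.residue A , 0 , 0 ⟫ ∷ ⟪ R.residue B , 0 , 0 ⟫ ∷ ⟪ R.residue C , 0 , 0 ⟫ ∷ []) ∧ R.invertibles
    where module R = Residues (+ 0) -[1+ 0 ] (+ 0) p-2

  -- A factor x + r gives the rational root -r. The search cannot run in ℚ[x]/(f), where f acquires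
  -- the root α. It runs in the algebra ℚ[x]/(x³ - x): `no-root` does not ask for a field, and
  -- modulo an odd prime this algebra is three copies of ℤ/p, which has no nilpotents.
  irreducible-sound : ∀ A B C p-2 → irreducible? A B C p-2 ≡ true → Irreducible (integral A B C)
  irreducible-sound A B C p-2 ok (r , s , t , e₁ , e₂ , e₃) =
    R.no-root (R.red-ι A (+ 0) (+ 0) ∷ R.red-ι B (+ 0) (+ 0) ∷ R.red-ι C (+ 0) (+ 0) ∷ []) (∧-left ok)
      (∧-right {R.rootless (⟪ R.residue A , 0 , 0 ⟫ ∷ ⟪ R.residue B , 0 , 0 ⟫ ∷ ⟪ R.residue C , 0 , 0 ⟫ ∷ [])} ok)
      (emb (ℚ.- r)) root
    where
    module R = Residues (+ 0) -[1+ 0 ] (+ 0) p-2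
    open Field R.f
    open KRing R.f
    emb-* : ∀ q r → emb q *K emb r ≡ emb (q ℚ.* r)
    emb-* q r = trans (*K-emb q r 0ℚ 0ℚ) (K-≡ refl (ℚₚ.*-zeroʳ q) (ℚₚ.*-zeroʳ q))
    value : ℚ → ℚ
    value x = ((1ℚ ℚ.* x ℚ.+ fromℤ A) ℚ.* x ℚ.+ fromℤ B) ℚ.* x ℚ.+ fromℤ C
    horner-emb : ∀ x → R.horner (emb x) (emb (fromℤ A) ∷ emb (fromℤ B) ∷ emb (fromℤ C) ∷ []) 1K ≡ emb (value x)
    horner-emb x = begin
      ((emb 1ℚ *K emb x +K emb (fromℤ A)) *K emb x +K emb (fromℤ B)) *K emb x +K emb (fromℤ C)
        ≡⟨ cong (λ u → ((u +K emb (fromℤ A)) *K emb x +K emb (fromℤ B)) *K emb x +K emb (fromℤ C)) (emb-* 1ℚ x) ⟩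
      (emb v₁ *K emb x +K emb (fromℤ B)) *K emb x +K emb (fromℤ C)
        ≡⟨ cong (λ u → (u +K emb (fromℤ B)) *K emb x +K emb (fromℤ C)) (emb-* v₁ x) ⟩
      emb v₂ *K emb x +K emb (fromℤ C)
        ≡⟨ cong (_+K emb (fromℤ C)) (emb-* v₂ x) ⟩
      emb (value x) ∎
      where
      open ≡-Reasoning
      v₁ v₂ : ℚ
      v₁ = 1ℚ ℚ.* x ℚ.+ fromℤ A
      v₂ = v₁ ℚ.* x ℚ.+ fromℤ B
    value≡0 : value (ℚ.- r) ≡ 0ℚ
    value≡0 = trans (cong₂ (λ u v → ((1ℚ ℚ.* (ℚ.- r) ℚ.+ u) ℚ.* (ℚ.- r) ℚ.+ v) ℚ.* (ℚ.- r) ℚ.+ fromℤ C) (sym e₁) (sym e₂))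
      (trans (cong (λ u → ((1ℚ ℚ.* (ℚ.- r) ℚ.+ (r ℚ.+ s)) ℚ.* (ℚ.- r) ℚ.+ (r ℚ.* s ℚ.+ t)) ℚ.* (ℚ.- r) ℚ.+ u) (sym e₃))
        (solveℚ 3 (λ r s t → ((:1 :* (:- r) :+ (r :+ s)) :* (:- r) :+ (r :* s :+ t)) :* (:- r) :+ r :* t := num 0) refl r s t))
    root : R.horner (emb (ℚ.- r)) (emb (fromℤ A) ∷ emb (fromℤ B) ∷ emb (fromℤ C) ∷ []) 1K ≡ 0K
    root = trans (horner-emb (ℚ.- r)) (cong emb value≡0)

  record ℤ³ : Set where
    constructor [_,_,_]
    field z0 z1 z2 : ℤ

  record ℤPt : Set where
    constructor ⦅_,_⦆
    field X Y : ℤ³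

  record ℤStep : Set where
    constructor ℤstep
    field slope x y : ℤ³

  module OverK (A B C : ℤ) (irr : Irreducible (integral A B C)) (G₂ G₁ G₀ : ℤ³) where
    f : MonicCubic
    f = integral A B C
    open Field f
    open KRing f

    𝕂 : DecField
    𝕂 = record
      { F = K f ; _+_ = _+K_ ; _*_ = _*K_ ; -_ = λ p → -K p ; 0F = 0K ; 1F = 1K
      ; isCommutativeRing = CommutativeRing.isCommutativeRing K-commutativeRing
      ; _≟_ = _≟K_
      ; inverse = K-inverse irr
      ; 2≢0 = λ e → 2ℚ≢0 (cong k0 e) }
      where
      2ℚ≢0 : 1ℚ ℚ.+ 1ℚ ≢ 0ℚ
      2ℚ≢0 ()

    el : ℤ³ → K f
    el [ x , y , z ] = ⟨ fromℤ x , fromℤ y , fromℤ z ⟩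

    g₂ g₁ g₀ : K f
    g₂ = el G₂
    g₁ = el G₁
    g₀ = el G₀

    open Certificates 𝕂 g₂ g₁ g₀ public
    private module S = RingSolver K-commutativeRing
    open S using (solve)

    𝓔 : Weierstrass f
    𝓔 = weierstrass 0K g₂ 0K g₁ g₀
    private module C = Curve 𝓔

    point : Pt → C.Point
    point O = C.O
    point (aff x y) = C.aff x y

    point-injective : ∀ P Q → point P ≡ point Q → P ≡ Q
    point-injective O O _ = refl
    point-injective (aff x y) (aff .x .y) refl = refl

    point-on : ∀ P → On P → C.OnCurve (point P)
    point-on O _ = tt
    point-on (aff x y) on = begin
      y *K y +K 0K *K x *K y +K 0K *K y                        ≡⟨ solve 2 (λ x y → y :* y :+ num 0 :* x :* y :+ num 0 :* y := y :* y) refl x y ⟩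
      y *K y                                                   ≡⟨ on ⟩
      x *K x *K x +K g₂ *K (x *K x) +K g₁ *K x +K g₀           ≡⟨ solve 4 (λ x g₂ g₁ g₀ → x :* x :* x :+ g₂ :* (x :* x) :+ g₁ :* x :+ g₀ := x :* x :* x :+ g₂ :* x :* x :+ g₁ :* x :+ g₀) refl x g₂ g₁ g₀ ⟩
      x *K x *K x +K g₂ *K x *K x +K g₁ *K x +K g₀             ∎
      where open ≡-Reasoning

    third-x-Defs : ∀ Λ x₁ x₂ → C.x₃ Λ x₁ x₂ ≡ third-x Λ x₁ x₂
    third-x-Defs Λ x₁ x₂ = solve 4 (λ Λ x₁ x₂ g₂ → Λ :* Λ :+ num 0 :* Λ :- g₂ :- x₁ :- x₂ := Λ :* Λ :- g₂ :- x₁ :- x₂) refl Λ x₁ x₂ g₂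

    third-y-Defs : ∀ Λ x₁ y₁ x₃ → C.y₃ Λ x₁ y₁ x₃ ≡ third-y Λ x₁ y₁ x₃
    third-y-Defs Λ x₁ y₁ x₃ = solve 4 (λ Λ x₁ y₁ x₃ → :- ((Λ :+ num 0) :* x₃) :- (y₁ :- Λ :* x₁) :- num 0 := :- (y₁ :+ Λ :* (x₃ :- x₁))) refl Λ x₁ y₁ x₃

    third-Defs : ∀ Λ x₁ y₁ x₂ → C.aff (C.x₃ Λ x₁ x₂) (C.y₃ Λ x₁ y₁ (C.x₃ Λ x₁ x₂)) ≡ point (aff (third-x Λ x₁ x₂) (third-y Λ x₁ y₁ (third-x Λ x₁ x₂)))
    third-Defs Λ x₁ y₁ x₂ = cong₂ C.aff (third-x-Defs Λ x₁ x₂)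
      (trans (third-y-Defs Λ x₁ y₁ (C.x₃ Λ x₁ x₂)) (cong (third-y Λ x₁ y₁) (third-x-Defs Λ x₁ x₂)))

    negY-Defs : ∀ x y → -K y ≡ C.negY x y
    negY-Defs x y = solve 2 (λ x y → :- y := :- y :- num 0 :* x :- num 0) refl x y

    sum-Add : ∀ {P Q R} → Sum P Q R → C.Add (point P) (point Q) (point R)
    sum-Add {Q = Q} O-left = C.O-left (point Q)
    sum-Add {P = P} O-right = C.O-right (point P)
    sum-Add (opposite {x} {y}) = C.inverse refl (negY-Defs x y)
    sum-Add (chord {x₁} {y₁} {x₂} {y₂} Λ x₁≢x₂ e) =
      subst (C.Add (C.aff x₁ y₁) (C.aff x₂ y₂)) (third-Defs Λ x₁ y₁ x₂) (C.chord Λ x₁≢x₂ e)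
    sum-Add (tangent {x} {y} Λ 2y≢0 e) =
      subst (C.Add (C.aff x y) (C.aff x y)) (third-Defs Λ x y x) (C.tangent Λ not-2-torsion slope)
      where
      not-2-torsion : y ≢ C.negY x y
      not-2-torsion h = 2y≢0 (trans (cong (y +K_) (trans h (sym (negY-Defs x y)))) (trans (+K-comm y (-K y)) (-K-inverseˡ y)))
      slope : Λ *K (nat 2 *K y +K 0K *K x +K 0K) ≡ nat 3 *K x *K x +K nat 2 *K g₂ *K x +K g₁ -K 0K *K y
      slope = begin
        Λ *K (nat 2 *K y +K 0K *K x +K 0K)    ≡⟨ solve 3 (λ Λ x y → Λ :* (num 2 :* y :+ num 0 :* x :+ num 0) := Λ :* (y :+ y)) refl Λ x y ⟩
        Λ *K (y +K y)                         ≡⟨ e ⟩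
        slope-at x                            ≡⟨ solve 4 (λ x y g₂ g₁ → x :* x :+ x :* x :+ x :* x :+ g₂ :* (x :+ x) :+ g₁
                                                    := num 3 :* x :* x :+ num 2 :* g₂ :* x :+ g₁ :- num 0 :* y) refl x y g₂ g₁ ⟩
        nat 3 *K x *K x +K nat 2 *K g₂ *K x +K g₁ -K 0K *K y ∎
        where open ≡-Reasoning

    module Modulo (p-2 : ℕ) where
      open Residues A B C p-2 hiding (f; ι) public

      res : ℤ³ → Triple
      res [ x , y , z ] = ⟪ residue x , residue y , residue z ⟫

      red-el : ∀ v → Red (el v) (res v)
      red-el [ x , y , z ] = red-ι x y z

      private
        4-fold : Triple → Triple
        4-fold n = n ⊞₃ n ⊞₃ n ⊞₃ n

        red-4 : ∀ {z n} → Red z n → Red (z +K z +K z +K z) (4-fold n)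
        red-4 r = red-+ (red-+ (red-+ r r) r) r

      cubic₃ : List Triple
      cubic₃ = res G₂ ∷ res G₁ ∷ res G₀ ∷ []

      quadratic₃ : ℤ³ → List Triple
      quadratic₃ e = res G₂ ⊞₃ res e ∷ res G₁ ⊞₃ res e ⊠₃ (res G₂ ⊞₃ res e) ∷ []

      -- The quartic of `halving` minus 4X·g, below its leading term. The bracketing is that of the
      -- derivation of `Red` in `quartic-rootless`, which must arrive at these residues literally.
      quartic₃ : ℤ³ → List Triple
      quartic₃ X = neg₃ x
        ∷ neg₃ (res G₁ ⊞₃ res G₁) ⊞₃ neg₃ (x ⊠₃ res G₂)
        ∷ neg₃ (4-fold (res G₀) ⊞₃ 4-fold (res G₀)) ⊞₃ neg₃ (x ⊠₃ res G₁)
        ∷ res G₁ ⊠₃ res G₁ ⊞₃ neg₃ (4-fold (res G₂) ⊠₃ res G₀) ⊞₃ neg₃ (x ⊠₃ res G₀)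
        ∷ []
        where x = 4-fold (res X)

      rootless? : List Triple → Bool
      rootless? cs = rootless cs ∧ invertibles

      no-root′ : ∀ {cs} ns → Pointwise Red cs ns → rootless? ns ≡ true → ∀ x → horner x cs 1K ≢ 0K
      no-root′ ns rs ok = no-root rs (∧-left ok) (∧-right {rootless ns} ok)

      cubic-rootless : rootless? cubic₃ ≡ true → ∀ x → cubic-at x ≢ 0K
      cubic-rootless ok x h = no-root′ cubic₃ (red-el G₂ ∷ red-el G₁ ∷ red-el G₀ ∷ []) ok x
        (trans (solve 4 (λ x g₂ g₁ g₀ → ((:1 :* x :+ g₂) :* x :+ g₁) :* x :+ g₀ := x :* x :* x :+ g₂ :* (x :* x) :+ g₁ :* x :+ g₀) refl x g₂ g₁ g₀) h)

      quadratic-rootless : ∀ e → rootless? (quadratic₃ e) ≡ true → ∀ x → x *K x +K (g₂ +K el e) *K x +K (g₁ +K el e *K (g₂ +K el e)) ≢ 0K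
      quadratic-rootless e ok x h = no-root′ (quadratic₃ e) (u ∷ red-+ (red-el G₁) (red-* (red-el e) u) ∷ []) ok x
        (trans (solve 3 (λ x u v → (:1 :* x :+ u) :* x :+ v := x :* x :+ u :* x :+ v) refl x (g₂ +K el e) (g₁ +K el e *K (g₂ +K el e))) h)
        where u = red-+ (red-el G₂) (red-el e)

      quartic-rootless : ∀ X → rootless? (quartic₃ X) ≡ true → ∀ x →
        x *K x *K x *K x -K (g₁ +K g₁) *K (x *K x) -K (g₀ +K g₀ +K g₀ +K g₀ +K g₀ +K g₀ +K g₀ +K g₀) *K x +K (g₁ *K g₁ -K (g₂ +K g₂ +K g₂ +K g₂) *K g₀)
        ≢ (el X +K el X +K el X +K el X) *K cubic-at x
      quartic-rootless X ok x h = no-root′ (quartic₃ X)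
        (red-neg rx ∷ red-+ (red-neg (red-+ (red-el G₁) (red-el G₁))) (red-neg (red-* rx (red-el G₂)))
        ∷ red-+ (red-neg (red-+ (red-4 (red-el G₀)) (red-4 (red-el G₀)))) (red-neg (red-* rx (red-el G₁)))
        ∷ red-+ (red-+ (red-* (red-el G₁) (red-el G₁)) (red-neg (red-* (red-4 (red-el G₂)) (red-el G₀)))) (red-neg (red-* rx (red-el G₀)))
        ∷ []) ok x
        (trans (solve 5 (λ x X g₂ g₁ g₀ → let X₄ = X :+ X :+ X :+ X in
            (((:1 :* x :+ :- X₄) :* x :+ (:- (g₁ :+ g₁) :+ :- (X₄ :* g₂))) :* x :+ (:- ((g₀ :+ g₀ :+ g₀ :+ g₀) :+ (g₀ :+ g₀ :+ g₀ :+ g₀)) :+ :- (X₄ :* g₁))) :* x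
              :+ (g₁ :* g₁ :+ :- ((g₂ :+ g₂ :+ g₂ :+ g₂) :* g₀) :+ :- (X₄ :* g₀))
            := (x :* x :* x :* x :- (g₁ :+ g₁) :* (x :* x) :- (g₀ :+ g₀ :+ g₀ :+ g₀ :+ g₀ :+ g₀ :+ g₀ :+ g₀) :* x :+ (g₁ :* g₁ :- (g₂ :+ g₂ :+ g₂ :+ g₂) :* g₀))
               :- X₄ :* (x :* x :* x :+ g₂ :* (x :* x) :+ g₁ :* x :+ g₀)) refl x (el X) g₂ g₁ g₀)
          (DecField.≡⇒-≡0 𝕂 h))
        where rx = red-4 (red-el X)

    pt : ℤPt → Pt
    pt ⦅ X , Y ⦆ = aff (el X) (el Y)

    steps : List ℤStep → List Step
    steps = map λ (ℤstep Λ x y) → step (el Λ) (el x) (el y)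

    Adds : ℤPt → ℤ³ → ℤPt → ℤPt → Set
    Adds P Λ Q S = sum? (pt P) (el Λ) (pt Q) (pt S) ≡ true

    Obstructed : ℕ → ℤPt → Set
    Obstructed p-2 Q = Modulo.rootless? p-2 (Modulo.quartic₃ p-2 (ℤPt.X Q)) ≡ true

    -- Each point carries its own prime p = 2 + p-2, since no single prime is required to serve all
    -- subsums.
    record Undivided : Set where
      constructor undivided
      field
        Q : ℤPt
        on : on? (pt Q) ≡ true
        p-2 : ℕ
        obstructed : Obstructed p-2 Q

    module Realization (nonsingular : Nonsingular) where
      open Points nonsingular public

      ept : (Q : ℤPt) → on? (pt Q) ≡ true → EPt
      ept Q on = pt Q , on-sound (pt Q) on

      unhalved : ∀ p-2 Q on → Obstructed p-2 Q → Unhalved (ept Q on)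
      unhalved p-2 ⦅ X , Y ⦆ on ok R e = let x , h = half-root (on-sound (pt ⦅ X , Y ⦆) on) R e in Modulo.quartic-rootless p-2 X ok x h

      ⟦_⟧ : Undivided → EPt
      ⟦ W ⟧ = ept (Undivided.Q W) (Undivided.on W)

      ⟦_⟧-unhalved : ∀ W → Unhalved ⟦ W ⟧
      ⟦ undivided Q on p-2 ok ⟧-unhalved = unhalved p-2 Q on ok

      adds : ∀ {P Q S} Λ → Adds P Λ Q S → Sum (pt P) (pt Q) (pt S)
      adds {P} {Q} {S} Λ = sum-sound (pt P) (el Λ) (pt Q) (pt S)

      realize : ∀ φs (γs : Generators φs) → Orders φs γs → (∀ z → linear φs γs z ≡ 0E → Trivial φs z) →
                not (does (C.Δ ≟K 0K)) ≡ true → CubicRealizable φs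
      realize φs γs orders kernel Δ≢0 = f , irr , (𝓔 , does-no (C.Δ ≟K 0K) Δ≢0)
        , (λ g → point (proj₁ (embed φs γs g)))
        , (λ g → point-on _ (proj₂ (embed φs γs g)))
        , (λ g g′ → subst (λ R → C.Add _ _ (point (proj₁ R))) (embed-homo φs γs orders g g′) (sum-Add (⊕-sum (embed φs γs g) (embed φs γs g′))))
        , (λ g g′ e → embed-injective φs γs kernel g g′ (EPt-≡ (point-injective _ _ e)))

-- Three shapes: the cubic has no root, one root or three roots in K

module SubgroupShapes where
  open import Defs
  open CubicFields using (module KRing)
  open PowerSeries
  open ResidueRings
  open PointCertificates
  open IntegralModels
  open import Data.Bool as Bool using (Bool; true; not)
  open import Data.Integer using (ℤ; +_)
  open import Data.List using (List; []; _∷_; length)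
  open import Data.Nat as ℕ using (ℕ; suc)
  import Data.Nat.Properties as ℕₚ
  open import Data.Product using (_×_; _,_; proj₁; proj₂; ∃-syntax)
  open import Data.Sum using (_⊎_; inj₁; inj₂; [_,_]′)
  open import Data.Unit using (tt)
  open import Data.Vec using ([]; _∷_)
  open import Data.Empty using (⊥-elim)
  open import Relation.Nullary using (Dec; yes; no; does)
  open import Relation.Binary.PropositionalEquality using (_≡_; _≢_; refl; sym; trans; cong; cong₂; subst)

  module Shapes (A B C : ℤ) (irr : Irreducible (integral A B C)) (G₂ G₁ G₀ : ℤ³) where
    open OverK A B C irr G₂ G₁ G₀ public
    open Field f using (0K; _+K_; _*K_; _-K_; -K_)
    open KRing f using (_≟K_)
    open DecField 𝕂 using (zeroˡ)
    private
      module C = Curve 𝓔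
      module U = Undivided

    Δ? : Bool
    Δ? = not (does (C.Δ ≟K 0K))

    on-axis : ∀ x → On (aff x 0K) → cubic-at x ≡ 0K
    on-axis x on = trans (sym on) (zeroˡ 0K)

    module Odd (q-2 : ℕ) (ok : Modulo.rootless? q-2 (Modulo.cubic₃ q-2) ≡ true) where
      nonsingular : Nonsingular
      -- Vacuous: a cubic without roots in K leaves no point with y = 0.
      nonsingular x on = ⊥-elim (Modulo.cubic-rootless q-2 ok x (on-axis x on))

      open Realization nonsingular public

      no-two-torsion : TwoTorsion []
      no-two-torsion R e = [ (λ R≡0 → [] , R≡0) , (λ (x , h , _) → ⊥-elim (Modulo.cubic-rootless q-2 ok x h)) ]′ (halves-of-O R e)

      module _ (T : ℤPt) (onT : on? (pt T) ≡ true) (qs : List ℤStep) (chain : chain? (pt T) (pt T) (steps qs) ≡ true) (Δ≢0 : Δ? ≡ true) where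
        open Torsion (el (ℤPt.X T)) (el (ℤPt.Y T)) (on-sound (pt T) onT) (steps qs) chain using (order; exact) renaming (T to T′)

        rank-1 : Undivided → CubicRealizable (zmod order ∷ zz ∷ [])
        rank-1 P = realize (zmod order ∷ zz ∷ []) (T′ , ⟦ P ⟧ , tt) (proj₁ exact , tt)
          (odd-kernel-1 {suc (length (steps qs))} {T′} {⟦ P ⟧} exact (indivisible-1-0 {⟦ P ⟧} ⟦ P ⟧-unhalved) no-two-torsion) Δ≢0

        rank-2 : (P Q PQ : Undivided) (Λ : ℤ³) → Adds (U.Q P) Λ (U.Q Q) (U.Q PQ) → CubicRealizable (zmod order ∷ zz ∷ zz ∷ [])
        rank-2 P Q PQ Λ s = realize (zmod order ∷ zz ∷ zz ∷ []) (T′ , ⟦ P ⟧ , ⟦ Q ⟧ , tt) (proj₁ exact , tt)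
          (odd-kernel-2 {suc (length (steps qs))} {T′} {⟦ P ⟧} {⟦ Q ⟧} exact
            (indivisible-2-0 {⟦ P ⟧} {⟦ Q ⟧} {⟦ PQ ⟧} (adds {U.Q P} {U.Q Q} {U.Q PQ} Λ s) ⟦ P ⟧-unhalved ⟦ Q ⟧-unhalved ⟦ PQ ⟧-unhalved)
            no-two-torsion) Δ≢0

    module Cyclic (e : ℤ³) (root : does (cubic-at (el e) ≟K 0K) ≡ true) (simple : not (does (slope-at (el e) ≟K 0K)) ≡ true)
                  (q-2 : ℕ) (ok : Modulo.rootless? q-2 (Modulo.quadratic₃ q-2 e) ≡ true) where
      -- Any other root would be a root of the quadratic left after division by X - e, which has
      -- none modulo q.
      only-root : ∀ x → cubic-at x ≡ 0K → x ≡ el e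
      only-root x h = decide (x ≟K el e)
        where
        decide : Dec (x ≡ el e) → x ≡ el e
        decide (yes p) = p
        decide (no x≢e) = ⊥-elim (Modulo.quadratic-rootless q-2 e ok x (root-of-quadratic (does-yes (cubic-at (el e) ≟K 0K) root) h x≢e))

      nonsingular : Nonsingular
      nonsingular x on = subst (λ x → slope-at x ≢ 0K) (sym (only-root x (on-axis x on))) (does-no (slope-at (el e) ≟K 0K) simple)

      open Realization nonsingular public

      module _ (T : ℤPt) (onT : on? (pt T) ≡ true) (qs : List ℤStep) (chain : chain? (pt T) (pt T) (steps qs) ≡ true) (Δ≢0 : Δ? ≡ true)
               (j : ℕ) (j≤ : (j ℕ.≤ᵇ suc (length (steps qs))) ≡ true) (middle : at (pt T) (steps qs) j ≡ aff (el e) 0K) where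
        open Torsion (el (ℤPt.X T)) (el (ℤPt.Y T)) (on-sound (pt T) onT) (steps qs) chain using (order; exact; multiples) renaming (T to T′)

        -- The only affine 2-torsion point is (e, 0), and `middle` locates it in the list of
        -- multiples as (j + 1)T.
        two-torsion-T : TwoTorsion (T′ ∷ [])
        two-torsion-T R h = [ (λ R≡0 → (+ 0 ∷ []) , trans R≡0 (sym (⊕-identityʳ 0E))) , affine ]′ (halves-of-O R h)
          where
          affine : ∃[ x ] (cubic-at x ≡ 0K × proj₁ R ≡ aff x 0K) → ∃[ w ] R ≡ combination w (T′ ∷ [])
          affine (x , c , r) = (+ suc j ∷ []) , trans (EPt-≡ (trans r (trans (cong (λ x → aff x 0K) (only-root x c))
            (sym (trans (multiples j (ℕₚ.≤ᵇ⇒≤ j _ (subst Bool.T (sym j≤) tt))) middle))))) (sym (⊕-identityʳ (suc j ·ℕ T′)))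

        rank-1 : ∀ p-2 → Obstructed p-2 T → (P PT : Undivided) (Λ : ℤ³) → Adds (U.Q P) Λ T (U.Q PT) → CubicRealizable (zmod order ∷ zz ∷ [])
        rank-1 p-2 ok P PT Λ s = realize (zmod order ∷ zz ∷ []) (T′ , ⟦ P ⟧ , tt) (proj₁ exact , tt)
          (cyclic-kernel {suc (length (steps qs))} {T′} {⟦ P ⟧} exact
            (indivisible-1-1 {⟦ P ⟧} {T′} {⟦ PT ⟧} (adds {U.Q P} {T} {U.Q PT} Λ s) ⟦ P ⟧-unhalved (unhalved p-2 T onT ok) ⟦ PT ⟧-unhalved)
            two-torsion-T) Δ≢0

    module Bicyclic (e e′ e″ : ℤ³) (root : does (cubic-at (el e) ≟K 0K) ≡ true) (root′ : does (cubic-at (el e′) ≟K 0K) ≡ true)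
                    (distinct : not (does (el e′ ≟K el e)) ≡ true) (third : does (el e″ ≟K (-K g₂ -K el e -K el e′)) ≡ true)
                    (simple : not (does (slope-at (el e) ≟K 0K)) ≡ true) (simple′ : not (does (slope-at (el e′) ≟K 0K)) ≡ true)
                    (simple″ : not (does (slope-at (el e″) ≟K 0K)) ≡ true) where
      roots : ∀ x → cubic-at x ≡ 0K → x ≡ el e ⊎ x ≡ el e′ ⊎ x ≡ el e″
      roots x h = decide (x ≟K el e) (x ≟K el e′)
        where
        decide : Dec (x ≡ el e) → Dec (x ≡ el e′) → x ≡ el e ⊎ x ≡ el e′ ⊎ x ≡ el e″
        decide (yes p) _ = inj₁ p
        decide _ (yes p) = inj₂ (inj₁ p)
        decide (no x≢e) (no x≢e′) = inj₂ (inj₂ (trans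
          (third-root (does-yes (cubic-at (el e) ≟K 0K) root) (does-yes (cubic-at (el e′) ≟K 0K) root′) (does-no (el e′ ≟K el e) distinct) h x≢e x≢e′)
          (sym (does-yes (el e″ ≟K (-K g₂ -K el e -K el e′)) third))))

      nonsingular : Nonsingular
      nonsingular x on = [ at-root (does-no (slope-at (el e) ≟K 0K) simple) , [ at-root (does-no (slope-at (el e′) ≟K 0K) simple′)
                         , at-root (does-no (slope-at (el e″) ≟K 0K) simple″) ]′ ]′ (roots x (on-axis x on))
        where
        at-root : ∀ {z} → slope-at z ≢ 0K → x ≡ z → slope-at x ≢ 0K
        at-root h refl = h

      open Realization nonsingular public

      S : ℤPt
      S = ⦅ e , [ + 0 , + 0 , + 0 ] ⦆

      module _ (onS : on? (pt S) ≡ true) (chainS : chain? (pt S) (pt S) [] ≡ true)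
               (T : ℤPt) (onT : on? (pt T) ≡ true) (qs : List ℤStep) (chain : chain? (pt T) (pt T) (steps qs) ≡ true) (Δ≢0 : Δ? ≡ true)
               (avoid : avoids? (el e) (el (ℤPt.X T)) (steps qs) ≡ true)
               (j : ℕ) (j≤ : (j ℕ.≤ᵇ suc (length (steps qs))) ≡ true) (middle : at (pt T) (steps qs) j ≡ aff (el e′) 0K)
               (Λ : ℤ³) (S+middle : sum? (pt S) (el Λ) (aff (el e′) 0K) (aff (el e″) 0K) ≡ true) where
        open Torsion (el (ℤPt.X T)) (el (ℤPt.Y T)) (on-sound (pt T) onT) (steps qs) chain using (order; exact; multiples; avoids) renaming (T to T′)
        open Torsion (el e) 0K (on-sound (pt S) onS) [] chainS using () renaming (T to S′; exact to exactS)

        middle-T : proj₁ (suc j ·ℕ T′) ≡ aff (el e′) 0K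
        middle-T = trans (multiples j (ℕₚ.≤ᵇ⇒≤ j _ (subst Bool.T (sym j≤) tt))) middle

        -- The three affine 2-torsion points are S, (j + 1)T and their sum, whose abscissas are e,
        -- e′ and e″ in this order.
        two-torsion-ST : TwoTorsion (S′ ∷ T′ ∷ [])
        two-torsion-ST R h = [ (λ R≡0 → (+ 0 ∷ + 0 ∷ []) , trans R≡0 (sym (trans (⊕-identityˡ _) (⊕-identityʳ 0E)))) , affine ]′ (halves-of-O R h)
          where
          affine : ∃[ x ] (cubic-at x ≡ 0K × proj₁ R ≡ aff x 0K) → ∃[ w ] R ≡ combination w (S′ ∷ T′ ∷ [])
          affine (x , c , r) = [ first , [ second , both ]′ ]′ (roots x c)
            where
            first : x ≡ el e → ∃[ w ] R ≡ combination w (S′ ∷ T′ ∷ [])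
            first p = (+ 1 ∷ + 0 ∷ []) , trans (EPt-≡ {R} {S′} (trans r (cong (λ x → aff x 0K) p)))
              (sym (trans (cong₂ _⊕_ (⊕-identityʳ S′) (⊕-identityʳ 0E)) (⊕-identityʳ S′)))
            second : x ≡ el e′ → ∃[ w ] R ≡ combination w (S′ ∷ T′ ∷ [])
            second p = (+ 0 ∷ + suc j ∷ []) , trans (EPt-≡ {R} {suc j ·ℕ T′} (trans r (trans (cong (λ x → aff x 0K) p) (sym middle-T))))
              (sym (trans (⊕-identityˡ _) (⊕-identityʳ (suc j ·ℕ T′))))
            both : x ≡ el e″ → ∃[ w ] R ≡ combination w (S′ ∷ T′ ∷ [])
            both p = (+ 1 ∷ + suc j ∷ []) , sym (trans (cong₂ _⊕_ (⊕-identityʳ S′) (⊕-identityʳ (suc j ·ℕ T′)))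
              (⊕-unique {S′} {suc j ·ℕ T′} {R} (subst (λ Q → Sum (pt S) Q (proj₁ R)) (sym middle-T)
                (subst (Sum (pt S) (aff (el e′) 0K)) (sym (trans r (cong (λ x → aff x 0K) p))) (sum-sound (pt S) (el Λ) (aff (el e′) 0K) (aff (el e″) 0K) S+middle)))))

        rank-1 : ∀ p-2 → Obstructed p-2 S → ∀ q-2 → Obstructed q-2 T → (P PS PT ST PST : Undivided)
          (Λ₁ : ℤ³) → Adds (U.Q P) Λ₁ S (U.Q PS) → (Λ₂ : ℤ³) → Adds (U.Q P) Λ₂ T (U.Q PT) →
          (Λ₃ : ℤ³) → Adds S Λ₃ T (U.Q ST) → (Λ₄ : ℤ³) → Adds (U.Q P) Λ₄ (U.Q ST) (U.Q PST) →
          CubicRealizable (zmod 2 ∷ zmod order ∷ zz ∷ [])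
        rank-1 p-2 okS q-2 okT P PS PT ST PST Λ₁ s₁ Λ₂ s₂ Λ₃ s₃ Λ₄ s₄ =
          realize (zmod 2 ∷ zmod order ∷ zz ∷ []) (S′ , T′ , ⟦ P ⟧ , tt) (proj₁ exactS , proj₁ exact , tt)
            (bicyclic-kernel {suc (length (steps qs))} {S′} {T′} {⟦ P ⟧} exactS exact (avoids (proj₂ S′) avoid)
              (indivisible-1-2 {⟦ P ⟧} {S′} {T′} {⟦ PS ⟧} {⟦ PT ⟧} {⟦ ST ⟧} {⟦ PST ⟧}
                (adds {U.Q P} {S} {U.Q PS} Λ₁ s₁) (adds {U.Q P} {T} {U.Q PT} Λ₂ s₂) (adds {S} {T} {U.Q ST} Λ₃ s₃) (adds {U.Q P} {U.Q ST} {U.Q PST} Λ₄ s₄)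
                ⟦ P ⟧-unhalved (unhalved p-2 S onS okS) (unhalved q-2 T onT okT) ⟦ PS ⟧-unhalved ⟦ PT ⟧-unhalved ⟦ ST ⟧-unhalved ⟦ PST ⟧-unhalved)
              two-torsion-ST) Δ≢0

-- The eight fields, curves and points

open import Defs
open IntegralModels
open OverK using (undivided)
open SubgroupShapes
open import Data.Integer using (ℤ; +_; -[1+_])
open import Data.List using (List; []; _∷_)
open import Data.List.Relation.Unary.All using (All; []; _∷_)
open import Data.Nat using (ℕ; zero; suc)
open import Relation.Binary.PropositionalEquality using (refl)

⁻_ : ℕ → ℤ
⁻ zero  = + 0
⁻ suc n = -[1+ n ]

module Order-11 where
  -- Here and in the next six curves the abscissa is translated so that x(T) = 0; thus g₀ is the
  -- square of y(T).
  T P Q PQ : ℤPt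
  T = ⦅ [ + 0 , + 0 , + 0 ] , [ + 13632 , ⁻ 4864 , + 448 ] ⦆
  P = ⦅ [ + 576 , + 240 , ⁻ 48 ] , [ ⁻ 960 , ⁻ 5216 , + 800 ] ⦆
  Q = ⦅ [ + 576 , + 384 , ⁻ 64 ] , [ ⁻ 1344 , + 3200 , ⁻ 320 ] ⦆
  PQ = ⦅ [ + 4256 , + 1120 , ⁻ 256 ] , [ ⁻ 220800 , ⁻ 53312 , + 12480 ] ⦆
  -- The slopes read the same in both directions: the line through T, kT and -(k + 1)T also serves
  -- the step from -(k + 1)T to -kT.
  chain : List ℤStep
  chain = ℤstep [ ⁻ 4 , + 37 , ⁻ 5 ] [ + 480 , + 352 , ⁻ 64 ] [ + 1536 , ⁻ 2368 , + 320 ]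
    ∷ ℤstep [ ⁻ 8 , + 23 , ⁻ 3 ] [ + 864 , + 512 , ⁻ 96 ] [ + 5376 , ⁻ 2560 , + 256 ]
    ∷ ℤstep [ ⁻ 4 , + 9 , ⁻ 1 ] [ + 864 , + 960 , ⁻ 160 ] [ ⁻ 1536 , + 7168 , ⁻ 1024 ]
    ∷ ℤstep [ + 8 , + 23 , ⁻ 3 ] [ + 480 , + 640 , ⁻ 96 ] [ ⁻ 3072 , ⁻ 1024 , + 0 ]
    ∷ ℤstep [ + 4 , + 29 , ⁻ 5 ] [ + 480 , + 640 , ⁻ 96 ] [ + 3072 , + 1024 , + 0 ]
    ∷ ℤstep [ + 8 , + 23 , ⁻ 3 ] [ + 864 , + 960 , ⁻ 160 ] [ + 1536 , ⁻ 7168 , + 1024 ]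
    ∷ ℤstep [ ⁻ 4 , + 9 , ⁻ 1 ] [ + 864 , + 512 , ⁻ 96 ] [ ⁻ 5376 , + 2560 , ⁻ 256 ]
    ∷ ℤstep [ ⁻ 8 , + 23 , ⁻ 3 ] [ + 480 , + 352 , ⁻ 64 ] [ ⁻ 1536 , + 2368 , ⁻ 320 ]
    ∷ ℤstep [ ⁻ 4 , + 37 , ⁻ 5 ] [ + 0 , + 0 , + 0 ] [ ⁻ 13632 , + 4864 , ⁻ 448 ]
    ∷ []
  realizable : CubicRealizable (zmod 11 ∷ zz ∷ zz ∷ [])
  -- Numbers before `refl` are primes minus 2. Here f is irreducible modulo 5, the cubic of the
  -- curve has no root modulo 3, and modulo 5 none of P, Q, P + Q can be halved. The last triple is
  -- the slope of the line through P and Q.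
  realizable = Shapes.Odd.rank-2 (⁻ 6) (⁻ 5) (⁻ 6) (irreducible-sound (⁻ 6) (⁻ 5) (⁻ 6) 3 refl)
    [ ⁻ 1784 , ⁻ 1598 , + 278 ]
    [ + 220416 , + 1295360 , ⁻ 192768 ]
    [ + 166907904 , ⁻ 147177472 , + 17952768 ]
    1 refl
    T refl chain refl refl
    (undivided P refl 3 refl) (undivided Q refl 3 refl) (undivided PQ refl 3 refl)
    [ + 60 , + 1 , ⁻ 1 ] refl

module Order-13 where
  T P : ℤPt
  T = ⦅ [ + 0 , + 0 , + 0 ] , [ ⁻ 864 , + 180 , ⁻ 180 ] ⦆
  P = ⦅ [ ⁻ 32 , ⁻ 20 , + 4 ] , [ + 1312 , ⁻ 368 , + 160 ] ⦆
  chain : List ℤStep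
  chain = ℤstep [ + 3 , + 3 , ⁻ 1 ] [ + 288 , ⁻ 60 , + 60 ] [ + 7200 , ⁻ 2904 , + 888 ]
    ∷ ℤstep [ + 3 , ⁻ 3 , + 1 ] [ + 0 , ⁻ 36 , + 12 ] [ ⁻ 1152 , + 384 , ⁻ 72 ]
    ∷ ℤstep [ + 3 , ⁻ 3 , ⁻ 1 ] [ + 0 , ⁻ 36 , + 36 ] [ + 0 , ⁻ 864 , + 0 ]
    ∷ ℤstep [ + 3 , + 1 , + 1 ] [ + 96 , ⁻ 20 , + 20 ] [ + 96 , + 304 , ⁻ 16 ]
    ∷ ℤstep [ + 15 , ⁻ 1 , ⁻ 1 ] [ + 216 , ⁻ 72 , + 0 ] [ ⁻ 648 , + 972 , + 396 ]
    ∷ ℤstep [ ⁻ 15 , + 0 , + 2 ] [ + 216 , ⁻ 72 , + 0 ] [ + 648 , ⁻ 972 , ⁻ 396 ]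
    ∷ ℤstep [ + 15 , ⁻ 1 , ⁻ 1 ] [ + 96 , ⁻ 20 , + 20 ] [ ⁻ 96 , ⁻ 304 , + 16 ]
    ∷ ℤstep [ + 3 , + 1 , + 1 ] [ + 0 , ⁻ 36 , + 36 ] [ + 0 , + 864 , + 0 ]
    ∷ ℤstep [ + 3 , ⁻ 3 , ⁻ 1 ] [ + 0 , ⁻ 36 , + 12 ] [ + 1152 , ⁻ 384 , + 72 ]
    ∷ ℤstep [ + 3 , ⁻ 3 , + 1 ] [ + 288 , ⁻ 60 , + 60 ] [ ⁻ 7200 , + 2904 , ⁻ 888 ]
    ∷ ℤstep [ + 3 , + 3 , ⁻ 1 ] [ + 0 , + 0 , + 0 ] [ + 864 , ⁻ 180 , + 180 ]
    ∷ []
  realizable : CubicRealizable (zmod 13 ∷ zz ∷ [])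
  -- f is irreducible modulo 5, 2-torsion is excluded modulo 5, and halving P is excluded modulo 11.
  realizable = Shapes.Odd.rank-1 (+ 1) (⁻ 2) (+ 24) (irreducible-sound (+ 1) (⁻ 2) (+ 24) 3 refl)
    [ ⁻ 111 , + 40 , ⁻ 48 ]
    [ + 38016 , ⁻ 16344 , + 4248 ]
    [ + 3079296 , ⁻ 1283040 , + 505440 ]
    3 refl
    T refl chain refl refl
    (undivided P refl 9 refl)

module Order-15 where
  T P : ℤPt
  T = ⦅ [ + 0 , + 0 , + 0 ] , [ ⁻ 24 , ⁻ 24 , + 8 ] ⦆
  P = ⦅ [ + 8 , + 4 , ⁻ 4 ] , [ ⁻ 8 , + 20 , ⁻ 28 ] ⦆
  chain : List ℤStep
  chain = ℤstep [ + 3 , ⁻ 1 , + 1 ] [ ⁻ 40 , + 32 , ⁻ 16 ] [ + 208 , ⁻ 80 , + 48 ]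
    ∷ ℤstep [ ⁻ 1 , + 3 , ⁻ 3 ] [ + 8 , + 0 , ⁻ 16 ] [ + 32 , + 96 , + 96 ]
    ∷ ℤstep [ + 7 , ⁻ 5 , + 5 ] [ + 40 , ⁻ 32 , + 16 ] [ ⁻ 576 , + 288 , ⁻ 160 ]
    ∷ ℤstep [ ⁻ 9 , + 3 , ⁻ 3 ] [ + 8 , + 16 , + 0 ] [ + 0 , + 48 , + 16 ]
    ∷ ℤstep [ + 7 , ⁻ 1 , + 1 ] [ ⁻ 8 , + 8 , ⁻ 8 ] [ + 96 , ⁻ 40 , + 40 ]
    ∷ ℤstep [ ⁻ 5 , + 5 , ⁻ 1 ] [ + 0 , ⁻ 4 , + 12 ] [ + 128 , + 84 , ⁻ 4 ]
    ∷ ℤstep [ + 5 , ⁻ 7 , + 1 ] [ + 0 , ⁻ 4 , + 12 ] [ ⁻ 128 , ⁻ 84 , + 4 ]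
    ∷ ℤstep [ ⁻ 5 , + 5 , ⁻ 1 ] [ ⁻ 8 , + 8 , ⁻ 8 ] [ ⁻ 96 , + 40 , ⁻ 40 ]
    ∷ ℤstep [ + 7 , ⁻ 1 , + 1 ] [ + 8 , + 16 , + 0 ] [ + 0 , ⁻ 48 , ⁻ 16 ]
    ∷ ℤstep [ ⁻ 9 , + 3 , ⁻ 3 ] [ + 40 , ⁻ 32 , + 16 ] [ + 576 , ⁻ 288 , + 160 ]
    ∷ ℤstep [ + 7 , ⁻ 5 , + 5 ] [ + 8 , + 0 , ⁻ 16 ] [ ⁻ 32 , ⁻ 96 , ⁻ 96 ]
    ∷ ℤstep [ ⁻ 1 , + 3 , ⁻ 3 ] [ ⁻ 40 , + 32 , ⁻ 16 ] [ ⁻ 208 , + 80 , ⁻ 48 ]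
    ∷ ℤstep [ + 3 , ⁻ 1 , + 1 ] [ + 0 , + 0 , + 0 ] [ + 24 , + 24 , ⁻ 8 ]
    ∷ []
  realizable : CubicRealizable (zmod 15 ∷ zz ∷ [])
  -- The primes are 3 for f, 7 for the 2-torsion and 3 for P.
  realizable = Shapes.Odd.rank-1 (⁻ 1) (+ 2) (+ 2) (irreducible-sound (⁻ 1) (+ 2) (+ 2) 1 refl)
    [ + 51 , ⁻ 38 , + 20 ]
    [ ⁻ 48 , ⁻ 32 , ⁻ 32 ]
    [ + 1216 , + 1664 , ⁻ 256 ]
    5 refl
    T refl chain refl refl
    (undivided P refl 1 refl)

module Order-16 where
  P T PT : ℤPt
  P = ⦅ [ ⁻ 576 , ⁻ 144 , ⁻ 144 ] , [ + 989568 , ⁻ 386784 , + 233568 ] ⦆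
  T = ⦅ [ + 0 , + 0 , + 0 ] , [ + 698112 , ⁻ 266112 , + 164160 ] ⦆
  PT = ⦅ [ + 1104 , ⁻ 570 , + 258 ] , [ + 165504 , ⁻ 63672 , + 38424 ] ⦆
  chain : List ℤStep
  chain = ℤstep [ ⁻ 46 , + 32 , ⁻ 16 ] [ + 1152 , ⁻ 576 , + 288 ] [ + 239616 , ⁻ 92160 , + 56448 ]
    ∷ ℤstep [ ⁻ 14 , + 16 , ⁻ 8 ] [ ⁻ 38784 , + 14784 , ⁻ 9120 ] [ ⁻ 14585856 , + 5624832 , ⁻ 3427584 ]
    ∷ ℤstep [ + 50 , ⁻ 16 , + 8 ] [ + 3456 , ⁻ 1728 , + 864 ] [ ⁻ 2198016 , + 850176 , ⁻ 518400 ]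
    ∷ ℤstep [ ⁻ 70 , + 32 , ⁻ 16 ] [ + 480 , ⁻ 384 , + 192 ] [ ⁻ 74688 , + 27264 , ⁻ 17088 ]
    ∷ ℤstep [ ⁻ 74 , + 40 , ⁻ 20 ] [ + 31680 , ⁻ 12384 , + 7488 ] [ + 29155968 , ⁻ 11242944 , + 6852672 ]
    ∷ ℤstep [ + 98 , ⁻ 28 , + 20 ] [ ⁻ 6912 , + 2448 , ⁻ 1584 ] [ + 5260032 , ⁻ 2027808 , + 1236384 ]
    ∷ ℤstep [ ⁻ 54 , + 27 , ⁻ 15 ] [ + 752 , ⁻ 562 , + 218 ] [ + 0 , + 0 , + 0 ]
    ∷ ℤstep [ ⁻ 54 , + 27 , ⁻ 15 ] [ ⁻ 6912 , + 2448 , ⁻ 1584 ] [ ⁻ 5260032 , + 2027808 , ⁻ 1236384 ]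
    ∷ ℤstep [ + 98 , ⁻ 28 , + 20 ] [ + 31680 , ⁻ 12384 , + 7488 ] [ ⁻ 29155968 , + 11242944 , ⁻ 6852672 ]
    ∷ ℤstep [ ⁻ 74 , + 40 , ⁻ 20 ] [ + 480 , ⁻ 384 , + 192 ] [ + 74688 , ⁻ 27264 , + 17088 ]
    ∷ ℤstep [ ⁻ 70 , + 32 , ⁻ 16 ] [ + 3456 , ⁻ 1728 , + 864 ] [ + 2198016 , ⁻ 850176 , + 518400 ]
    ∷ ℤstep [ + 50 , ⁻ 16 , + 8 ] [ ⁻ 38784 , + 14784 , ⁻ 9120 ] [ + 14585856 , ⁻ 5624832 , + 3427584 ]
    ∷ ℤstep [ ⁻ 14 , + 16 , ⁻ 8 ] [ + 1152 , ⁻ 576 , + 288 ] [ ⁻ 239616 , + 92160 , ⁻ 56448 ]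
    ∷ ℤstep [ ⁻ 46 , + 32 , ⁻ 16 ] [ + 0 , + 0 , + 0 ] [ ⁻ 698112 , + 266112 , ⁻ 164160 ]
    ∷ []
  realizable : CubicRealizable (zmod 16 ∷ zz ∷ [])
  -- The quadratic factor of the curve's cubic has no root modulo 7. Index 7 points at 8T, whose
  -- abscissa is the root e; T, P and P + T are treated modulo 5.
  realizable = Shapes.Cyclic.rank-1 (+ 4) (⁻ 5) (+ 24) (irreducible-sound (+ 4) (⁻ 5) (+ 24) 3 refl)
    [ + 50116 , ⁻ 18752 , + 11680 ]
    [ ⁻ 1025049600 , + 395407872 , ⁻ 240876288 ]
    [ + 5171294306304 , ⁻ 1994135666688 , + 1215417913344 ]
    [ + 752 , ⁻ 562 , + 218 ] refl refl 5 refl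
    T refl chain refl refl 7 refl refl
    3 refl (undivided P refl 3 refl) (undivided PT refl 3 refl)
    [ ⁻ 50 , + 25 , ⁻ 17 ] refl

module Order-20 where
  P T PT : ℤPt
  P = ⦅ [ + 1407 , ⁻ 300 , ⁻ 37 ] , [ + 79790 , ⁻ 21720 , ⁻ 2570 ] ⦆
  T = ⦅ [ + 0 , + 0 , + 0 ] , [ ⁻ 62576 , + 16440 , + 1976 ] ⦆
  PT = ⦅ [ ⁻ 2616 , + 796 , + 92 ] , [ + 130840 , ⁻ 35596 , ⁻ 4236 ] ⦆
  chain : List ℤStep
  chain = ℤstep [ + 419 , ⁻ 118 , ⁻ 14 ] [ + 352 , + 120 , + 8 ] [ ⁻ 229360 , + 66080 , + 7760 ]
    ∷ ℤstep [ ⁻ 235 , + 70 , + 8 ] [ ⁻ 17328 , + 4760 , + 568 ] [ ⁻ 266880 , + 72000 , + 8640 ]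
    ∷ ℤstep [ + 67 , ⁻ 18 , ⁻ 2 ] [ + 528 , ⁻ 40 , ⁻ 8 ] [ + 36672 , ⁻ 9600 , ⁻ 1152 ]
    ∷ ℤstep [ + 253 , ⁻ 66 , ⁻ 8 ] [ ⁻ 3984 , + 1160 , + 136 ] [ + 202656 , ⁻ 55248 , ⁻ 6576 ]
    ∷ ℤstep [ ⁻ 677 , + 186 , + 22 ] [ + 53856 , ⁻ 14560 , ⁻ 1736 ] [ + 5882352 , ⁻ 1599720 , ⁻ 190512 ]
    ∷ ℤstep [ + 625 , ⁻ 168 , ⁻ 20 ] [ ⁻ 648 , + 260 , + 28 ] [ ⁻ 16680 , + 4500 , + 540 ]
    ∷ ℤstep [ + 375 , ⁻ 100 , ⁻ 12 ] [ + 9872 , ⁻ 2600 , ⁻ 312 ] [ ⁻ 684160 , + 186080 , + 22160 ]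
    ∷ ℤstep [ ⁻ 367 , + 102 , + 12 ] [ ⁻ 10136 , + 2840 , + 336 ] [ ⁻ 389496 , + 105920 , + 12616 ]
    ∷ ℤstep [ + 191 , ⁻ 50 , ⁻ 6 ] [ + 464 , ⁻ 40 , ⁻ 8 ] [ + 0 , + 0 , + 0 ]
    ∷ ℤstep [ + 191 , ⁻ 50 , ⁻ 6 ] [ ⁻ 10136 , + 2840 , + 336 ] [ + 389496 , ⁻ 105920 , ⁻ 12616 ]
    ∷ ℤstep [ ⁻ 367 , + 102 , + 12 ] [ + 9872 , ⁻ 2600 , ⁻ 312 ] [ + 684160 , ⁻ 186080 , ⁻ 22160 ]
    ∷ ℤstep [ + 375 , ⁻ 100 , ⁻ 12 ] [ ⁻ 648 , + 260 , + 28 ] [ + 16680 , ⁻ 4500 , ⁻ 540 ]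
    ∷ ℤstep [ + 625 , ⁻ 168 , ⁻ 20 ] [ + 53856 , ⁻ 14560 , ⁻ 1736 ] [ ⁻ 5882352 , + 1599720 , + 190512 ]
    ∷ ℤstep [ ⁻ 677 , + 186 , + 22 ] [ ⁻ 3984 , + 1160 , + 136 ] [ ⁻ 202656 , + 55248 , + 6576 ]
    ∷ ℤstep [ + 253 , ⁻ 66 , ⁻ 8 ] [ + 528 , ⁻ 40 , ⁻ 8 ] [ ⁻ 36672 , + 9600 , + 1152 ]
    ∷ ℤstep [ + 67 , ⁻ 18 , ⁻ 2 ] [ ⁻ 17328 , + 4760 , + 568 ] [ + 266880 , ⁻ 72000 , ⁻ 8640 ]
    ∷ ℤstep [ ⁻ 235 , + 70 , + 8 ] [ + 352 , + 120 , + 8 ] [ + 229360 , ⁻ 66080 , ⁻ 7760 ]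
    ∷ ℤstep [ + 419 , ⁻ 118 , ⁻ 14 ] [ + 0 , + 0 , + 0 ] [ + 62576 , ⁻ 16440 , ⁻ 1976 ]
    ∷ []
  realizable : CubicRealizable (zmod 20 ∷ zz ∷ [])
  -- f is irreducible modulo 7, and index 9 points at 10T = (e, 0). The prime is 7 for the quadratic
  -- factor, T and P, and 13 for P + T.
  realizable = Shapes.Cyclic.rank-1 (+ 6) (⁻ 51) (+ 74) (irreducible-sound (+ 6) (⁻ 51) (+ 74) 5 refl)
    [ + 17737 , ⁻ 4980 , ⁻ 588 ]
    [ ⁻ 8431776 , + 2309840 , + 274576 ]
    [ + 841542400 , ⁻ 227722880 , ⁻ 27153920 ]
    [ + 464 , ⁻ 40 , ⁻ 8 ] refl refl 5 refl
    T refl chain refl refl 9 refl refl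
    5 refl (undivided P refl 5 refl) (undivided PT refl 11 refl)
    [ + 286 , ⁻ 76 , ⁻ 9 ] refl

module Order-2-10 where
  P T PS PT ST PST : ℤPt
  P = ⦅ [ ⁻ 780 , + 1020 , ⁻ 320 ] , [ + 3660 , + 5640 , ⁻ 4120 ] ⦆
  T = ⦅ [ + 0 , + 0 , + 0 ] , [ ⁻ 9720 , ⁻ 30780 , + 19440 ] ⦆
  PS = ⦅ [ ⁻ 648 , + 1080 , ⁻ 468 ] , [ ⁻ 6480 , ⁻ 324 , + 2268 ] ⦆
  PT = ⦅ [ + 216 , + 1224 , + 288 ] , [ + 51840 , + 29700 , + 30240 ] ⦆
  ST = ⦅ [ ⁻ 324 , + 864 , ⁻ 432 ] , [ ⁻ 4860 , + 1620 , + 0 ] ⦆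
  PST = ⦅ [ ⁻ 324 , + 1152 , ⁻ 504 ] , [ ⁻ 1620 , + 2700 , ⁻ 1080 ] ⦆
  chain : List ℤStep
  chain = ℤstep [ + 33 , ⁻ 30 , + 0 ] [ ⁻ 324 , + 756 , ⁻ 216 ] [ + 972 , ⁻ 3888 , + 3888 ]
    ∷ ℤstep [ + 33 , ⁻ 18 , + 6 ] [ ⁻ 540 , + 900 , ⁻ 360 ] [ ⁻ 1620 , ⁻ 2160 , + 2160 ]
    ∷ ℤstep [ + 21 , ⁻ 18 , + 0 ] [ ⁻ 432 , + 1080 , ⁻ 432 ] [ ⁻ 4536 , + 324 , + 1296 ]
    ∷ ℤstep [ + 24 , ⁻ 12 , + 0 ] [ ⁻ 405 , + 1080 , ⁻ 540 ] [ + 0 , + 0 , + 0 ]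
    ∷ ℤstep [ + 24 , ⁻ 12 , + 0 ] [ ⁻ 432 , + 1080 , ⁻ 432 ] [ + 4536 , ⁻ 324 , ⁻ 1296 ]
    ∷ ℤstep [ + 21 , ⁻ 18 , + 0 ] [ ⁻ 540 , + 900 , ⁻ 360 ] [ + 1620 , + 2160 , ⁻ 2160 ]
    ∷ ℤstep [ + 33 , ⁻ 18 , + 6 ] [ ⁻ 324 , + 756 , ⁻ 216 ] [ ⁻ 972 , + 3888 , ⁻ 3888 ]
    ∷ ℤstep [ + 33 , ⁻ 30 , + 0 ] [ + 0 , + 0 , + 0 ] [ + 9720 , + 30780 , ⁻ 19440 ]
    ∷ []
  realizable : CubicRealizable (zmod 2 ∷ zmod 10 ∷ zz ∷ [])
  realizable = Shapes.Bicyclic.rank-1 (⁻ 1) (+ 0) (⁻ 3) (irreducible-sound (⁻ 1) (+ 0) (⁻ 3) 5 refl)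
    [ + 1413 , ⁻ 2736 , + 1116 ]
    [ ⁻ 4140720 , ⁻ 1448280 , + 1963440 ]
    [ ⁻ 2361960000 , + 1732104000 , ⁻ 249318000 ]
    [ ⁻ 360 , + 900 , ⁻ 360 ] [ ⁻ 405 , + 1080 , ⁻ 540 ] [ ⁻ 648 , + 756 , ⁻ 216 ] refl refl refl refl refl refl refl
    -- Index 4 points at 5T = (e′, 0). The line joining it to S is the axis y = 0, hence the slope
    -- 0; the same holds for the two remaining curves.
    refl refl T refl chain refl refl refl 4 refl refl [ + 0 , + 0 , + 0 ] refl
    -- S is treated modulo 13 and T modulo 11; the subsums involving P, and S + T, carry the primes
    -- 7, 11 and 13.
    11 refl 9 refl
    (undivided P refl 9 refl) (undivided PS refl 5 refl) (undivided PT refl 11 refl) (undivided ST refl 5 refl) (undivided PST refl 5 refl)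
    [ ⁻ 3 , ⁻ 12 , + 8 ] refl
    [ + 9 , ⁻ 30 , ⁻ 4 ] refl
    [ + 27 , ⁻ 18 , + 0 ] refl
    [ ⁻ 9 , ⁻ 6 , + 8 ] refl

module Order-2-12 where
  P T PS PT ST PST : ℤPt
  P = ⦅ [ + 56 , + 8 , + 32 ] , [ ⁻ 24 , ⁻ 96 , + 88 ] ⦆
  T = ⦅ [ + 0 , + 0 , + 0 ] , [ ⁻ 352 , ⁻ 256 , ⁻ 264 ] ⦆
  PS = ⦅ [ ⁻ 24 , + 552 , ⁻ 384 ] , [ ⁻ 11368 , + 22496 , ⁻ 9816 ] ⦆
  PT = ⦅ [ + 176 , + 0 , ⁻ 28 ] , [ + 2088 , + 508 , ⁻ 1516 ] ⦆
  ST = ⦅ [ + 608 , ⁻ 400 , + 32 ] , [ + 15456 , ⁻ 14208 , + 2056 ] ⦆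
  PST = ⦅ [ + 5232 , + 1264 , + 3532 ] , [ ⁻ 602216 , ⁻ 144348 , ⁻ 407412 ] ⦆
  chain : List ℤStep
  chain = ℤstep [ ⁻ 9 , + 2 , + 5 ] [ + 192 , ⁻ 104 , + 64 ] [ + 2224 , ⁻ 1776 , + 480 ]
    ∷ ℤstep [ + 13 , + 0 , ⁻ 1 ] [ + 0 , + 32 , + 40 ] [ + 496 , ⁻ 152 , ⁻ 224 ]
    ∷ ℤstep [ ⁻ 1 , ⁻ 2 , + 7 ] [ + 64 , ⁻ 24 , + 52 ] [ + 232 , ⁻ 276 , + 92 ]
    ∷ ℤstep [ + 5 , + 2 , + 1 ] [ ⁻ 8 , ⁻ 32 , + 96 ] [ ⁻ 120 , + 496 , ⁻ 304 ]
    ∷ ℤstep [ + 3 , ⁻ 2 , + 5 ] [ + 48 , ⁻ 8 , + 48 ] [ + 0 , + 0 , + 0 ]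
    ∷ ℤstep [ + 3 , ⁻ 2 , + 5 ] [ ⁻ 8 , ⁻ 32 , + 96 ] [ + 120 , ⁻ 496 , + 304 ]
    ∷ ℤstep [ + 5 , + 2 , + 1 ] [ + 64 , ⁻ 24 , + 52 ] [ ⁻ 232 , + 276 , ⁻ 92 ]
    ∷ ℤstep [ ⁻ 1 , ⁻ 2 , + 7 ] [ + 0 , + 32 , + 40 ] [ ⁻ 496 , + 152 , + 224 ]
    ∷ ℤstep [ + 13 , + 0 , ⁻ 1 ] [ + 192 , ⁻ 104 , + 64 ] [ ⁻ 2224 , + 1776 , ⁻ 480 ]
    ∷ ℤstep [ ⁻ 9 , + 2 , + 5 ] [ + 0 , + 0 , + 0 ] [ + 352 , + 256 , + 264 ]
    ∷ []
  realizable : CubicRealizable (zmod 2 ∷ zmod 12 ∷ zz ∷ [])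
  realizable = Shapes.Bicyclic.rank-1 (⁻ 1) (+ 1) (⁻ 2) (irreducible-sound (⁻ 1) (+ 1) (⁻ 2) 1 refl)
    [ ⁻ 21 , + 73 , ⁻ 130 ]
    [ ⁻ 6176 , + 4176 , ⁻ 3408 ]
    [ + 533632 , + 114752 , + 386560 ]
    [ + 53 , + 7 , + 34 ] [ + 48 , ⁻ 8 , + 48 ] [ ⁻ 80 , ⁻ 72 , + 48 ] refl refl refl refl refl refl refl
    refl refl T refl chain refl refl refl 5 refl refl [ + 0 , + 0 , + 0 ] refl
    -- The prime 3 excludes halving for every subsum except P + S + T, which takes 5.
    1 refl 1 refl
    (undivided P refl 1 refl) (undivided PS refl 1 refl) (undivided PT refl 1 refl) (undivided ST refl 1 refl) (undivided PST refl 3 refl)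
    [ ⁻ 8 , ⁻ 8 , + 16 ] refl
    [ ⁻ 7 , + 0 , + 9 ] refl
    [ ⁻ 16 , + 8 , + 8 ] refl
    [ + 65 , + 4 , + 25 ] refl

-- The rational curve y² = x³ − 1415516937387147x + 20492177370058895480262 over the cyclic cubic field of
-- conductor 499, with x and y scaled by 53494828² and 53494828³ to make all points integral.
module Order-2-14 where
  P T PS PT ST PST : ℤPt
  P = ⦅ [ + 63786333456831797738544 , + 0 , + 0 ] , [ + 591646102870850622547256954437632 , + 0 , + 0 ] ⦆
  T = ⦅ [ ⁻ 40222098977720778731472 , + 56445454907918732619648 , + 3701341305437293942272 ] , [ ⁻ 85366056068923468558533697761509376 , + 49722763560978860592687596526018048 , + 3260509085965826924110662067279872 ] ⦆
  PS = ⦅ [ + 568717305722019526752048 , ⁻ 29428300948676992365888 , ⁻ 4038067194810062539968 ] , [ ⁻ 405877693545063201002619181756197888 , + 24888701915906238546184711561598208 , + 3046595395907581388936105316016896 ] ⦆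
  PT = ⦅ [ ⁻ 111294782813153981412816 , + 11164724778724460815104 , + 1254394637892977746176 ] , [ ⁻ 31740311927578018753242453990795264 , + 1928230045843768312241522765159424 , + 242032579015067704112912063198208 ] ⦆
  ST = ⦅ [ + 5427777122672513223216 , ⁻ 8842093118544646639872 , ⁻ 205630072524294107904 ] , [ ⁻ 23021170213031444645993462475036672 , ⁻ 708090357053184635034133681277952 , ⁻ 16467217605888014768235667006464 ] ⦆
  PST = ⦅ [ + 61979594439321321344760 , ⁻ 839580651810375046074 , + 92205216458072996607 ] , [ + 992656483600080066769573856160840 , ⁻ 436605515672620452850537813380762 , + 37753615051192141290489840220719 ] ⦆
  chain : List ℤStep
  chain = ℤstep [ ⁻ 681898572516 , + 136251326916 , + 12036336300 ] [ + 56012774963648863767600 , + 9870243481166117179392 , + 616890217572882323712 ] [ ⁻ 4742558670495748253251872097861632 , + 5532985115578372962127184114171904 , + 345811569723648310132949007135744 ]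
    ∷ ℤstep [ + 108968964636 , + 66708050516 , + 4761039692 ] [ ⁻ 106846242475592069692368 , + 14805365221749175769088 , + 1233780435145764647424 ] [ + 32012271025846300709450136660566016 , ⁻ 1185639667623937063312968024465408 , ⁻ 98803305635328088609414002038784 ]
    ∷ ℤstep [ ⁻ 393026501316 , + 109289933604 , + 6258894876 ] [ + 65266128227242098623280 , ⁻ 1542225543932205809280 , + 308445108786441161856 ] [ + 444614875358976398742363009174528 , ⁻ 864528924309120775332372517839360 , + 172905784861824155066474503567872 ]
    ∷ ℤstep [ ⁻ 577583657916 , + 99821349048 , + 9950038008 ] [ + 29178050499228482686128 , + 2416153352160455767872 , + 257037590655367634880 ] [ ⁻ 13116138823089803762899708770648576 , + 967449034345920867633845436629760 , + 102920110036800092301472918790400 ]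
    ∷ ℤstep [ + 456257388012 , + 36429977868 , + 2086298292 ] [ + 192962403264828739631664 , ⁻ 8328017937233911370112 , ⁻ 925335326359323485568 ] [ ⁻ 72027609808154176596262807486273536 , + 4668456191269252186794811596332544 , + 518717354585472465199423510703616 ]
    ∷ ℤstep [ ⁻ 763103721420 , + 121941460426 , + 9923290594 ] [ + 55730033613927959369232 , + 4127595309940778603448 , ⁻ 396266285593691770440 ] [ + 0 , + 0 , + 0 ]
    ∷ ℤstep [ ⁻ 763103721420 , + 121941460426 , + 9923290594 ] [ + 192962403264828739631664 , ⁻ 8328017937233911370112 , ⁻ 925335326359323485568 ] [ + 72027609808154176596262807486273536 , ⁻ 4668456191269252186794811596332544 , ⁻ 518717354585472465199423510703616 ]
    ∷ ℤstep [ + 456257388012 , + 36429977868 , + 2086298292 ] [ + 29178050499228482686128 , + 2416153352160455767872 , + 257037590655367634880 ] [ + 13116138823089803762899708770648576 , ⁻ 967449034345920867633845436629760 , ⁻ 102920110036800092301472918790400 ]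
    ∷ ℤstep [ ⁻ 577583657916 , + 99821349048 , + 9950038008 ] [ + 65266128227242098623280 , ⁻ 1542225543932205809280 , + 308445108786441161856 ] [ ⁻ 444614875358976398742363009174528 , + 864528924309120775332372517839360 , ⁻ 172905784861824155066474503567872 ]
    ∷ ℤstep [ ⁻ 393026501316 , + 109289933604 , + 6258894876 ] [ ⁻ 106846242475592069692368 , + 14805365221749175769088 , + 1233780435145764647424 ] [ ⁻ 32012271025846300709450136660566016 , + 1185639667623937063312968024465408 , + 98803305635328088609414002038784 ]
    ∷ ℤstep [ + 108968964636 , + 66708050516 , + 4761039692 ] [ + 56012774963648863767600 , + 9870243481166117179392 , + 616890217572882323712 ] [ + 4742558670495748253251872097861632 , ⁻ 5532985115578372962127184114171904 , ⁻ 345811569723648310132949007135744 ]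
    ∷ ℤstep [ ⁻ 681898572516 , + 136251326916 , + 12036336300 ] [ ⁻ 40222098977720778731472 , + 56445454907918732619648 , + 3701341305437293942272 ] [ + 85366056068923468558533697761509376 , ⁻ 49722763560978860592687596526018048 , ⁻ 3260509085965826924110662067279872 ]
    ∷ []
  realizable : CubicRealizable (zmod 2 ∷ zmod 14 ∷ zz ∷ [])
  realizable = Shapes.Bicyclic.rank-1 (+ 7) (⁻ 150) (+ 216) (irreducible-sound (+ 7) (⁻ 150) (+ 216) 3 refl)
    [ + 0 , + 0 , + 0 ]
    [ ⁻ 11592103557581719342300770093007809019154111232 , + 0 , + 0 ]
    [ + 480240606886928714669052549338493347480583260618284906837453860200448 , + 0 , + 0 ]
    [ + 93373188765406549497408 , ⁻ 17330759549938162781784 , ⁻ 1150243218182770166088 ] [ + 55730033613927959369232 , + 4127595309940778603448 , ⁻ 396266285593691770440 ] [ ⁻ 149103222379334508866640 , + 13203164239997384178336 , + 1546509503776461936528 ] refl refl refl refl refl refl refl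
    refl refl T refl chain refl refl refl 6 refl refl [ + 0 , + 0 , + 0 ] refl
    -- S needs the prime 7 and the rational point P the prime 31; all other subsums are settled
    -- modulo 5.
    5 refl 3 refl
    (undivided P refl 29 refl) (undivided PS refl 3 refl) (undivided PT refl 3 refl) (undivided ST refl 3 refl) (undivided PST refl 3 refl)
    [ + 912373332072 , ⁻ 61757965542 , ⁻ 6107930658 ] refl
    [ ⁻ 334761290148 , + 86474222964 , + 7829304012 ] refl
    [ ⁻ 477280855416 , + 77112794562 , + 7943981958 ] refl
    [ + 336690646788 , + 6271462938 , ⁻ 2653311243 ] refl

theorem3p3 : All CubicRealizable theGroups
theorem3p3 = Order-11.realizable ∷ Order-13.realizable ∷ Order-15.realizable ∷ Order-16.realizable
  ∷ Order-20.realizable ∷ Order-2-10.realizable ∷ Order-2-12.realizable ∷ Order-2-14.realizable ∷ []
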